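{- Let $q\ge 8$ be a prime power. Let $\mathrm{PG}(6,q)$ have hyperplane at infinity $\Sigma_\infty$ and let $\mathcal S$ be a regular 2-spread in $\Sigma_\infty$ with transversal lines $g,g^q,g^{q^2}$. Then an $r$-dimensional 3-special normal rational curve $\mathcal N_r$ in $\mathrm{PG}(6,q)$ is one of the following. 1. $r=6$ and $\mathcal N_6^\star\cap\Sigma_\infty^\star=\{P,P^q,P^{q^2},Q,Q^q,Q^{q^2}\}$ for some $P,Q\in g$, possibly repeated. 2. $r=6$ and $\mathcal N_6^{\star\star}\cap\Sigma_\infty^{\star\star}=\{P,P^q,P^{q^2},P^{q^3},P^{q^4},P^{q^5}\}$ for some $P\in g^{\star\star}\setminus g$. 3. $r=4$ and $\mathcal N_4\cap\Sigma_\infty=\{T\}$ and $\mathcal N_4^\star\cap\Sigma_\infty^\star=\{T,P,P^q,P^{q^2}\}$, $P\in g$, with $T\notin\langle P,P^q,P^{q^2}\rangle$. 4. $r=3$ and $\mathcal N_3^\star\cap\Sigma_\infty^\star=\{R,R^q,R^{q^2}\}$ where $R\in XY^q$ (the line joining $X$ and $Y^q$) for some distinct $X,Y\in g$, $R\ne X,Y^q$. 5. $r=2$ and $\mathcal N_2\cap\Sigma_\infty=\{P,Q\}$ with $P,Q\in\Sigma_\infty$ (possibly repeated). 6. $r=2$ and $\mathcal N_2^{\star\star}\cap\Sigma_\infty^{\star\star}=\{P,P^{q^3}\}$ with $P\in\Sigma_\infty^{\star\star}\setminus\Sigma_\infty^{\star}$, $P$ not in an extended transversal line.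
   Context: **Normal rational curves.** An $r$-dimensional normal rational curve ($r$-dim nrc) in $\mathrm{PG}(n,q)$, $q\ge r$, is a set of points lying in an $r$-space and projectively equivalent to $\{(1,\theta,\dots,\theta^r):\theta\in\mathbb F_q\}\cup\{(0,\dots,0,1)\}$; it extends naturally to an $r$-dim nrc over extension fields. An $r$-dim nrc $\mathcal N_r$ of $\mathrm{PG}(6,q)$ not contained in $\Sigma_\infty$ meets $\Sigma_\infty$ in $r$ points, possibly repeated or in an extension. **Extensions.** For a subspace or nrc $\mathcal K$ of $\mathrm{PG}(6,q)$, $\mathcal K^\star$ and $\mathcal K^{\star\star}$ denote its natural extensions to $\mathrm{PG}(6,q^3)$ and $\mathrm{PG}(6,q^6)$; $g^{\star\star}$ is the extension of the line $g$ of $\mathrm{PG}(6,q^3)$ to $\mathrm{PG}(6,q^6)$. $X^q$ is obtained from $X$ by raising coordinates to the $q$-th power. **Regular 2-spread.** A regular 2-spread $\mathcal S$ of $\Sigma_\infty\cong\mathrm{PG}(5,q)$ is obtained from a line $g$ of $\Sigma_\infty^\star\cong\mathrm{PG}(5,q^3)$ disjoint from $\Sigma_\infty$ such that $g,g^q,g^{q^2}$ span $\Sigma_\infty^\star$: its elements are the planes $\langle X,X^q,X^{q^2}\rangle\cap\Sigma_\infty$, $X\in g$. The lines $g,g^q,g^{q^2}$ are its transversal lines; their extensions to $\Sigma_\infty^{\star\star}\cong\mathrm{PG}(5,q^6)$ are the extended transversal lines, and the extensions of the planes of $\mathcal S$ are the extended planes of $\mathcal S$. **$\mathcal S$-good points.**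 For a point $P$ of $\Sigma_\infty^{\star\star}$: the weight is $w(P)=1$ if $P$ lies on an extended transversal line of $\mathcal S$; $w(P)=2$ if $w(P)\ne1$ and $P$ lies on a line meeting two of the extended transversal lines; $w(P)=3$ otherwise. $o(P)$ is the size of the orbit of $P$ under the collineation $X\mapsto X^q$. $s(P)=1$ if $P$ lies in an extended plane of $\mathcal S$, and $s(P)=2$ otherwise. $P$ is $\mathcal S$-good if $w(P)\times o(P)=3s(P)$. **3-special.** Let $\mathcal N_r$, $r\le6$, be an $r$-dim nrc of $\mathrm{PG}(6,q)$ not contained in $\Sigma_\infty$, meeting $\Sigma_\infty$ in the $r$ points $P_1,\dots,P_r$ (possibly repeated or in an extension). $\mathcal N_r$ is 3-special (with respect to $\mathcal S$) if $w(P_1)+\cdots+w(P_r)=6$ and each $P_i$ is $\mathcal S$-good. -}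

module Defs where

open import Level using (Level; _⊔_)
open import Algebra.Apartness.Bundles using (HeytingField; module HeytingCommutativeRing)
open import Algebra.Bundles using (CommutativeRing)
import Algebra.Apartness.Properties.HeytingCommutativeRing as HeytingProperties
import Algebra.Properties.Semiring.Exp as Exp
import Algebra.Properties.Semiring.Sum as Sum
open import Data.Bool.Base using (if_then_else_)
open import Data.Fin.Base as Fin using (Fin; toℕ; fromℕ)
import Data.Fin.Properties as Finₚ
open import Data.List.Base as List using (List; length; foldr)
open import Data.List.Relation.Binary.Pointwise using (Pointwise)
open import Data.List.Relation.Unary.All using (All)
open import Data.List.Relation.Unary.AllPairs using (AllPairs)
open import Data.List.Relation.Unary.Any using (Any)
open import Data.Maybe.Base using (Maybe; just; nothing)
import Data.Maybe.Relation.Unary.All as Maybe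
open import Data.Nat.Base as ℕ using (ℕ; zero; suc)
open import Data.Nat.Primality using (Prime)
open import Data.Product.Base using (Σ; ∃-syntax; _×_; _,_)
open import Data.Vec.Functional using (Vector; _++_)
open import Function.Bundles using (Inverse; _⇔_)
open import Relation.Binary.PropositionalEquality.Core using (_≡_; _≢_)
open import Relation.Binary.PropositionalEquality.Properties using (setoid)
open import Relation.Nullary.Decidable.Core using (does)
open import Relation.Nullary.Negation.Core using (¬_)

IsPrimePower : ℕ → Set
IsPrimePower q = ∃[ p ] ∃[ h ] (Prime p × q ≡ p ℕ.^ suc h)

HasCardinality : ∀ {c ℓ₁ ℓ₂} → HeytingField c ℓ₁ ℓ₂ → ℕ → Set (c ⊔ ℓ₁)
HasCardinality K n = Inverse (HeytingField.setoid K) (setoid (Fin n))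

-- K is meant to be the field with q ^ 6 elements. All the geometries PG(6,q),
-- PG(6,q³), PG(6,q⁶) are handled inside PG(6,q⁶) = PG(6,K): those over a smaller
-- field 𝔽 k (of q ^ k elements, for k dividing 6) consist of the points having a
-- coordinate vector over 𝔽 k. The natural extension of a subspace or of a curve
-- is given by the same generating vectors with coefficients taken in K.

module Geometry {c ℓ₁ ℓ₂ : Level} (K : HeytingField c ℓ₁ ℓ₂) (q : ℕ) where

  open HeytingField K public
    using (Carrier; _≈_; _#_; _+_; _*_; -_; _-_; 0#; 1#; heytingCommutativeRing)
  open HeytingCommutativeRing heytingCommutativeRing using (commutativeRing)
  open CommutativeRing commutativeRing using (semiring)
  open Exp semiring using (_^_)
  open Sum semiring using (sum)
  open HeytingProperties heytingCommutativeRing using (1#0; x#0y#0→xy#0)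

  𝔽 : ℕ → Carrier → Set ℓ₁
  𝔽 k x = x ^ (q ℕ.^ k) ≈ x

  V : Set c
  V = Vector Carrier 7

  Over : ℕ → V → Set ℓ₁
  Over k v = ∀ j → 𝔽 k (v j)

  combination : ∀ {m} → Vector Carrier m → Vector V m → V
  combination a v j = sum (λ i → a i * v i j)

  LinearlyIndependent : ∀ {m} → Vector V m → Set (c ⊔ ℓ₁)
  LinearlyIndependent v =
    ∀ a → (∀ j → combination a v j ≈ 0#) → ∀ i → a i ≈ 0#

  NonZero : V → Set ℓ₂
  NonZero v = ∃[ j ] (v j # 0#)

  infix 4 _∼_ _≈ₚ_ _≉ₚ_ _∈⟨_⟩ _∈PG_
  infixl 8 _^q^_

  _∼_ : V → V → Set (c ⊔ ℓ₁ ⊔ ℓ₂)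
  v ∼ w = ∃[ a ] (a # 0# × (∀ j → v j ≈ a * w j))

  record Point : Set (c ⊔ ℓ₂) where
    constructor point
    field
      coordinates : V
      nonZero     : NonZero coordinates
  open Point public

  _≈ₚ_ : Point → Point → Set (c ⊔ ℓ₁ ⊔ ℓ₂)
  P ≈ₚ Q = coordinates P ∼ coordinates Q

  _≉ₚ_ : Point → Point → Set (c ⊔ ℓ₁ ⊔ ℓ₂)
  P ≉ₚ Q = ¬ (P ≈ₚ Q)

  _∈PG_ : Point → ℕ → Set (c ⊔ ℓ₁ ⊔ ℓ₂)
  P ∈PG k = ∃[ v ] (Over k v × coordinates P ∼ v)

  _∈⟨_⟩ : ∀ {m} → Point → Vector V m → Set (c ⊔ ℓ₁)
  P ∈⟨ v ⟩ = ∃[ a ] (∀ j → coordinates P j ≈ combination a v j)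

  frobenius : ℕ → V → V
  frobenius i v j = v j ^ (q ℕ.^ i)

  ^-#0 : ∀ {x} → x # 0# → ∀ n → x ^ n # 0#
  ^-#0 x#0 zero    = 1#0
  ^-#0 x#0 (suc n) = x#0y#0→xy#0 x#0 (^-#0 x#0 n)

  -- P ^q^ i is P^(q^i).
  _^q^_ : Point → ℕ → Point
  point v (j , vj#0) ^q^ i = point (frobenius i v) (j , ^-#0 vj#0 (q ℕ.^ i))

  conjugates : Point → Vector V 3
  conjugates P i = coordinates (P ^q^ toℕ i)

  line : Point → Point → Vector V 2
  line P Q Fin.zero    = coordinates P
  line P Q (Fin.suc _) = coordinates Q

  -- Of projective dimension d, in PG(6,q^k). Independence over 𝔽 k and over K agree
  -- for vectors over 𝔽 k.
  record Subspace (k d : ℕ) : Set (c ⊔ ℓ₁) where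
    field
      basis       : Vector V (suc d)
      over        : ∀ i → Over k (basis i)
      independent : LinearlyIndependent basis

  -- A hyperplane of PG(6,q), given by the coefficients of its equation.
  record Hyperplane : Set (c ⊔ ℓ₁ ⊔ ℓ₂) where
    field
      coefficients : V
      over         : Over 1 coefficients
      nonZero      : NonZero coefficients

    form : V → Carrier
    form v = sum (λ j → coefficients j * v j)

  -- P ∈ Σ∞ ⟨ k ⟩ : P is a point of the extension of Σ∞ to PG(6,q^k).
  _∈_⟨_⟩ : Point → Hyperplane → ℕ → Set (c ⊔ ℓ₁ ⊔ ℓ₂)
  P ∈ Σ∞ ⟨ k ⟩ = P ∈PG k × Hyperplane.form Σ∞ (coordinates P) ≈ 0#

  module _ (g : Subspace 3 1) where

    transversalBasis : Fin 3 → Vector V 2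
    transversalBasis i l = frobenius (toℕ i) (Subspace.basis g l)

    ExtendedTransversal : Fin 3 → Point → Set (c ⊔ ℓ₁)
    ExtendedTransversal i P = P ∈⟨ transversalBasis i ⟩

  record RegularSpread (Σ∞ : Hyperplane) : Set (c ⊔ ℓ₁ ⊔ ℓ₂) where
    field
      g        : Subspace 3 1
      g⊂Σ∞     : ∀ P → P ∈⟨ Subspace.basis g ⟩ → Hyperplane.form Σ∞ (coordinates P) ≈ 0#
      disjoint : ∀ P → P ∈⟨ Subspace.basis g ⟩ → ¬ (P ∈ Σ∞ ⟨ 1 ⟩)
      spanning : ∀ P → P ∈ Σ∞ ⟨ 3 ⟩ →
                 P ∈⟨ transversalBasis g Fin.zero
                      ++ transversalBasis g (Fin.suc Fin.zero)
                      ++ transversalBasis g (Fin.suc (Fin.suc Fin.zero)) ⟩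

  module _ {Σ∞ : Hyperplane} (S : RegularSpread Σ∞) where

    open RegularSpread S using (g)

    -- OnG** P says P ∈ g**, and OnG P says P ∈ g.
    OnG** : Point → Set (c ⊔ ℓ₁)
    OnG** P = P ∈⟨ Subspace.basis g ⟩

    OnG : Point → Set (c ⊔ ℓ₁ ⊔ ℓ₂)
    OnG P = P ∈PG 3 × OnG** P

    OnExtendedTransversal : Point → Set (c ⊔ ℓ₁)
    OnExtendedTransversal P = ∃[ i ] ExtendedTransversal g i P

    -- A plane of PG(6,q) is an element of S if its set of points is that of
    -- ⟨X , X^q , X^(q²)⟩ ∩ Σ∞ for some X on g.
    SpreadElement : Subspace 1 2 → Set (c ⊔ ℓ₁ ⊔ ℓ₂)
    SpreadElement π = ∃[ X ] (OnG X × (∀ P →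
      (P ∈PG 1 × P ∈⟨ Subspace.basis π ⟩) ⇔ (P ∈⟨ conjugates X ⟩ × P ∈ Σ∞ ⟨ 1 ⟩)))

    InExtendedPlane : Point → Set (c ⊔ ℓ₁ ⊔ ℓ₂)
    InExtendedPlane P = ∃[ π ] (SpreadElement π × P ∈⟨ Subspace.basis π ⟩)

    OnLineMeetingTwoTransversals : Point → Set (c ⊔ ℓ₁ ⊔ ℓ₂)
    OnLineMeetingTwoTransversals P =
      Σ (Subspace 6 1) λ ℓ → P ∈⟨ Subspace.basis ℓ ⟩ ×
      (∃[ i ] ∃[ j ] (i ≢ j × Meets ℓ i × Meets ℓ j))
      where
      Meets : Subspace 6 1 → Fin 3 → Set (c ⊔ ℓ₁ ⊔ ℓ₂)
      Meets ℓ i = ∃[ X ] (X ∈⟨ Subspace.basis ℓ ⟩ × ExtendedTransversal g i X)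

    data Weight (P : Point) : ℕ → Set (c ⊔ ℓ₁ ⊔ ℓ₂) where
      w≡1 : OnExtendedTransversal P → Weight P 1
      w≡2 : ¬ OnExtendedTransversal P → OnLineMeetingTwoTransversals P → Weight P 2
      w≡3 : ¬ OnExtendedTransversal P → ¬ OnLineMeetingTwoTransversals P → Weight P 3

    data PlaneIndex (P : Point) : ℕ → Set (c ⊔ ℓ₁ ⊔ ℓ₂) where
      s≡1 : InExtendedPlane P → PlaneIndex P 1
      s≡2 : ¬ InExtendedPlane P → PlaneIndex P 2

    -- The collineation X ↦ X^q has finite order, so its nonnegative powers
    -- already give the whole orbit.
    OrbitSize : Point → ℕ → Set (c ⊔ ℓ₁ ⊔ ℓ₂)
    OrbitSize P n = ∃[ orbit ]
      ( AllPairs _≉ₚ_ orbit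
      × (∀ i → Any (P ^q^ i ≈ₚ_) orbit)
      × All (λ X → ∃[ i ] (X ≈ₚ P ^q^ i)) orbit
      × length orbit ≡ n )

    Good : Point → Set (c ⊔ ℓ₁ ⊔ ℓ₂)
    Good P = ∃[ w ] ∃[ o ] ∃[ s ]
      (Weight P w × OrbitSize P o × PlaneIndex P s × w ℕ.* o ≡ 3 ℕ.* s)

  -- just θ stands for (1,θ,…,θ^r) and nothing for (0,…,0,1).
  standard : (r : ℕ) → Maybe Carrier → Vector Carrier (suc r)
  standard r (just θ) i = θ ^ toℕ i
  standard r nothing  i = if does (i Finₚ.≟ fromℕ r) then 1# else 0#

  -- The curve spans the r-space with the given basis, and the basis provides the
  -- projectivity from PG(r,q) taking the standard curve to it.
  record NormalRationalCurve (r : ℕ) : Set (c ⊔ ℓ₁) where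
    field
      space : Subspace 1 r

    at : Maybe Carrier → V
    at u = combination (standard r u) (Subspace.basis space)

  -- X ∈ 𝒩 ⟪ k ⟫ : X is a point of the extension of 𝒩 to PG(6,q^k).
  _∈_⟪_⟫ : ∀ {r} → Point → NormalRationalCurve r → ℕ → Set (c ⊔ ℓ₁ ⊔ ℓ₂)
  X ∈ 𝒩 ⟪ k ⟫ =
    ∃[ u ] (Maybe.All (𝔽 k) u × coordinates X ∼ NormalRationalCurve.at 𝒩 u)

  linearFactor : Carrier → Maybe Carrier → Carrier
  linearFactor θ (just u) = θ - u
  linearFactor θ nothing  = 1#

  -- Substituting (1,θ,…,θ^r) in the equation of Σ∞ gives a polynomial in θ of
  -- degree at most r whose roots are the parameters of the intersection points;
  -- the parameter nothing counts r minus the degree times. As r ≤ 6 < ∣K∣,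
  -- equality of polynomials amounts to equality of the values on K.
  MeetsWithMultiplicity : ∀ {r} → Hyperplane → NormalRationalCurve r → List Point →
                          Set (c ⊔ ℓ₁ ⊔ ℓ₂)
  MeetsWithMultiplicity {r} Σ∞ 𝒩 Ps = ∃[ us ]
    ( length us ≡ r
    × Pointwise (λ P u → coordinates P ∼ at u) Ps us
    × ∃[ a ] (a # 0# × (∀ θ →
        form (at (just θ)) ≈ a * foldr (λ u x → linearFactor θ u * x) 1# us)) )
    where
    open NormalRationalCurve 𝒩 using (at)
    open Hyperplane Σ∞ using (form)

  CommonPoints : ∀ {r} → ℕ → Hyperplane → NormalRationalCurve r → List Point →
                 Set (c ⊔ ℓ₁ ⊔ ℓ₂)
  CommonPoints k Σ∞ 𝒩 Ps =
    ∀ X → (X ∈ 𝒩 ⟪ k ⟫ × X ∈ Σ∞ ⟨ k ⟩) ⇔ Any (X ≈ₚ_) Ps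

  -- All r points of intersection lie in PG(6,q^k), and Ps lists them with
  -- multiplicities.
  IntersectionIs : ∀ {r} → ℕ → Hyperplane → NormalRationalCurve r → List Point →
                   Set (c ⊔ ℓ₁ ⊔ ℓ₂)
  IntersectionIs k Σ∞ 𝒩 Ps =
    CommonPoints k Σ∞ 𝒩 Ps × MeetsWithMultiplicity Σ∞ 𝒩 Ps

  ThreeSpecial : ∀ {Σ∞ r} → RegularSpread Σ∞ → NormalRationalCurve r →
                 Set (c ⊔ ℓ₁ ⊔ ℓ₂)
  ThreeSpecial {Σ∞} {r} S 𝒩 =
    r ℕ.≤ 6 ×
    ¬ (∀ X → X ∈ 𝒩 ⟪ 1 ⟫ → X ∈ Σ∞ ⟨ 1 ⟩) ×
    (∃[ Ps ] ( MeetsWithMultiplicity Σ∞ 𝒩 Ps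
             × (∃[ ws ] (Pointwise (Weight S) Ps ws × List.sum ws ≡ 6))
             × All (Good S) Ps ))

{-# OPTIONS --safe #-}
module Submission where

-- The equation of Σ∞, restricted to the curve, is a polynomial over GF(q) of degree
-- at most r whose roots, with the parameter at infinity, are the r intersection
-- points. By unique factorisation this multiset is stable under X ↦ X^q, so it is a
-- union of orbits. Goodness leaves five possibilities for weight and orbit size, and
-- the orbits have total weight 3 (weight 1 and size 3, or weight 3 and size 1) or 6
-- (all others); adding up to 6 gives the six cases.
--
-- The transversals span Σ∞, a space of dimension six, so they are independent. A
-- point R of weight 2 fixed by X ↦ X^(q³) is therefore a sum of two points with the
-- same property on two transversals, and if these were X and X^q then R would be in
-- the extended plane through X, contrary to s(R) = 2. In case 3 a point T in the
-- plane of P, P^q, P^(q²) would be dependent on three other points of a normal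
-- rational curve of dimension four.

open import Defs
import Algebra.Apartness.Properties.HeytingCommutativeRing as HeytingProperties
open import Algebra.Apartness.Bundles using (HeytingField; module HeytingCommutativeRing)
open import Algebra.Bundles using (CommutativeRing)
import Algebra.Properties.CommutativeMonoid.Sum as MonoidSum
import Algebra.Properties.CommutativeSemiring.Binomial as Binomial
import Algebra.Properties.CommutativeSemiring.Exp as ExpProperties
import Algebra.Properties.Ring as RingProperties
import Algebra.Properties.Semiring.Mult as MultProperties
import Algebra.Properties.Semiring.Sum as SumProperties
open import Algebra.Solver.Ring.AlmostCommutativeRing using (AlmostCommutativeRing; fromCommutativeRing; _-Raw-AlmostCommutative⟶_)
open import Data.Bool.Base using (true; false; if_then_else_)
open import Data.Empty using (⊥-elim)
open import Data.Fin.Base as Fin using (Fin; zero; suc; toℕ; fromℕ; fromℕ<; inject₁; inject≤; punchIn; funToFin; finToFun)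
open import Data.Fin.Patterns using (0F; 1F; 2F; 3F; 4F; 5F)
open import Data.Fin.Permutation using (Permutation′; permutation)
import Data.Fin.Properties as Finₚ
open import Data.Integer.Base as ℤ using (ℤ; +_; -[1+_])
import Data.Integer.Properties as ℤₚ
open import Data.List.Base as List using (List; []; _∷_; length; foldr; map; _++_; lookup; applyUpTo)
open import Data.List.Membership.Propositional.Properties using (∈-lookup)
import Data.List.Membership.Setoid as Membership
open import Data.List.Membership.Setoid.Properties using (∈-map⁺; ∈-resp-≈)
import Data.List.Properties as Listₚ
import Data.List.Relation.Binary.Permutation.Setoid as Permutation
import Data.List.Relation.Binary.Permutation.Setoid.Properties as Permutationₚ
open import Data.List.Relation.Binary.Pointwise using (Pointwise; []; _∷_)
open import Data.List.Relation.Unary.All as All using (All; []; _∷_)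
import Data.List.Relation.Unary.All.Properties as Allₚ
open import Data.List.Relation.Unary.AllPairs as AllPairs using (AllPairs; []; _∷_)
import Data.List.Relation.Unary.AllPairs.Properties as AllPairsₚ
open import Data.List.Relation.Unary.Any as Any using (Any; here; there)
import Data.List.Relation.Unary.Any.Properties as Anyₚ
open import Data.Maybe.Base as Maybe using (Maybe; just; nothing)
open import Data.Maybe.Relation.Binary.Pointwise as Maybeₚ using (just; nothing)
import Data.Maybe.Relation.Unary.All as MaybeAll
open import Data.Nat.Base as ℕ using (ℕ; zero; suc; _!)
import Data.Nat.Combinatorics as Combinatorics
open import Data.Nat.Divisibility using (_∣_; _∤_; _∣?_; divides; m∣m*n; ∣⇒≤; ∣1⇒≡1)
open import Data.Nat.DivMod using (_%_; _/_; m≡m%n+[m/n]*n; m%n<n; m/n*n≡m)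
import Data.Nat.ListAction as ListAction
open import Data.Nat.Primality using (Prime; euclidsLemma; prime⇒nonTrivial; prime⇒nonZero)
import Data.Nat.Properties as ℕₚ
open import Data.Product.Base using (∃-syntax; _×_; _,_; proj₁; proj₂)
open import Data.Sum.Base using (_⊎_; inj₁; inj₂)
open import Data.Vec.Functional as Vector using (Vector; replicate; removeAt; tail)
open import Function.Base using (_∘_)
open import Function.Bundles using (Inverse; mk⇔)
open import Level using (_⊔_)
open import Relation.Binary.Bundles using (Setoid)
open import Relation.Binary.Definitions using (Decidable; tri<; tri≈; tri>)
open import Relation.Binary.PropositionalEquality.Core as ≡ using (_≡_; _≢_)
import Relation.Binary.Reasoning.Setoid as SetoidReasoning
open import Relation.Nullary.Decidable using (yes; no; does; map′; dec-true; dec-false; from-no)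
open import Relation.Nullary.Negation.Core using (¬_; contradiction)

-- The field is given only as a set in bijection with `Fin (q ^ 6)`. Decidable equality,
-- characteristic p, the identity x^(q^6) = x and additivity of Frobenius all have to come from that
-- bijection, and a pigeonhole count of coefficient vectors takes the place of elimination and
-- dimension theory.
--
-- The orbits are computed on parameters in K and infinity, not on points. The curve has a basis
-- over GF(q), so conjugating a point conjugates its parameter, and the parametrisation is
-- injective. Lists up to permutation keep track of repeated intersection points, and the parameter
-- at infinity appears as a drop in degree.
--
-- Polynomials are functions with a bound on the number of their coefficients. An identity of
-- functions can be divided by θ - u only away from u, and recovering it at u takes a degree below
-- the size of K; this is where r ≤ 6 and 8 ≤ q meet.
--
-- Transversals carry natural number indices, read modulo 3, so Frobenius adds to the index and any
-- statement about a transversal can be rotated back to g.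

-- Ring solver with integer coefficients

module IntegerSolver {c ℓ} (R : CommutativeRing c ℓ) where
  open CommutativeRing R
  open import Algebra.Properties.Ring ring using (-0#≈0#; -‿involutive; -‿distribˡ-*; -‿distribʳ-*)
  open import Algebra.Properties.AbelianGroup +-abelianGroup using (⁻¹-∙-comm)
  open import Algebra.Properties.Semiring.Mult.TCOptimised semiring using (×-homo-+; ×1-homo-*) renaming (_×_ to _×#_)
  open SetoidReasoning setoid

  ⟦_⟧ : ℤ → Carrier
  ⟦ + n ⟧      = n ×# 1#
  ⟦ -[1+ n ] ⟧ = - (suc n ×# 1#)

  ⟦-⟧ : ∀ i → ⟦ ℤ.- i ⟧ ≈ - ⟦ i ⟧
  ⟦-⟧ (+ zero)   = sym -0#≈0#
  ⟦-⟧ (+ suc n)  = refl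
  ⟦-⟧ (-[1+ n ]) = sym (-‿involutive _)

  private
    cancel : ∀ x y z → (x + y) - (x + z) ≈ y - z
    cancel x y z = begin
      (x + y) - (x + z)      ≈⟨ +-cong (+-comm y x) (⁻¹-∙-comm x z) ⟨
      (y + x) + (- x - z)    ≈⟨ +-assoc y x _ ⟩
      y + (x + (- x - z))    ≈⟨ +-congˡ (+-assoc x (- x) (- z)) ⟨
      y + (x - x - z)        ≈⟨ +-congˡ (+-congʳ (-‿inverseʳ x)) ⟩
      y + (0# - z)           ≈⟨ +-congˡ (+-identityˡ _) ⟩
      y - z                  ∎

  ⟦⊖⟧ : ∀ m n → ⟦ m ℤ.⊖ n ⟧ ≈ m ×# 1# - n ×# 1#
  ⟦⊖⟧ m       zero    = sym (trans (+-congˡ -0#≈0#) (+-identityʳ _))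
  ⟦⊖⟧ zero    (suc n) = sym (+-identityˡ _)
  ⟦⊖⟧ (suc m) (suc n) = begin
    ⟦ suc m ℤ.⊖ suc n ⟧                    ≡⟨ ≡.cong ⟦_⟧ (ℤₚ.[1+m]⊖[1+n]≡m⊖n m n) ⟩
    ⟦ m ℤ.⊖ n ⟧                            ≈⟨ ⟦⊖⟧ m n ⟩
    m ×# 1# - n ×# 1#                        ≈⟨ cancel 1# _ _ ⟨
    (1# + m ×# 1#) - (1# + n ×# 1#)          ≈⟨ +-cong (×-homo-+ 1# 1 m) (-‿cong (×-homo-+ 1# 1 n)) ⟨
    suc m ×# 1# - suc n ×# 1#                ∎

  ⟦+⟧ : ∀ i j → ⟦ i ℤ.+ j ⟧ ≈ ⟦ i ⟧ + ⟦ j ⟧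
  ⟦+⟧ (+ m)      (+ n)      = ×-homo-+ 1# m n
  ⟦+⟧ (+ m)      (-[1+ n ]) = ⟦⊖⟧ m (suc n)
  ⟦+⟧ (-[1+ m ]) (+ n)      = trans (⟦⊖⟧ n (suc m)) (+-comm _ _)
  ⟦+⟧ (-[1+ m ]) (-[1+ n ]) = begin
    - (suc (suc (m ℕ.+ n)) ×# 1#)          ≡⟨ ≡.cong (λ k → - (suc k ×# 1#)) (ℕₚ.+-suc m n) ⟨
    - ((suc m ℕ.+ suc n) ×# 1#)            ≈⟨ -‿cong (×-homo-+ 1# (suc m) (suc n)) ⟩
    - (suc m ×# 1# + suc n ×# 1#)           ≈⟨ ⁻¹-∙-comm _ _ ⟨
    - (suc m ×# 1#) - suc n ×# 1#           ∎

  ⟦+*⟧ : ∀ m j → ⟦ + m ℤ.* j ⟧ ≈ m ×# 1# * ⟦ j ⟧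
  ⟦+*⟧ m (+ n) = begin
    ⟦ + m ℤ.* + n ⟧     ≡⟨ ≡.cong ⟦_⟧ (ℤₚ.pos-* m n) ⟨
    (m ℕ.* n) ×# 1#      ≈⟨ ×1-homo-* m n ⟩
    m ×# 1# * (n ×# 1#)   ∎
  ⟦+*⟧ m -[1+ n ] = begin
    ⟦ + m ℤ.* (ℤ.- + suc n) ⟧   ≡⟨ ≡.cong ⟦_⟧ (ℤₚ.neg-distribʳ-* (+ m) (+ suc n)) ⟨
    ⟦ ℤ.- (+ m ℤ.* + suc n) ⟧   ≈⟨ ⟦-⟧ (+ m ℤ.* + suc n) ⟩
    - ⟦ + m ℤ.* + suc n ⟧       ≈⟨ -‿cong (⟦+*⟧ m (+ suc n)) ⟩
    - (m ×# 1# * (suc n ×# 1#))   ≈⟨ -‿distribʳ-* _ _ ⟩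
    m ×# 1# * - (suc n ×# 1#)     ∎

  ⟦*⟧ : ∀ i j → ⟦ i ℤ.* j ⟧ ≈ ⟦ i ⟧ * ⟦ j ⟧
  ⟦*⟧ (+ m)    j = ⟦+*⟧ m j
  ⟦*⟧ -[1+ m ] j = begin
    ⟦ (ℤ.- + suc m) ℤ.* j ⟧    ≡⟨ ≡.cong ⟦_⟧ (ℤₚ.neg-distribˡ-* (+ suc m) j) ⟨
    ⟦ ℤ.- (+ suc m ℤ.* j) ⟧    ≈⟨ ⟦-⟧ (+ suc m ℤ.* j) ⟩
    - ⟦ + suc m ℤ.* j ⟧        ≈⟨ -‿cong (⟦+*⟧ (suc m) j) ⟩
    - (suc m ×# 1# * ⟦ j ⟧)     ≈⟨ -‿distribˡ-* _ _ ⟩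
    - (suc m ×# 1#) * ⟦ j ⟧     ∎

  almostCommutativeRing : AlmostCommutativeRing c ℓ
  almostCommutativeRing = fromCommutativeRing R

  morphism : ℤ.+-*-rawRing -Raw-AlmostCommutative⟶ almostCommutativeRing
  morphism = record
    { ⟦_⟧ = ⟦_⟧ ; +-homo = ⟦+⟧ ; *-homo = ⟦*⟧ ; -‿homo = ⟦-⟧ ; 0-homo = refl ; 1-homo = refl }

  -- Only equality as integers is tested. Distinct integers may agree in the ring, but the answer
  -- `nothing` then merely leaves terms unmerged, so soundness is unaffected.
  _coeff≟_ : ∀ i j → Maybe (⟦ i ⟧ ≈ ⟦ j ⟧)
  i coeff≟ j with i ℤₚ.≟ j
  ... | yes ≡.refl = just refl
  ... | no _       = nothing

  open import Algebra.Solver.Ring ℤ.+-*-rawRing almostCommutativeRing morphism _coeff≟_ public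
    using (solve; _:=_; _:+_; _:*_; :-_; _:-_; con)

-- Finite fields: decidability, characteristic and the identity a^N = a

module FiniteField {c ℓ₁ ℓ₂} (K : HeytingField c ℓ₁ ℓ₂) (N : ℕ) (card : HasCardinality K N) where

  open HeytingField K hiding (zero)
  open HeytingCommutativeRing heytingCommutativeRing using (commutativeRing)
  open CommutativeRing commutativeRing
    using (ring; semiring; commutativeSemiring; +-commutativeMonoid; *-commutativeMonoid)
  open HeytingProperties heytingCommutativeRing using (1#0; x-0≈x; invertibleˡ⇒#)
  open RingProperties ring using (x∙y⁻¹≈ε⇒x≈y; +-cancelˡ)
  open ExpProperties commutativeSemiring using (_^_)
  open MultProperties semiring renaming (_×_ to _×#_)
  open SetoidReasoning setoid
  open Inverse card using (to; from; to-cong; strictlyInverseˡ; strictlyInverseʳ)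

  module +Sum = MonoidSum +-commutativeMonoid
  module *Sum = MonoidSum *-commutativeMonoid

  1≉0 : ¬ 1# ≈ 0#
  1≉0 1≈0 = proj₂ (tight 1# 0#) 1≈0 1#0

  to-injective : ∀ {x y} → to x ≡ to y → x ≈ y
  to-injective {x} {y} eq = begin
    x             ≈⟨ strictlyInverseʳ x ⟨
    from (to x)   ≡⟨ ≡.cong from eq ⟩
    from (to y)   ≈⟨ strictlyInverseʳ y ⟩
    y             ∎

  from-injective : ∀ {i j} → from i ≈ from j → i ≡ j
  from-injective {i} {j} eq = ≡.trans (≡.sym (strictlyInverseˡ i)) (≡.trans (to-cong eq) (strictlyInverseˡ j))

  _≟_ : Decidable _≈_
  x ≟ y = map′ to-injective to-cong (to x Finₚ.≟ to y)

  -- Invertibility can be searched for, so apartness is decidable, and tightness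
  -- then turns inequality into apartness.
  ≉⇒# : ∀ {x} → ¬ x ≈ 0# → x # 0#
  ≉⇒# {x} x≉0 with Finₚ.any? (λ i → (from i * x) ≟ 1#)
  ... | yes (i , eq) = invertibleˡ⇒# (from i , trans (*-congˡ (x-0≈x x)) eq)
  ... | no ∄ = ⊥-elim (x≉0 (proj₁ (tight x 0#) λ x#0 →
          let y , yx≈1 , _ = #⇒invertible x#0 in
          ∄ (to y , trans (*-cong (strictlyInverseʳ y) (sym (x-0≈x x))) yx≈1)))

  #⇒≉ : ∀ {x} → x # 0# → ¬ x ≈ 0#
  #⇒≉ x#0 x≈0 = proj₂ (tight _ _) x≈0 x#0

  inverse : ∀ {x} → ¬ x ≈ 0# → ∃[ y ] y * x ≈ 1#
  inverse {x} x≉0 = let y , yx≈1 , _ = #⇒invertible (≉⇒# x≉0) in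
    y , trans (*-congˡ (sym (x-0≈x x))) yx≈1

  *-cancelˡ-≉ : ∀ {x y z} → ¬ x ≈ 0# → x * y ≈ x * z → y ≈ z
  *-cancelˡ-≉ {x} {y} {z} x≉0 eq = let w , wx≈1 = inverse x≉0 in begin
    y             ≈⟨ *-identityˡ y ⟨
    1# * y        ≈⟨ *-congʳ wx≈1 ⟨
    w * x * y     ≈⟨ *-assoc w x y ⟩
    w * (x * y)   ≈⟨ *-congˡ eq ⟩
    w * (x * z)   ≈⟨ *-assoc w x z ⟨
    w * x * z     ≈⟨ *-congʳ wx≈1 ⟩
    1# * z        ≈⟨ *-identityˡ z ⟩
    z             ∎

  xy≈0⇒y≈0 : ∀ {x y} → ¬ x ≈ 0# → x * y ≈ 0# → y ≈ 0#
  xy≈0⇒y≈0 x≉0 xy≈0 = *-cancelˡ-≉ x≉0 (trans xy≈0 (sym (zeroʳ _)))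

  *-≉0 : ∀ {x y} → ¬ x ≈ 0# → ¬ y ≈ 0# → ¬ x * y ≈ 0#
  *-≉0 x≉0 y≉0 xy≈0 = y≉0 (xy≈0⇒y≈0 x≉0 xy≈0)

  x-y≈0⇒x≈y : ∀ {x y} → x - y ≈ 0# → x ≈ y
  x-y≈0⇒x≈y = x∙y⁻¹≈ε⇒x≈y _ _

  ^-≉0 : ∀ {x} → ¬ x ≈ 0# → ∀ m → ¬ x ^ m ≈ 0#
  ^-≉0 x≉0 zero    = 1≉0
  ^-≉0 x≉0 (suc m) = *-≉0 x≉0 (^-≉0 x≉0 m)

  ^-≈0 : ∀ {x} m → x ^ m ≈ 0# → x ≈ 0#
  ^-≈0 {x} m xᵐ≈0 with x ≟ 0#
  ... | yes x≈0 = x≈0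
  ... | no x≉0  = contradiction xᵐ≈0 (^-≉0 x≉0 m)

  -- Carries a bijection of K over to the index set, so that finite sums and products over K can be
  -- reindexed along it.
  shuffle : (f g : Carrier → Carrier) → (∀ {x y} → x ≈ y → f x ≈ f y) → (∀ {x y} → x ≈ y → g x ≈ g y) →
            (∀ x → f (g x) ≈ x) → (∀ x → g (f x) ≈ x) → Permutation′ N
  shuffle f g f-cong g-cong fg gf = permutation (to ∘ f ∘ from) (to ∘ g ∘ from)
    (λ i → ≡.trans (to-cong (trans (f-cong (strictlyInverseʳ _)) (fg _))) (strictlyInverseˡ i))
    (λ i → ≡.trans (to-cong (trans (g-cong (strictlyInverseʳ _)) (gf _))) (strictlyInverseˡ i))

  -- Adding 1 permutes K, so the sum of all elements equals itself plus N times 1.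
  N×1≈0 : N ×# 1# ≈ 0#
  N×1≈0 = sym (+-cancelˡ (sum from) _ _ (begin
    sum from + 0#                           ≈⟨ +-identityʳ _ ⟩
    sum from                                ≈⟨ sum-permute from π ⟩
    sum (from ∘ to ∘ (_+ 1#) ∘ from)        ≈⟨ sum-cong-≋ {N} (λ i → strictlyInverseʳ (from i + 1#)) ⟩
    sum (λ i → from i + 1#)                 ≈⟨ ∑-distrib-+ from (λ _ → 1#) ⟩
    sum from + sum (replicate N 1#)         ≈⟨ +-congˡ (sum-replicate N) ⟩
    sum from + N ×# 1#                      ∎))
    where
    open +Sum
    π = shuffle (_+ 1#) (_- 1#) +-congʳ +-congʳ
          (λ x → trans (+-assoc x _ _) (trans (+-congˡ (-‿inverseˡ 1#)) (+-identityʳ x)))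
          (λ x → trans (+-assoc x _ _) (trans (+-congˡ (-‿inverseʳ 1#)) (+-identityʳ x)))

  -- Turns a product over all of K into one over the nonzero elements. The first argument decides
  -- and the second is the value, so the same function serves for the factor x and for the constant
  -- factor a.
  0→1 : Carrier → Carrier → Carrier
  0→1 x y with x ≟ 0#
  ... | yes _ = 1#
  ... | no _  = y

  0→1-zero : ∀ {x} y → x ≈ 0# → 0→1 x y ≈ 1#
  0→1-zero {x} y x≈0 with x ≟ 0#
  ... | yes _   = refl
  ... | no x≉0  = contradiction x≈0 x≉0

  0→1-nonzero : ∀ {x} y → ¬ x ≈ 0# → 0→1 x y ≈ y
  0→1-nonzero {x} y x≉0 with x ≟ 0#
  ... | yes x≈0 = contradiction x≈0 x≉0
  ... | no _    = refl

  0→1≉0 : ∀ x → ¬ 0→1 x x ≈ 0#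
  0→1≉0 x with x ≟ 0#
  ... | yes _  = 1≉0
  ... | no x≉0 = x≉0

  0→1-cong : ∀ {x y} → x ≈ y → 0→1 x x ≈ 0→1 y y
  0→1-cong {x} {y} x≈y with x ≟ 0#
  ... | yes x≈0 = sym (0→1-zero _ (trans (sym x≈y) x≈0))
  ... | no x≉0  = trans x≈y (sym (0→1-nonzero _ (λ y≈0 → x≉0 (trans x≈y y≈0))))

  -- Multiplication by a permutes K, so the product Π of the nonzero elements
  -- satisfies Π = a ^ (N - 1) * Π.
  fermat : ∀ a → a ^ N ≈ a
  fermat a with a ≟ 0#
  fermat a | yes a≈0 = aux N (λ N≡0 → contradiction (≡.subst Fin N≡0 (to a)) λ ())
    where
    aux : ∀ m → m ≢ 0 → a ^ m ≈ a
    aux zero    m≢0 = contradiction ≡.refl m≢0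
    aux (suc m) _   = begin
      a * a ^ m    ≈⟨ *-congʳ a≈0 ⟩
      0# * a ^ m   ≈⟨ zeroˡ _ ⟩
      0#           ≈⟨ a≈0 ⟨
      a            ∎
  fermat a | no a≉0 = begin
      a ^ N                               ≈⟨ power from (to 0#) (strictlyInverseʳ 0#) (λ i i≢ eq → i≢ (≡.trans (≡.sym (strictlyInverseˡ i)) (to-cong eq))) ⟩
      a * product (λ i → 0→1 (from i) a)  ≈⟨ *-congˡ product≈1 ⟩
      a * 1#                              ≈⟨ *-identityʳ a ⟩
      a                                   ∎
    where
    open *Sum renaming (sum to product; sum-permute to product-permute; sum-cong-≋ to product-cong;
      ∑-distrib-+ to ∏-distrib-*; sum-replicate to product-replicate; sum-remove to product-remove)
    a⁻¹ = proj₁ (inverse a≉0)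
    a⁻¹a≈1 = proj₂ (inverse a≉0)
    π = shuffle (a *_) (a⁻¹ *_) *-congˡ *-congˡ
          (λ x → trans (sym (*-assoc a _ x)) (trans (*-congʳ (trans (*-comm a _) a⁻¹a≈1)) (*-identityˡ x)))
          (λ x → trans (sym (*-assoc _ a x)) (trans (*-congʳ a⁻¹a≈1) (*-identityˡ x)))
    Π = product (λ i → 0→1 (from i) (from i))
    Π≉0 : ∀ {m} (t : Vector Carrier m) → ¬ product (λ i → 0→1 (t i) (t i)) ≈ 0#
    Π≉0 {zero}  t = 1≉0
    Π≉0 {suc m} t = *-≉0 (0→1≉0 _) (Π≉0 (tail t))
    factor : ∀ x → 0→1 (a * x) (a * x) ≈ 0→1 x a * 0→1 x x
    factor x with x ≟ 0#
    ... | yes x≈0 = trans (0→1-zero _ (trans (*-congˡ x≈0) (zeroʳ a))) (sym (*-identityˡ _))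
    ... | no x≉0  = 0→1-nonzero _ (*-≉0 a≉0 x≉0)
    product≈1 : product (λ i → 0→1 (from i) a) ≈ 1#
    product≈1 = *-cancelˡ-≉ (Π≉0 from) (begin
      Π * product (λ i → 0→1 (from i) a)                     ≈⟨ *-comm _ _ ⟩
      product (λ i → 0→1 (from i) a) * Π                     ≈⟨ ∏-distrib-* (λ i → 0→1 (from i) a) _ ⟨
      product (λ i → 0→1 (from i) a * 0→1 (from i) (from i)) ≈⟨ product-cong {N} (λ i → factor (from i)) ⟨
      product (λ i → 0→1 (a * from i) (a * from i))          ≈⟨ product-cong {N} (λ i → 0→1-cong (strictlyInverseʳ (a * from i))) ⟨
      product (λ i → 0→1 (from (to (a * from i))) (from (to (a * from i))))
                                                             ≈⟨ product-permute (λ i → 0→1 (from i) (from i)) π ⟨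
      Π                                                      ≈⟨ *-identityʳ Π ⟨
      Π * 1#                                                 ∎)
    -- The index of 0 contributes 1 instead of a, which the extra factor a makes up for.
    power : ∀ {m} (t : Vector Carrier m) (i₀ : Fin m) → t i₀ ≈ 0# → (∀ i → i ≢ i₀ → ¬ t i ≈ 0#) →
            a ^ m ≈ a * product (λ i → 0→1 (t i) a)
    power {suc m} t i₀ t₀≈0 t≉0 = *-congˡ (begin
      a ^ m                                                          ≈⟨ product-replicate m ⟨
      product (replicate m a)                                        ≈⟨ product-cong (λ i → 0→1-nonzero a (t≉0 _ (Finₚ.punchInᵢ≢i i₀ i))) ⟨
      product (removeAt (λ i → 0→1 (t i) a) i₀)                      ≈⟨ *-identityˡ _ ⟨
      1# * product (removeAt (λ i → 0→1 (t i) a) i₀)                 ≈⟨ *-congʳ (0→1-zero a t₀≈0) ⟨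
      0→1 (t i₀) a * product (removeAt (λ i → 0→1 (t i) a) i₀)       ≈⟨ product-remove {i = i₀} (λ i → 0→1 (t i) a) ⟨
      product (λ i → 0→1 (t i) a)                                    ∎)

-- Polynomial functions of bounded degree

module Polynomials {c ℓ₁ ℓ₂} (K : HeytingField c ℓ₁ ℓ₂) (N : ℕ) (card : HasCardinality K N) where

  open HeytingField K hiding (zero)
  open HeytingCommutativeRing heytingCommutativeRing using (commutativeRing)
  open CommutativeRing commutativeRing using (semiring; commutativeSemiring)
  open ExpProperties commutativeSemiring using (_^_)
  open SumProperties semiring
  open SetoidReasoning setoid
  open Inverse card using (to; from; strictlyInverseʳ)
  open FiniteField K N card
  open IntegerSolver commutativeRing

  -- The index bounds the number of coefficients, so the degree is less than it.
  data Poly : ℕ → (Carrier → Carrier) → Set (c ⊔ ℓ₁) where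
    nil  : ∀ {f} → (∀ θ → f θ ≈ 0#) → Poly 0 f
    cons : ∀ {m f g} a → Poly m g → (∀ θ → f θ ≈ a + θ * g θ) → Poly (suc m) f

  Poly-cong : ∀ {m f g} → (∀ θ → f θ ≈ g θ) → Poly m f → Poly m g
  Poly-cong f≈g (nil f≈0)      = nil (λ θ → trans (sym (f≈g θ)) (f≈0 θ))
  Poly-cong f≈g (cons a h f≈h) = cons a h (λ θ → trans (sym (f≈g θ)) (f≈h θ))

  Poly-scale : ∀ {m f} b → Poly m f → Poly m (λ θ → b * f θ)
  Poly-scale b (nil f≈0) = nil (λ θ → trans (*-congˡ (f≈0 θ)) (zeroʳ b))
  Poly-scale b (cons {g = g} a h f≈h) = cons (b * a) (Poly-scale b h) λ θ →
    trans (*-congˡ (f≈h θ))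
      (solve 4 (λ b a θ x → (b :* (a :+ θ :* x)) := (b :* a :+ θ :* (b :* x))) refl b a θ (g θ))

  Poly-+ : ∀ {m f g} → Poly m f → Poly m g → Poly m (λ θ → f θ + g θ)
  Poly-+ (nil f≈0) (nil g≈0) = nil (λ θ → trans (+-cong (f≈0 θ) (g≈0 θ)) (+-identityˡ 0#))
  Poly-+ (cons {g = h} a p f≈) (cons {g = k} b p′ g≈) = cons (a + b) (Poly-+ p p′) λ θ →
    trans (+-cong (f≈ θ) (g≈ θ))
      (solve 5 (λ a b θ x y → ((a :+ θ :* x) :+ (b :+ θ :* y)) := ((a :+ b) :+ θ :* (x :+ y))) refl a b θ (h θ) (k θ))

  Poly-- : ∀ {m f g} → Poly m f → Poly m g → Poly m (λ θ → f θ - g θ)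
  Poly-- {g = g} p p′ = Poly-+ p (Poly-cong (λ θ → solve 1 (λ x → (con (ℤ.- ℤ.1ℤ) :* x) := (:- x)) refl (g θ)) (Poly-scale _ p′))

  Poly-zero : ∀ m → Poly m (λ _ → 0#)
  Poly-zero zero    = nil (λ _ → refl)
  Poly-zero (suc m) = cons 0# (Poly-zero m) (λ θ → sym (trans (+-identityˡ _) (zeroʳ θ)))

  Poly-const : ∀ m a → Poly (suc m) (λ _ → a)
  Poly-const m a = cons a (Poly-zero m) (λ θ → sym (trans (+-congˡ (zeroʳ θ)) (+-identityʳ a)))

  Poly-suc : ∀ {m f} → Poly m f → Poly (suc m) f
  Poly-suc (nil f≈0)      = Poly-cong (λ θ → sym (f≈0 θ)) (Poly-zero 1)
  Poly-suc (cons a h f≈h) = cons a (Poly-suc h) f≈h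

  Poly-linear : ∀ {m f} u → Poly m f → Poly (suc m) (λ θ → (θ - u) * f θ)
  Poly-linear {f = f} u p = Poly-cong
    (λ θ → solve 3 (λ θ u x → (con ℤ.0ℤ :+ θ :* x :+ (:- u) :* x) := ((θ :- u) :* x)) refl θ u (f θ))
    (Poly-+ (cons 0# p (λ θ → refl)) (Poly-suc (Poly-scale (- u) p)))

  Poly-eval : ∀ {m} (a : Vector Carrier m) → Poly m (λ θ → sum (λ i → a i * θ ^ toℕ i))
  Poly-eval {zero}  a = nil (λ _ → refl)
  Poly-eval {suc m} a = cons (a zero) (Poly-eval (a ∘ suc)) λ θ → +-cong (*-identityʳ _) (begin
    sum (λ i → a (suc i) * (θ * θ ^ toℕ i))   ≈⟨ sum-cong-≋ (λ i → solve 3 (λ x y z → (x :* (y :* z)) := (y :* (x :* z))) refl (a (suc i)) θ (θ ^ toℕ i)) ⟩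
    sum (λ i → θ * (a (suc i) * θ ^ toℕ i))   ≈⟨ *-distribˡ-sum θ (λ i → a (suc i) * θ ^ toℕ i) ⟨
    θ * sum (λ i → a (suc i) * θ ^ toℕ i)     ∎)

  -- Synthetic division: if f is a + θ h and h is h(u) + (θ - u) k, then the quotient of f is h(u) +
  -- θ k.
  divide : ∀ {m f} u → Poly (suc m) f → ∃[ g ] (Poly m g × (∀ θ → f θ ≈ f u + (θ - u) * g θ))
  divide {f = f} u (cons {g = h} a (nil h≈0) f≈) = _ , Poly-zero 0 , λ θ → begin
    f θ                      ≈⟨ f≈a θ ⟩
    a                        ≈⟨ f≈a u ⟨
    f u                      ≈⟨ solve 2 (λ x y → x := (x :+ y :* con ℤ.0ℤ)) refl (f u) (θ - u) ⟩
    f u + (θ - u) * 0#       ∎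
    where
    f≈a : ∀ θ → f θ ≈ a
    f≈a θ = trans (f≈ θ) (trans (+-congˡ (trans (*-congˡ (h≈0 θ)) (zeroʳ θ))) (+-identityʳ a))
  divide {f = f} u (cons {g = h} a p@(cons _ _ _) f≈) with k , pk , h≈ ← divide u p =
    (λ θ → h u + θ * k θ) , cons (h u) pk (λ _ → refl) , λ θ → begin
    f θ                                               ≈⟨ f≈ θ ⟩
    a + θ * h θ                                       ≈⟨ +-congˡ (*-congˡ (h≈ θ)) ⟩
    a + θ * (h u + (θ - u) * k θ)                     ≈⟨ solve 5 (λ a θ x u y → (a :+ θ :* (x :+ (θ :- u) :* y)) := (a :+ u :* x :+ (θ :- u) :* (x :+ θ :* y))) refl a θ (h u) u (k θ) ⟩
    a + u * h u + (θ - u) * (h u + θ * k θ)           ≈⟨ +-congʳ (f≈ u) ⟨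
    f u + (θ - u) * (h u + θ * k θ)                   ∎

  factor : ∀ {m f} u → Poly (suc m) f → f u ≈ 0# → ∃[ g ] (Poly m g × (∀ θ → f θ ≈ (θ - u) * g θ))
  factor u p fu≈0 = let g , pg , f≈ = divide u p in
    g , pg , λ θ → trans (f≈ θ) (trans (+-congʳ fu≈0) (+-identityˡ _))

  x≉y⇒x-y≉0 : ∀ {x y} → ¬ x ≈ y → ¬ x - y ≈ 0#
  x≉y⇒x-y≉0 x≉y eq = x≉y (x-y≈0⇒x≈y eq)

  -- One linear factor is divided out per root. Distinctness keeps the other nodes roots of the
  -- quotient, and after m divisions no coefficient is left.
  roots⇒zero : ∀ {m f} → Poly m f → (t : Vector Carrier m) → (∀ i j → i ≢ j → ¬ t i ≈ t j) →
               (∀ i → f (t i) ≈ 0#) → ∀ θ → f θ ≈ 0#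
  roots⇒zero (nil f≈0) t distinct root θ = f≈0 θ
  roots⇒zero {f = f} p@(cons _ _ _) t distinct root θ with g , pg , f≈ ← factor (t zero) p (root zero) =
    trans (f≈ θ) (trans (*-congˡ (roots⇒zero pg (t ∘ suc) (λ i j i≢j → distinct _ _ (i≢j ∘ Finₚ.suc-injective)) g-root θ)) (zeroʳ _))
    where
    g-root : ∀ i → g (t (suc i)) ≈ 0#
    g-root i = xy≈0⇒y≈0 (x≉y⇒x-y≉0 (distinct (suc i) zero λ ())) (trans (sym (f≈ _)) (root (suc i)))

  -- Leaving out u, the field still has N - 1 ≥ m distinct roots to offer. This is what makes
  -- division by θ - u possible for identities of functions.
  zero-off-point⇒zero : ∀ {m f} → m ℕ.< N → Poly m f → ∀ u → (∀ θ → ¬ θ ≈ u → f θ ≈ 0#) → ∀ θ → f θ ≈ 0#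
  zero-off-point⇒zero {m} {f} m<N p u f≈0 = aux m<N from from-injective (to u) (strictlyInverseʳ u)
    where
    -- `N` and the enumeration of K are generalised so that matching on `m < n` exposes a successor,
    -- over which `punchIn k` skips the index of u.
    aux : ∀ {n} → m ℕ.< n → (e : Fin n → Carrier) → (∀ {i j} → e i ≈ e j → i ≡ j) → ∀ k → e k ≈ u → ∀ θ → f θ ≈ 0#
    aux (ℕ.s≤s m≤n) e inj k ek≈u = roots⇒zero p (λ i → e (punchIn k (inject≤ i m≤n)))
      (λ i j i≢j eq → i≢j (Finₚ.inject≤-injective m≤n m≤n i j (Finₚ.punchIn-injective k _ _ (inj eq))))
      (λ i → f≈0 _ (λ eq → Finₚ.punchInᵢ≢i k (inject≤ i m≤n) (inj (trans eq (sym ek≈u)))))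

  -- The value at 0 gives the constant coefficient. What remains is θ times the tail, so the tail
  -- vanishes away from 0 and hence everywhere.
  zero⇒coefficients≈0 : ∀ {m} → m ℕ.≤ N → (a : Vector Carrier m) → (∀ θ → sum (λ i → a i * θ ^ toℕ i) ≈ 0#) → ∀ i → a i ≈ 0#
  zero⇒coefficients≈0 {suc m} m<N a a≈0 = λ where
      zero    → a₀≈0
      (suc i) → zero⇒coefficients≈0 (ℕₚ.<⇒≤ m<N) (a ∘ suc) tail≈0 i
    where
    shift : ∀ θ → sum (λ i → a i * θ ^ toℕ i) ≈ a zero + θ * sum (λ i → a (suc i) * θ ^ toℕ i)
    shift θ = +-cong (*-identityʳ _) (trans
      (sum-cong-≋ (λ i → solve 3 (λ x y z → (x :* (y :* z)) := (y :* (x :* z))) refl (a (suc i)) θ (θ ^ toℕ i)))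
      (sym (*-distribˡ-sum θ (λ i → a (suc i) * θ ^ toℕ i))))
    a₀≈0 = begin
      a zero                                                ≈⟨ +-identityʳ _ ⟨
      a zero + 0#                                           ≈⟨ +-congˡ (zeroˡ _) ⟨
      a zero + 0# * sum (λ i → a (suc i) * 0# ^ toℕ i)      ≈⟨ shift 0# ⟨
      sum (λ i → a i * 0# ^ toℕ i)                          ≈⟨ a≈0 0# ⟩
      0#                                                    ∎
    tail≈0 : ∀ θ → sum (λ i → a (suc i) * θ ^ toℕ i) ≈ 0#
    tail≈0 = zero-off-point⇒zero m<N (Poly-eval (a ∘ suc)) 0# λ θ θ≉0 → xy≈0⇒y≈0 θ≉0 (begin
      θ * sum (λ i → a (suc i) * θ ^ toℕ i)             ≈⟨ +-identityˡ _ ⟨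
      0# + θ * sum (λ i → a (suc i) * θ ^ toℕ i)        ≈⟨ +-congʳ a₀≈0 ⟨
      a zero + θ * sum (λ i → a (suc i) * θ ^ toℕ i)    ≈⟨ shift θ ⟨
      sum (λ i → a i * θ ^ toℕ i)                       ≈⟨ a≈0 θ ⟩
      0#                                                ∎)

-- Linear algebra by counting

funToFin-cong : ∀ {m o} {f g : Fin m → Fin o} → (∀ i → f i ≡ g i) → funToFin f ≡ funToFin g
funToFin-cong {zero}  f≗g = ≡.refl
funToFin-cong {suc m} f≗g = ≡.cong₂ Fin.combine (f≗g zero) (funToFin-cong (f≗g ∘ suc))

-- There are N^(n+1) arguments and only N^n values once functions are coded as numbers. Different
-- codes decode to functions that differ at some index, found by search.
functional-pigeonhole : ∀ {N} → 1 ℕ.< N → ∀ n (F : (Fin (suc n) → Fin N) → Fin n → Fin N) →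
  ∃[ u ] ∃[ v ] ((∃[ i ] u i ≢ v i) × (∀ j → F u j ≡ F v j))
functional-pigeonhole {N} 1<N n F =
  let k , l , k<l , eq = Finₚ.pigeonhole (ℕₚ.^-monoʳ-< N 1<N (ℕₚ.n<1+n n)) (λ k → funToFin (F (finToFun k)))
  in  finToFun k , finToFun l ,
      Finₚ.¬∀⟶∃¬ (suc n) _ (λ i → finToFun k i Finₚ.≟ finToFun l i) (λ eqs → Finₚ.<⇒≢ k<l (finToFun-injective k l eqs)) ,
      λ j → ≡.trans (≡.sym (Finₚ.finToFun-funToFin _ j))
              (≡.trans (≡.cong (λ z → finToFun z j) eq) (Finₚ.finToFun-funToFin _ j))
  where
  finToFun-injective : ∀ k l → (∀ i → finToFun {N} {suc n} k i ≡ finToFun l i) → k ≡ l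
  finToFun-injective k l eqs = ≡.trans (≡.sym (Finₚ.funToFin-finToFin {suc n} {N} k))
    (≡.trans (funToFin-cong eqs) (Finₚ.funToFin-finToFin {suc n} {N} l))

module LinearAlgebra {c ℓ₁ ℓ₂} (K : HeytingField c ℓ₁ ℓ₂) (N : ℕ) (card : HasCardinality K N) where

  open HeytingField K hiding (zero)
  open HeytingCommutativeRing heytingCommutativeRing using (commutativeRing)
  open CommutativeRing commutativeRing using (semiring)
  open SumProperties semiring
  open SetoidReasoning setoid
  open Inverse card using (to; from)
  open FiniteField K N card
  open IntegerSolver commutativeRing

  1<N : 1 ℕ.< N
  1<N with N ℕₚ.≤? 1
  ... | no N≰1  = ℕₚ.≰⇒> N≰1
  ... | yes N≤1 = contradiction (to-injective (aux N≤1 (to 1#) (to 0#))) 1≉0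
    where
    aux : ∀ {n} → n ℕ.≤ 1 → (i j : Fin n) → i ≡ j
    aux (ℕ.s≤s ℕ.z≤n) zero zero = ≡.refl

  sum-*-+ : ∀ {n} (x y z : Vector Carrier n) → sum (λ i → (x i + y i) * z i) ≈ sum (λ i → x i * z i) + sum (λ i → y i * z i)
  sum-*-+ {n} x y z = trans (sum-cong-≋ {n} (λ i → distribʳ (z i) (x i) (y i))) (∑-distrib-+ (λ i → x i * z i) _)

  sum-*-scale : ∀ {n} a (x z : Vector Carrier n) → sum (λ i → (a * x i) * z i) ≈ a * sum (λ i → x i * z i)
  sum-*-scale {n} a x z = trans (sum-cong-≋ {n} (λ i → *-assoc a (x i) (z i))) (sym (*-distribˡ-sum a (λ i → x i * z i)))

  -- There are more coefficient vectors x than values of x C, so two of them have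
  -- the same image.
  kernel : ∀ {n} (C : Fin (suc n) → Fin n → Carrier) →
           ∃[ x ] ((∃[ i ] ¬ x i ≈ 0#) × (∀ j → sum (λ i → x i * C i j) ≈ 0#))
  kernel {n} C =
    let u , v , (i , uᵢ≢vᵢ) , eq = functional-pigeonhole 1<N n (λ u j → to (sum (λ i → from (u i) * C i j))) in
    difference u v i uᵢ≢vᵢ eq
    where
    difference : ∀ u v i → u i ≢ v i →
      (∀ j → to (sum (λ i → from (u i) * C i j)) ≡ to (sum (λ i → from (v i) * C i j))) →
      ∃[ x ] ((∃[ i ] ¬ x i ≈ 0#) × (∀ j → sum (λ i → x i * C i j) ≈ 0#))
    difference u v i uᵢ≢vᵢ eq = (λ i → from (u i) + - 1# * from (v i)) ,
      (i , λ xᵢ≈0 → uᵢ≢vᵢ (from-injective (x-y≈0⇒x≈y (trans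
        (solve 2 (λ u v → (u :- v) := (u :+ (:- con ℤ.1ℤ) :* v)) refl (from (u i)) (from (v i))) xᵢ≈0)))) ,
      λ j → begin
      sum (λ i → (from (u i) + - 1# * from (v i)) * C i j)                      ≈⟨ sum-*-+ (from ∘ u) (λ i → - 1# * from (v i)) (λ i → C i j) ⟩
      sum (λ i → from (u i) * C i j) + sum (λ i → - 1# * from (v i) * C i j)    ≈⟨ +-cong (to-injective (eq j)) (sum-*-scale (- 1#) (from ∘ v) (λ i → C i j)) ⟩
      sum (λ i → from (v i) * C i j) + - 1# * sum (λ i → from (v i) * C i j)    ≈⟨ solve 1 (λ x → (x :+ (:- con ℤ.1ℤ) :* x) := con ℤ.0ℤ) refl (sum (λ i → from (v i) * C i j)) ⟩
      0#                                                                        ∎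

  -- Adding t to the n rows gives n + 1 rows and a relation. Its coefficient at t is nonzero, since
  -- otherwise the independent rows would be related, so t can be isolated.
  independent⇒spanning : ∀ {n} (C : Fin n → Fin n → Carrier) →
    (∀ x → (∀ j → sum (λ i → x i * C i j) ≈ 0#) → ∀ i → x i ≈ 0#) →
    ∀ (t : Fin n → Carrier) → ∃[ y ] (∀ j → t j ≈ sum (λ i → y i * C i j))
  independent⇒spanning {n} C independent t = let x , (k , xₖ≉0) , xD≈0 = kernel D in solution x k xₖ≉0 xD≈0
    where
    D : Fin (suc n) → Fin n → Carrier
    D zero    = t
    D (suc i) = C i
    isolate : ∀ a y b s → y * a ≈ 1# → a * b + s ≈ 0# → b ≈ - y * s
    isolate a y b s ya≈1 eq = begin
      b                              ≈⟨ *-identityˡ b ⟨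
      1# * b                         ≈⟨ *-congʳ ya≈1 ⟨
      y * a * b                      ≈⟨ solve 4 (λ a y b s → (y :* a :* b) := (y :* (a :* b :+ s) :+ (:- y) :* s)) refl a y b s ⟩
      y * (a * b + s) + - y * s      ≈⟨ +-congʳ (*-congˡ eq) ⟩
      y * 0# + - y * s               ≈⟨ +-congʳ (zeroʳ y) ⟩
      0# + - y * s                   ≈⟨ +-identityˡ _ ⟩
      - y * s                        ∎
    solution : ∀ x k → ¬ x k ≈ 0# → (∀ j → sum (λ i → x i * D i j) ≈ 0#) →
               ∃[ y ] (∀ j → t j ≈ sum (λ i → y i * C i j))
    solution x k xₖ≉0 xD≈0 with x zero ≟ 0#
    ... | yes x₀≈0 = contradiction (x≈0 k) xₖ≉0
      where
      x≈0 : ∀ i → x i ≈ 0#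
      x≈0 zero    = x₀≈0
      x≈0 (suc i) = independent (x ∘ suc) (λ j → begin
        sum (λ i → x (suc i) * C i j)                    ≈⟨ +-identityˡ _ ⟨
        0# + sum (λ i → x (suc i) * C i j)               ≈⟨ +-congʳ (trans (*-congʳ x₀≈0) (zeroˡ (t j))) ⟨
        x zero * t j + sum (λ i → x (suc i) * C i j)     ≈⟨ xD≈0 j ⟩
        0#                                               ∎) i
    ... | no x₀≉0 = let y , yx₀≈1 = inverse x₀≉0 in (λ i → - y * x (suc i)) , λ j → begin
        t j                                              ≈⟨ isolate (x zero) y (t j) _ yx₀≈1 (xD≈0 j) ⟩
        - y * sum (λ i → x (suc i) * C i j)              ≈⟨ sum-*-scale (- y) (x ∘ suc) (λ i → C i j) ⟨
        sum (λ i → - y * x (suc i) * C i j)              ∎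

-- Binomial coefficients modulo a prime

module PrimeBinomial {p} (prime : Prime p) where

  open Combinatorics using (_C_; nCk≡n!/k![n-k]!; k![n∸k]!∣n!)

  p≢1 : p ≢ 1
  p≢1 p≡1 = ℕ.nonTrivial⇒≢1 {{prime⇒nonTrivial prime}} p≡1

  p∤k! : ∀ {k} → k ℕ.< p → p ∤ k !
  p∤k! {zero}  _    p∣1 = p≢1 (∣1⇒≡1 p∣1)
  p∤k! {suc k} k<p p∣ with euclidsLemma (suc k) (k !) prime p∣
  ... | inj₁ p∣1+k = ℕₚ.<⇒≱ k<p (∣⇒≤ p∣1+k)
  ... | inj₂ p∣k!  = p∤k! (ℕₚ.<⇒≤ k<p) p∣k!

  p∣p! : p ∣ p !
  p∣p! = aux (prime⇒nonZero prime)
    where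
    aux : ∀ {n} → ℕ.NonZero n → n ∣ n !
    aux {suc n} _ = m∣m*n (n !)

  -- The coefficient times k! (p - k)! is p!, and p divides p! but neither of the two smaller
  -- factorials.
  p∣pCk : ∀ {k} → 0 ℕ.< k → k ℕ.< p → p ∣ (p C k)
  p∣pCk {k} 0<k k<p with euclidsLemma (p C k) (k ! ℕ.* (p ℕ.∸ k) !) prime (≡.subst (p ∣_) (≡.sym factorials) p∣p!)
    where
    instance _ = k ℕₚ.!* (p ℕ.∸ k) !≢0
    factorials : (p C k) ℕ.* (k ! ℕ.* (p ℕ.∸ k) !) ≡ p !
    factorials = ≡.trans (≡.cong (ℕ._* (k ! ℕ.* (p ℕ.∸ k) !)) (nCk≡n!/k![n-k]! (ℕₚ.<⇒≤ k<p)))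
                   (m/n*n≡m (k![n∸k]!∣n! (ℕₚ.<⇒≤ k<p)))
  ... | inj₁ p∣C = p∣C
  ... | inj₂ p∣k![p-k]! with euclidsLemma (k !) ((p ℕ.∸ k) !) prime p∣k![p-k]!
  ...   | inj₁ p∣k!     = contradiction p∣k! (p∤k! k<p)
  ...   | inj₂ p∣[p-k]! = contradiction p∣[p-k]! (p∤k! (ℕₚ.∸-monoʳ-< 0<k (ℕₚ.<⇒≤ k<p)))

-- The Frobenius maps

module Frobenius {c ℓ₁ ℓ₂} (K : HeytingField c ℓ₁ ℓ₂) (q : ℕ) (primePower : IsPrimePower q)
                 (card : HasCardinality K (q ℕ.^ 6)) where

  open HeytingField K hiding (zero)
  open HeytingCommutativeRing heytingCommutativeRing using (commutativeRing)
  open CommutativeRing commutativeRing using (ring; semiring; commutativeSemiring)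
  open ExpProperties commutativeSemiring
  open MultProperties semiring using (×-assoc-*; ×1-homo-*; ×-congʳ; ×-congˡ; ×-homo-1) renaming (_×_ to _×#_)
  open RingProperties ring using (+-cancelʳ)
  open SumProperties semiring
  open SetoidReasoning setoid
  open FiniteField K (q ℕ.^ 6) card
  open Combinatorics using (_C_; nCn≡1; nCk≡nC[n∸k])

  private
    p = proj₁ primePower
    h = proj₁ (proj₂ primePower)
    prime = proj₁ (proj₂ (proj₂ primePower))
    q≡p^ = proj₂ (proj₂ (proj₂ primePower))
    open PrimeBinomial prime

  q^k≡p^ : ∀ k → q ℕ.^ k ≡ p ℕ.^ (suc h ℕ.* k)
  q^k≡p^ k = ≡.trans (≡.cong (ℕ._^ k) q≡p^) (ℕₚ.^-*-assoc p (suc h) k)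

  -- The number of elements is a power of p, so a power of p times 1 vanishes, and a field has no
  -- nilpotent elements.
  characteristic : p ×# 1# ≈ 0#
  characteristic = ^-≈0 (suc h ℕ.* 6) (begin
    (p ×# 1#) ^ (suc h ℕ.* 6)      ≈⟨ power (suc h ℕ.* 6) ⟨
    (p ℕ.^ (suc h ℕ.* 6)) ×# 1#    ≈⟨ ×-congˡ {1#} (q^k≡p^ 6) ⟨
    (q ℕ.^ 6) ×# 1#                ≈⟨ N×1≈0 ⟩
    0#                             ∎)
    where
    power : ∀ m → (p ℕ.^ m) ×# 1# ≈ (p ×# 1#) ^ m
    power zero    = ×-homo-1 1#
    power (suc m) = trans (×1-homo-* p (p ℕ.^ m)) (*-congˡ (power m))

  ∣⇒×≈0 : ∀ {m} → p ∣ m → ∀ x → m ×# x ≈ 0#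
  ∣⇒×≈0 {m} (divides d m≡dp) x = begin
    m ×# x                      ≈⟨ ×-congˡ m≡dp ⟩
    (d ℕ.* p) ×# x              ≈⟨ ×-congʳ (d ℕ.* p) (*-identityˡ x) ⟨
    (d ℕ.* p) ×# (1# * x)       ≈⟨ ×-assoc-* (d ℕ.* p) 1# x ⟨
    (d ℕ.* p) ×# 1# * x         ≈⟨ *-congʳ (×1-homo-* d p) ⟩
    (d ×# 1#) * (p ×# 1#) * x   ≈⟨ *-congʳ (*-congˡ characteristic) ⟩
    (d ×# 1#) * 0# * x          ≈⟨ *-congʳ (zeroʳ _) ⟩
    0# * x                      ≈⟨ zeroˡ x ⟩
    0#                          ∎

  sum≈0 : ∀ {n} (t : Vector Carrier n) → (∀ i → t i ≈ 0#) → sum t ≈ 0#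
  sum≈0 {n} t t≈0 = trans (sum-cong-≋ t≈0) (sum-replicate-zero n)

  -- In the binomial expansion every term except the first and the last has a coefficient divisible
  -- by p.
  freshman : ∀ x y → (x + y) ^ p ≈ x ^ p + y ^ p
  freshman x y = aux (prime⇒nonZero prime) ≡.refl
    where
    open Binomial commutativeSemiring
    middle : ∀ k → 0 ℕ.< toℕ k → toℕ k ℕ.< p → binomialTerm x y p k ≈ 0#
    middle k 0<k k<p = ∣⇒×≈0 (p∣pCk 0<k k<p) _
    first : binomialTerm x y p zero ≈ y ^ p
    first = begin
      (p C 0) ×# (1# * y ^ p)    ≈⟨ ×-congˡ (≡.trans (nCk≡nC[n∸k] {0} {p} ℕ.z≤n) (nCn≡1 p)) ⟩
      1 ×# (1# * y ^ p)          ≈⟨ ×-homo-1 _ ⟩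
      1# * y ^ p                 ≈⟨ *-identityˡ _ ⟩
      y ^ p                      ∎
    last-term : binomialTerm x y p (fromℕ p) ≈ x ^ p
    last-term = begin
      (p C toℕ (fromℕ p)) ×# (x ^ toℕ (fromℕ p) * y ^ (p ℕ.∸ toℕ (fromℕ p)))   ≡⟨ ≡.cong (λ k → (p C k) ×# (x ^ k * y ^ (p ℕ.∸ k))) (Finₚ.toℕ-fromℕ p) ⟩
      (p C p) ×# (x ^ p * y ^ (p ℕ.∸ p))    ≡⟨ ≡.cong₂ (λ i j → i ×# (x ^ p * y ^ j)) (nCn≡1 p) (ℕₚ.n∸n≡0 p) ⟩
      1 ×# (x ^ p * 1#)                     ≈⟨ ×-homo-1 _ ⟩
      x ^ p * 1#                            ≈⟨ *-identityʳ _ ⟩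
      x ^ p                                 ∎
    aux : ∀ {n} → ℕ.NonZero n → n ≡ p → (x + y) ^ p ≈ x ^ p + y ^ p
    aux {suc n} _ ≡.refl = begin
      (x + y) ^ p                                                             ≈⟨ theorem p x y ⟩
      binomialTerm x y p zero + sum (λ k → binomialTerm x y p (suc k))        ≈⟨ +-congˡ (sum-init-last (λ k → binomialTerm x y p (suc k))) ⟩
      binomialTerm x y p zero + (sum (λ k → binomialTerm x y p (suc (inject₁ k))) + binomialTerm x y p (fromℕ p))
        ≈⟨ +-cong first (+-cong (sum≈0 (λ k → binomialTerm x y p (suc (inject₁ k))) λ k →
             middle (suc (inject₁ k)) (ℕ.s≤s ℕ.z≤n) (ℕ.s≤s (≡.subst (ℕ._< n) (≡.sym (Finₚ.toℕ-inject₁ k)) (Finₚ.toℕ<n k)))) last-term) ⟩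
      y ^ p + (0# + x ^ p)                                                    ≈⟨ +-congˡ (+-identityˡ _) ⟩
      y ^ p + x ^ p                                                           ≈⟨ +-comm _ _ ⟩
      x ^ p + y ^ p                                                           ∎

  σ : ℕ → Carrier → Carrier
  σ k x = x ^ (q ℕ.^ k)

  σ-cong : ∀ k {x y} → x ≈ y → σ k x ≈ σ k y
  σ-cong k = ^-congˡ (q ℕ.^ k)

  σ-+ : ∀ k x y → σ k (x + y) ≈ σ k x + σ k y
  σ-+ k x y = ≡.subst (λ n → (x + y) ^ n ≈ x ^ n + y ^ n) (≡.sym (q^k≡p^ k)) (aux (suc h ℕ.* k) x y)
    where
    aux : ∀ m x y → (x + y) ^ (p ℕ.^ m) ≈ x ^ (p ℕ.^ m) + y ^ (p ℕ.^ m)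
    aux zero    x y = trans (*-identityʳ _) (sym (+-cong (*-identityʳ x) (*-identityʳ y)))
    aux (suc m) x y = begin
      (x + y) ^ (p ℕ.* p ℕ.^ m)                          ≈⟨ ^-assocʳ (x + y) p _ ⟨
      ((x + y) ^ p) ^ (p ℕ.^ m)                          ≈⟨ ^-congˡ (p ℕ.^ m) (freshman x y) ⟩
      (x ^ p + y ^ p) ^ (p ℕ.^ m)                        ≈⟨ aux m _ _ ⟩
      (x ^ p) ^ (p ℕ.^ m) + (y ^ p) ^ (p ℕ.^ m)          ≈⟨ +-cong (^-assocʳ x p _) (^-assocʳ y p _) ⟩
      x ^ (p ℕ.* p ℕ.^ m) + y ^ (p ℕ.* p ℕ.^ m)          ∎

  σ-* : ∀ k x y → σ k (x * y) ≈ σ k x * σ k y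
  σ-* k x y = ^-distrib-* x y (q ℕ.^ k)

  σ-0 : ∀ k → σ k 0# ≈ 0#
  σ-0 k = +-cancelʳ (σ k 0#) _ _ (trans (sym (σ-+ k 0# 0#)) (trans (σ-cong k (+-identityˡ 0#)) (sym (+-identityˡ _))))

  σ-1 : ∀ k → σ k 1# ≈ 1#
  σ-1 k = aux (q ℕ.^ k)
    where
    aux : ∀ m → 1# ^ m ≈ 1#
    aux zero    = refl
    aux (suc m) = trans (*-identityˡ _) (aux m)

  σ-- : ∀ k x → σ k (- x) ≈ - σ k x
  σ-- k x = +-cancelʳ (σ k x) _ _ (begin
    σ k (- x) + σ k x   ≈⟨ σ-+ k (- x) x ⟨
    σ k (- x + x)       ≈⟨ σ-cong k (-‿inverseˡ x) ⟩
    σ k 0#              ≈⟨ σ-0 k ⟩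
    0#                  ≈⟨ -‿inverseˡ _ ⟨
    - σ k x + σ k x     ∎)

  σ-∘ : ∀ j k x → σ j (σ k x) ≈ σ (j ℕ.+ k) x
  σ-∘ j k x = trans (^-assocʳ x (q ℕ.^ k) (q ℕ.^ j))
    (^-congʳ x (≡.trans (≡.sym (ℕₚ.^-distribˡ-+-* q k j)) (≡.cong (q ℕ.^_) (ℕₚ.+-comm k j))))

  σ-zero : ∀ x → σ 0 x ≈ x
  σ-zero = *-identityʳ

  σ-6 : ∀ x → σ 6 x ≈ x
  σ-6 = fermat

  σ-comm : ∀ j k x → σ j (σ k x) ≈ σ k (σ j x)
  σ-comm j k x = trans (σ-∘ j k x) (trans (^-congʳ x (≡.cong (q ℕ.^_) (ℕₚ.+-comm j k))) (sym (σ-∘ k j x)))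

  σ-≈0 : ∀ k {x} → σ k x ≈ 0# → x ≈ 0#
  σ-≈0 k = ^-≈0 (q ℕ.^ k)

  σ-injective : ∀ k {x y} → σ k x ≈ σ k y → x ≈ y
  σ-injective k {x} {y} eq = x-y≈0⇒x≈y (σ-≈0 k (begin
    σ k (x - y)         ≈⟨ σ-+ k x (- y) ⟩
    σ k x + σ k (- y)   ≈⟨ +-cong eq (σ-- k y) ⟩
    σ k y - σ k y       ≈⟨ -‿inverseʳ _ ⟩
    0#                  ∎))

  σ-sum : ∀ k {n} (t : Vector Carrier n) → σ k (sum t) ≈ sum (λ i → σ k (t i))
  σ-sum k {zero}  t = σ-0 k
  σ-sum k {suc n} t = trans (σ-+ k _ _) (+-congˡ (σ-sum k (t ∘ suc)))

  σ-^ : ∀ k x m → σ k (x ^ m) ≈ σ k x ^ m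
  σ-^ k x m = trans (^-assocʳ x m (q ℕ.^ k)) (trans (^-congʳ x (ℕₚ.*-comm m (q ℕ.^ k))) (sym (^-assocʳ x (q ℕ.^ k) m)))

-- Multisets of parameters and unique factorisation

module Extraction {a ℓ} (S : Setoid a ℓ) where

  open Setoid S using (sym)
  open Membership S using (_∈_)
  open Permutation S using (_↭_; prep; ↭-refl; ↭-trans; ↭-prep; ↭-swap)

  ∈⇒↭ : ∀ {u us} → u ∈ us → ∃[ vs ] (us ↭ u ∷ vs)
  ∈⇒↭ {us = _ ∷ us} (here u≈v) = us , prep (sym u≈v) ↭-refl
  ∈⇒↭ {u} {v ∷ _} (there u∈us) = let vs , us↭ = ∈⇒↭ u∈us in
    v ∷ vs , ↭-trans (↭-prep v us↭) (↭-swap v u ↭-refl)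

module Factorisation {c ℓ₁ ℓ₂} (K : HeytingField c ℓ₁ ℓ₂) (N : ℕ) (card : HasCardinality K N) (q : ℕ) where

  open HeytingField K hiding (zero; Carrier; _≈_; _#_; _+_; _*_; -_; _-_; 0#; 1#; heytingCommutativeRing)
  open Geometry K q
  open FiniteField K N card
  open Polynomials K N card
  open HeytingCommutativeRing heytingCommutativeRing using (commutativeRing)
  open IntegerSolver commutativeRing

  parameters : Setoid _ _
  parameters = Maybeₚ.setoid setoid

  infix 4 _≈ᵐ_
  _≈ᵐ_ = Setoid._≈_ parameters
  open Setoid parameters public using () renaming (refl to ≈ᵐ-refl; sym to ≈ᵐ-sym; trans to ≈ᵐ-trans)
  open Membership parameters public using (_∈_)
  open Permutation parameters public using (_↭_; prep; swap; ↭-refl; ↭-sym; ↭-trans; ↭-prep)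
  open Permutationₚ parameters public using (xs↭ys⇒|xs|≡|ys|; ∈-resp-↭)
  open Extraction parameters using (∈⇒↭)

  _≟ᵐ_ : Decidable _≈ᵐ_
  _≟ᵐ_ = Maybeₚ.dec _≟_

  _∈?_ : Decidable _∈_
  u ∈? us = Any.any? (u ≟ᵐ_) us

  -- The parameter at infinity contributes the factor 1, so the degree is the number of finite
  -- parameters in the list.
  factors : List (Maybe Carrier) → Carrier → Carrier
  factors us θ = foldr (λ u x → linearFactor θ u * x) 1# us

  linearFactor-cong : ∀ θ {u v} → u ≈ᵐ v → linearFactor θ u ≈ linearFactor θ v
  linearFactor-cong θ (just u≈v) = +-congˡ (-‿cong u≈v)
  linearFactor-cong θ nothing    = refl

  factors-↭ : ∀ {us vs} → us ↭ vs → ∀ θ → factors us θ ≈ factors vs θ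
  factors-↭ (Permutation.refl eqs) θ = aux eqs
    where
    aux : ∀ {us vs} → Pointwise _≈ᵐ_ us vs → factors us θ ≈ factors vs θ
    aux []          = refl
    aux (eq ∷ eqs)  = *-cong (linearFactor-cong θ eq) (aux eqs)
  factors-↭ (prep eq p) θ = *-cong (linearFactor-cong θ eq) (factors-↭ p θ)
  factors-↭ (swap {x = u} {y = v} eq₁ eq₂ p) θ = trans
    (*-cong (linearFactor-cong θ eq₁) (*-cong (linearFactor-cong θ eq₂) (factors-↭ p θ)))
    (solve 3 (λ x y z → (x :* (y :* z)) := (y :* (x :* z))) refl _ _ _)
  factors-↭ (Permutation.trans p p′) θ = trans (factors-↭ p θ) (factors-↭ p′ θ)

  Poly-factors : ∀ us → Poly (suc (length us)) (factors us)
  Poly-factors []             = Poly-const 0 1#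
  Poly-factors (just u ∷ us)  = Poly-linear u (Poly-factors us)
  Poly-factors (nothing ∷ us) = Poly-suc (Poly-cong (λ θ → sym (*-identityˡ _)) (Poly-factors us))

  factors-nothing : ∀ {us vs} → us ↭ nothing ∷ vs → ∀ θ → factors us θ ≈ factors vs θ
  factors-nothing p θ = trans (factors-↭ p θ) (*-identityˡ _)

  -- A parameter at infinity lowers the degree by one, so one coefficient fewer suffices than in
  -- `Poly-factors`.
  Poly-factors-nothing : ∀ {us} → nothing ∈ us → Poly (length us) (factors us)
  Poly-factors-nothing {us} nothing∈us with vs , us↭ ← ∈⇒↭ nothing∈us =
    ≡.subst (λ m → Poly m (factors us)) (≡.sym (xs↭ys⇒|xs|≡|ys| us↭))
      (Poly-cong (λ θ → sym (factors-nothing us↭ θ)) (Poly-factors vs))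

  root : ∀ us {θ} → just θ ∈ us → factors us θ ≈ 0#
  root (just u ∷ us) (here (just θ≈u)) = trans (*-congʳ (trans (+-congʳ θ≈u) (-‿inverseʳ u))) (zeroˡ _)
  root (u ∷ us)      (there θ∈us)      = trans (*-congˡ (root us θ∈us)) (zeroʳ _)

  root⁻¹ : ∀ us {θ} → factors us θ ≈ 0# → just θ ∈ us
  root⁻¹ []             eq = contradiction eq 1≉0
  root⁻¹ (nothing ∷ us) eq = there (root⁻¹ us (trans (sym (*-identityˡ _)) eq))
  root⁻¹ (just u ∷ us) {θ} eq with θ ≟ u
  ... | yes θ≈u = here (just θ≈u)
  ... | no θ≉u  = there (root⁻¹ us (xy≈0⇒y≈0 (x≉y⇒x-y≉0 θ≉u) eq))

  -- Cancellation is immediate away from u, and the degree bound extends it to u.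
  cancel-linear : ∀ {m f g} → m ℕ.< N → Poly m f → Poly m g → ∀ u →
                  (∀ θ → (θ - u) * f θ ≈ (θ - u) * g θ) → ∀ θ → f θ ≈ g θ
  cancel-linear {f = f} {g} m<N pf pg u eq θ = x-y≈0⇒x≈y (zero-off-point⇒zero m<N (Poly-- pf pg) u
    (λ η η≉u → trans (+-congʳ (*-cancelˡ-≉ (x≉y⇒x-y≉0 η≉u) (eq η))) (-‿inverseʳ (g η))) θ)

  swap-scalar : ∀ a x y → a * (x * y) ≈ x * (a * y)
  swap-scalar = solve 3 (λ a x y → (a :* (x :* y)) := (x :* (a :* y))) refl

  -- Without a parameter at infinity the product is monic of degree `length us`, while f has smaller
  -- degree. Dividing out the roots one after the other leaves a constant with no coefficients,
  -- equal to a.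
  leading-coefficient : ∀ us {f a} → length us ℕ.< N → ¬ (nothing ∈ us) → Poly (length us) f →
                        (∀ θ → f θ ≈ a * factors us θ) → a ≈ 0#
  leading-coefficient [] {f} {a} _ _ (nil f≈0) f≈ = trans (sym (*-identityʳ a)) (trans (sym (f≈ 0#)) (f≈0 0#))
  leading-coefficient (nothing ∷ us) _ nothing∉us _ _ = contradiction (here nothing) nothing∉us
  leading-coefficient (just u ∷ us) {f} {a} <N nothing∉us pf f≈
    with g , pg , f≈g ← factor u pf (trans (f≈ u) (trans (*-congˡ (root (just u ∷ us) (here ≈ᵐ-refl))) (zeroʳ a))) =
    leading-coefficient us (ℕₚ.<⇒≤ <N) (nothing∉us ∘ there) pg
      (cancel-linear <N (Poly-suc pg) (Poly-scale a (Poly-factors us)) u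
        (λ θ → trans (sym (f≈g θ)) (trans (f≈ θ) (swap-scalar a _ _))))

  -- A finite parameter of `us` is a root of the right side, hence occurs in `vs`, and its factor
  -- cancels. If `us` contains infinity, the left side has too low a degree for `vs` to consist of
  -- finite parameters only.
  unique-factorisation : ∀ us vs {a b} → length us ≡ length vs → length us ℕ.< N → ¬ a ≈ 0# → ¬ b ≈ 0# →
                         (∀ θ → a * factors us θ ≈ b * factors vs θ) → us ↭ vs
  unique-factorisation [] [] _ _ _ _ _ = ↭-refl
  unique-factorisation (nothing ∷ us) vs {a} {b} len <N a≉0 b≉0 eq with nothing ∈? vs
  ... | no nothing∉vs = contradiction
          (leading-coefficient vs (≡.subst (ℕ._< N) len <N) nothing∉vs
            (≡.subst (λ m → Poly m (λ θ → a * factors us θ)) len (Poly-scale a (Poly-factors us)))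
            (λ θ → trans (*-congˡ (sym (*-identityˡ _))) (eq θ)))
          b≉0
  ... | yes nothing∈vs with ws , vs↭ ← ∈⇒↭ nothing∈vs = ↭-trans
          (↭-prep nothing (unique-factorisation us ws (ℕₚ.suc-injective (≡.trans len (xs↭ys⇒|xs|≡|ys| vs↭))) (ℕₚ.<⇒≤ <N) a≉0 b≉0
            (λ θ → trans (*-congˡ (sym (*-identityˡ _))) (trans (eq θ) (*-congˡ (factors-nothing vs↭ θ))))))
          (↭-sym vs↭)
  unique-factorisation (just u ∷ us) vs {a} {b} len <N a≉0 b≉0 eq
    with ws , vs↭ ← ∈⇒↭ (root⁻¹ vs (xy≈0⇒y≈0 b≉0 (trans (sym (eq u)) (trans (*-congˡ (root (just u ∷ us) (here ≈ᵐ-refl))) (zeroʳ a))))) =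
    let len′ = ℕₚ.suc-injective (≡.trans len (xs↭ys⇒|xs|≡|ys| vs↭)) in
    ↭-trans
      (↭-prep (just u) (unique-factorisation us ws len′ (ℕₚ.<⇒≤ <N) a≉0 b≉0
        (cancel-linear <N (Poly-scale a (Poly-factors us))
          (≡.subst (λ m → Poly (suc m) (λ θ → b * factors ws θ)) (≡.sym len′) (Poly-scale b (Poly-factors ws))) u
          (λ θ → trans (sym (swap-scalar a _ _)) (trans (eq θ) (trans (*-congˡ (factors-↭ vs↭ θ)) (swap-scalar b _ _)))))))
      (↭-sym vs↭)

8≤q⇒8≤q^6 : ∀ {q} → 8 ℕ.≤ q → 8 ℕ.≤ q ℕ.^ 6
8≤q⇒8≤q^6 {q} 8≤q = ℕₚ.≤-trans 8≤q (≡.subst (ℕ._≤ q ℕ.^ 6) (ℕₚ.*-identityʳ q)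
  (ℕₚ.^-monoʳ-≤ q {{ℕ.>-nonZero (ℕₚ.≤-trans (ℕ.s≤s ℕ.z≤n) 8≤q)}} (ℕ.s≤s {n = 5} ℕ.z≤n)))

-- Vectors, proportionality and the equation of the hyperplane

module Coordinates {c ℓ₁ ℓ₂} (K : HeytingField c ℓ₁ ℓ₂) (q : ℕ) (primePower : IsPrimePower q)
                   (card : HasCardinality K (q ℕ.^ 6)) where

  open HeytingField K hiding (zero; Carrier; _≈_; _#_; _+_; _*_; -_; _-_; 0#; 1#; heytingCommutativeRing)
  open Geometry K q
  open FiniteField K (q ℕ.^ 6) card
  open Frobenius K q primePower card
  open HeytingCommutativeRing heytingCommutativeRing using (commutativeRing)
  open CommutativeRing commutativeRing using (semiring)
  open SumProperties semiring
  open IntegerSolver commutativeRing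
  open SetoidReasoning setoid

  infix 4 _≋_
  _≋_ : V → V → Set ℓ₁
  v ≋ w = ∀ j → v j ≈ w j

  ≋⇒∼ : ∀ {v w} → v ≋ w → v ∼ w
  ≋⇒∼ v≋w = 1# , ≉⇒# 1≉0 , λ j → trans (v≋w j) (sym (*-identityˡ _))

  ∼-refl : ∀ {v} → v ∼ v
  ∼-refl = ≋⇒∼ (λ _ → refl)

  scalar : ∀ {v w a} → ¬ a ≈ 0# → (∀ j → v j ≈ a * w j) → v ∼ w
  scalar a≉0 eq = _ , ≉⇒# a≉0 , eq

  ∼-sym : ∀ {v w} → v ∼ w → w ∼ v
  ∼-sym {v} {w} (a , a#0 , eq) = let b , ba≈1 = inverse (#⇒≉ a#0) in
    scalar (λ b≈0 → 1≉0 (trans (sym ba≈1) (trans (*-congʳ b≈0) (zeroˡ a)))) λ j → begin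
      w j              ≈⟨ *-identityˡ _ ⟨
      1# * w j         ≈⟨ *-congʳ ba≈1 ⟨
      b * a * w j      ≈⟨ *-assoc b a (w j) ⟩
      b * (a * w j)    ≈⟨ *-congˡ (eq j) ⟨
      b * v j          ∎

  ∼-trans : ∀ {u v w} → u ∼ v → v ∼ w → u ∼ w
  ∼-trans (a , a#0 , eq) (b , b#0 , eq′) = scalar (*-≉0 (#⇒≉ a#0) (#⇒≉ b#0)) λ j →
    trans (eq j) (trans (*-congˡ (eq′ j)) (sym (*-assoc a b _)))

  combination-cong : ∀ {m} {a b : Vector Carrier m} {v w : Vector V m} →
                     (∀ i → a i ≈ b i) → (∀ i → v i ≋ w i) → combination a v ≋ combination b w
  combination-cong {m} a≈b v≋w j = sum-cong-≋ {m} (λ i → *-cong (a≈b i) (v≋w i j))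

  combination-scale : ∀ {m} b (a : Vector Carrier m) (v : Vector V m) j →
                      combination (λ i → b * a i) v j ≈ b * combination a v j
  combination-scale {m} b a v j = trans (sum-cong-≋ {m} (λ i → *-assoc b (a i) (v i j)))
    (sym (*-distribˡ-sum b (λ i → a i * v i j)))

  combination-+ : ∀ {m} (a b : Vector Carrier m) (v : Vector V m) j →
                  combination (λ i → a i + b i) v j ≈ combination a v j + combination b v j
  combination-+ {m} a b v j = trans (sum-cong-≋ {m} (λ i → distribʳ (v i j) (a i) (b i)))
    (∑-distrib-+ (λ i → a i * v i j) (λ i → b i * v i j))

  combination-- : ∀ {m} (a b : Vector Carrier m) (v : Vector V m) j →
                  combination (λ i → a i + - 1# * b i) v j ≈ combination a v j - combination b v j
  combination-- a b v j = trans (combination-+ a (λ i → - 1# * b i) v j)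
    (+-congˡ (trans (combination-scale (- 1#) b v j)
      (solve 1 (λ x → ((:- con ℤ.1ℤ) :* x) := (:- x)) refl (combination b v j))))

  combination-combination : ∀ {m n} (x : Vector Carrier n) (y : Vector (Vector Carrier m) n) (v : Vector V m) →
    combination x (λ i → combination (y i) v) ≋ combination (λ k → sum (λ i → x i * y i k)) v
  combination-combination {m} {n} x y v j = begin
    sum (λ i → x i * sum (λ k → y i k * v k j))
      ≈⟨ sum-cong-≋ {n} (λ i → *-distribˡ-sum (x i) (λ k → y i k * v k j)) ⟩
    sum (λ i → sum (λ k → x i * (y i k * v k j)))
      ≈⟨ sum-cong-≋ {n} (λ i → sum-cong-≋ {m} (λ k → *-assoc (x i) (y i k) (v k j))) ⟨
    sum (λ i → sum (λ k → x i * y i k * v k j))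
      ≈⟨ ∑-comm (λ i k → x i * y i k * v k j) ⟩
    sum (λ k → sum (λ i → x i * y i k * v k j))
      ≈⟨ sum-cong-≋ {m} (λ k → *-distribʳ-sum (v k j) (λ i → x i * y i k)) ⟨
    sum (λ k → sum (λ i → x i * y i k) * v k j) ∎

  sum-exchange : ∀ {m n} (h : Vector Carrier n) (a : Vector Carrier m) (v : Fin m → Vector Carrier n) →
                 sum (λ j → h j * sum (λ i → a i * v i j)) ≈ sum (λ i → a i * sum (λ j → h j * v i j))
  sum-exchange {m} {n} h a v = begin
    sum (λ j → h j * sum (λ i → a i * v i j))
      ≈⟨ sum-cong-≋ {n} (λ j → *-distribˡ-sum (h j) (λ i → a i * v i j)) ⟩
    sum (λ j → sum (λ i → h j * (a i * v i j)))
      ≈⟨ ∑-comm (λ j i → h j * (a i * v i j)) ⟩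
    sum (λ i → sum (λ j → h j * (a i * v i j)))
      ≈⟨ sum-cong-≋ {m} (λ i → sum-cong-≋ {n} (λ j → solve 3 (λ h a x → (h :* (a :* x)) := (a :* (h :* x))) refl (h j) (a i) (v i j))) ⟩
    sum (λ i → sum (λ j → a i * (h j * v i j)))
      ≈⟨ sum-cong-≋ {m} (λ i → *-distribˡ-sum (a i) (λ j → h j * v i j)) ⟨
    sum (λ i → a i * sum (λ j → h j * v i j)) ∎

  frobenius-cong : ∀ k {v w} → v ≋ w → frobenius k v ≋ frobenius k w
  frobenius-cong k v≋w j = σ-cong k (v≋w j)

  frobenius-∼ : ∀ k {v w} → v ∼ w → frobenius k v ∼ frobenius k w
  frobenius-∼ k (a , a#0 , eq) = scalar (λ eq → #⇒≉ a#0 (σ-≈0 k eq)) λ j →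
    trans (σ-cong k (eq j)) (σ-* k a _)

  frobenius-combination : ∀ k {m} (a : Vector Carrier m) (v : Vector V m) →
    frobenius k (combination a v) ≋ combination (λ i → σ k (a i)) (λ i → frobenius k (v i))
  frobenius-combination k {m} a v j = trans (σ-sum k (λ i → a i * v i j))
    (sum-cong-≋ {m} (λ i → σ-* k (a i) (v i j)))

  frobenius-∘ : ∀ j k v → frobenius j (frobenius k v) ≋ frobenius (j ℕ.+ k) v
  frobenius-∘ j k v i = σ-∘ j k (v i)

  𝔽-* : ∀ k m {x} → 𝔽 k x → 𝔽 (m ℕ.* k) x
  𝔽-* k zero    {x} _ = σ-zero x
  𝔽-* k (suc m) {x} p = trans (sym (σ-∘ k (m ℕ.* k) x)) (trans (σ-cong k (𝔽-* k m p)) p)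

  𝔽1⇒𝔽 : ∀ k {x} → 𝔽 1 x → 𝔽 k x
  𝔽1⇒𝔽 k {x} p = ≡.subst (λ m → 𝔽 m x) (ℕₚ.*-identityʳ k) (𝔽-* 1 k p)

  module _ (Σ∞ : Hyperplane) where
    open Hyperplane Σ∞

    form-cong : ∀ {v w} → v ≋ w → form v ≈ form w
    form-cong {v} {w} v≋w = sum-cong-≋ {7} {λ j → coefficients j * v j} (λ j → *-congˡ {coefficients j} (v≋w j))

    form-scale : ∀ a v → form (λ j → a * v j) ≈ a * form v
    form-scale a v = trans (sum-cong-≋ {7} (λ j → solve 3 (λ h a x → (h :* (a :* x)) := (a :* (h :* x))) refl (coefficients j) a (v j)))
      (sym (*-distribˡ-sum a (λ j → coefficients j * v j)))

    form-combination : ∀ {m} (a : Vector Carrier m) (v : Vector V m) →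
                       form (combination a v) ≈ sum (λ i → a i * form (v i))
    form-combination a v = sum-exchange coefficients a v

    form-frobenius : ∀ k v → form (frobenius k v) ≈ σ k (form v)
    form-frobenius k v = sym (trans (σ-sum k (λ j → coefficients j * v j))
      (sum-cong-≋ {7} (λ j → trans (σ-* k (coefficients j) (v j)) (*-congʳ (𝔽1⇒𝔽 k (over j))))))

    form-∼ : ∀ {v w} → v ∼ w → form w ≈ 0# → form v ≈ 0#
    form-∼ {w = w} (a , _ , eq) form≈0 =
      trans (form-cong eq) (trans (form-scale a w) (trans (*-congˡ form≈0) (zeroʳ a)))

-- The curve, its parameters and its points at infinity

module Curve {c ℓ₁ ℓ₂} (K : HeytingField c ℓ₁ ℓ₂) (q : ℕ) (primePower : IsPrimePower q)
             (card : HasCardinality K (q ℕ.^ 6)) (8≤q : 8 ℕ.≤ q)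
             (Σ∞ : Geometry.Hyperplane K q) (r′ : ℕ) (r≤6 : suc r′ ℕ.≤ 6)
             (𝒩 : Geometry.NormalRationalCurve K q (suc r′)) where

  open HeytingField K hiding (zero; Carrier; _≈_; _#_; _+_; _*_; -_; _-_; 0#; 1#; heytingCommutativeRing)
  open Geometry K q
  open FiniteField K (q ℕ.^ 6) card
  open Frobenius K q primePower card
  open Polynomials K (q ℕ.^ 6) card
  open Factorisation K (q ℕ.^ 6) card q
  open Coordinates K q primePower card
  open HeytingCommutativeRing heytingCommutativeRing using (commutativeRing)
  open CommutativeRing commutativeRing using (semiring; commutativeSemiring)
  open ExpProperties commutativeSemiring using (_^_; ^-congˡ)
  open SumProperties semiring
  open IntegerSolver commutativeRing
  open SetoidReasoning setoid
  open NormalRationalCurve 𝒩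
  open Subspace space
  open Hyperplane Σ∞ using (form)

  private
    r = suc r′

  r<N : r ℕ.< q ℕ.^ 6
  r<N = ℕₚ.≤-trans (ℕ.s≤s (ℕₚ.≤-trans r≤6 (ℕₚ.n≤1+n 6))) (8≤q⇒8≤q^6 8≤q)

  σᵐ : ℕ → Maybe Carrier → Maybe Carrier
  σᵐ k = Maybe.map (σ k)

  σᵐ-cong : ∀ k {u v} → u ≈ᵐ v → σᵐ k u ≈ᵐ σᵐ k v
  σᵐ-cong k (just eq) = just (σ-cong k eq)
  σᵐ-cong k nothing   = nothing

  σᵐ-∘ : ∀ j k u → σᵐ j (σᵐ k u) ≈ᵐ σᵐ (j ℕ.+ k) u
  σᵐ-∘ j k (just x) = just (σ-∘ j k x)
  σᵐ-∘ j k nothing  = nothing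

  standard-cong : ∀ {u v} → u ≈ᵐ v → ∀ i → standard r u i ≈ standard r v i
  standard-cong (just eq) i = ^-congˡ (toℕ i) eq
  standard-cong nothing   i = refl

  at-cong : ∀ {u v} → u ≈ᵐ v → at u ≋ at v
  at-cong u≈v = combination-cong {v = basis} (standard-cong u≈v) (λ i j → refl)

  σ-standard : ∀ k u i → σ k (standard r u i) ≈ standard r (σᵐ k u) i
  σ-standard k (just θ) i = σ-^ k θ (toℕ i)
  σ-standard k nothing  i with does (i Finₚ.≟ fromℕ r)
  ... | true  = σ-1 k
  ... | false = σ-0 k

  -- The basis of the curve is over GF(q), so Frobenius acts only on the powers of the parameter.
  -- Orbits of points thereby become orbits of parameters.
  frobenius-at : ∀ k u → frobenius k (at u) ≋ at (σᵐ k u)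
  frobenius-at k u j = trans (frobenius-combination k (standard r u) basis j)
    (combination-cong {w = basis} (σ-standard k u) (λ i j → 𝔽1⇒𝔽 k (over i j)) j)

  -- Coordinate 0 separates infinity from the finite parameters and forces a to be 1. Coordinate 1,
  -- present because r is a successor, is the parameter.
  standard-injective : ∀ u v {a} → ¬ a ≈ 0# → (∀ i → standard r u i ≈ a * standard r v i) → u ≈ᵐ v
  standard-injective nothing  nothing  a≉0 eq = nothing
  standard-injective (just θ) (just η) {a} a≉0 eq = just (begin
    θ               ≈⟨ *-identityʳ θ ⟨
    θ * 1#          ≈⟨ eq (suc zero) ⟩
    a * (η * 1#)    ≈⟨ *-cong (trans (sym (*-identityʳ a)) (sym (eq zero))) (*-identityʳ η) ⟩
    1# * η          ≈⟨ *-identityˡ η ⟩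
    η               ∎)
  standard-injective (just θ) nothing  a≉0 eq = contradiction (trans (eq zero) (zeroʳ _)) 1≉0
  standard-injective nothing  (just η) a≉0 eq = contradiction (sym (eq zero)) (*-≉0 a≉0 1≉0)

  combination-injective : ∀ {m} {v : Vector V m} → LinearlyIndependent v → ∀ a b →
                          combination a v ≋ combination b v → ∀ i → a i ≈ b i
  combination-injective {v = v} ind a b eq i = x-y≈0⇒x≈y (trans
    (+-congˡ (solve 1 (λ x → (:- x) := ((:- con ℤ.1ℤ) :* x)) refl (b i)))
    (ind (λ i → a i + - 1# * b i) (λ j → trans (combination-- a b v j) (trans (+-congʳ (eq j)) (-‿inverseʳ _))) i))

  at-injective : ∀ u v → at u ∼ at v → u ≈ᵐ v
  at-injective u v (a , a#0 , eq) = standard-injective u v (#⇒≉ a#0)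
    (combination-injective {v = basis} independent (standard r u) (λ i → a * standard r v i)
      (λ j → trans (eq j) (sym (combination-scale a (standard r v) basis j))))

  coefficient : Vector Carrier (suc r)
  coefficient i = form (basis i)

  form-at : ∀ u → form (at u) ≈ sum (λ i → standard r u i * coefficient i)
  form-at u = form-combination Σ∞ (standard r u) basis

  form-at-frobenius : ∀ k u → form (at (σᵐ k u)) ≈ σ k (form (at u))
  form-at-frobenius k u = trans (form-cong Σ∞ (λ j → sym (frobenius-at k u j))) (form-frobenius Σ∞ k (at u))

  -- The value at infinity is the coefficient of θ^r in the restricted equation, so infinity is an
  -- intersection point exactly when the degree drops.
  form-at-nothing : form (at nothing) ≈ coefficient (fromℕ r)
  form-at-nothing = trans (form-at nothing) (trans
    (sum-init-last (λ i → standard r nothing i * coefficient i))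
    (trans (+-cong
      (sum≈0 (λ i → standard r nothing (inject₁ i) * coefficient (inject₁ i)) (λ i → trans (*-congʳ (reflexive
        (≡.cong (λ b → if b then 1# else 0#) (dec-false (inject₁ i Finₚ.≟ fromℕ r) (λ eq → Finₚ.fromℕ≢inject₁ (≡.sym eq)))))) (zeroˡ _)))
      (trans (*-congʳ (reflexive (≡.cong (λ b → if b then 1# else 0#) (dec-true (fromℕ r Finₚ.≟ fromℕ r) ≡.refl)))) (*-identityˡ _)))
      (+-identityˡ _)))

  form-at-just : ∀ θ → form (at (just θ)) ≈ sum (λ i → coefficient (inject₁ i) * θ ^ toℕ i) + coefficient (fromℕ r) * θ ^ r
  form-at-just θ = trans (form-at (just θ)) (trans (sum-init-last (λ i → θ ^ toℕ i * coefficient i)) (+-cong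
    (sum-cong-≋ {r} (λ i → trans (*-comm _ (coefficient (inject₁ i))) (*-congˡ (reflexive (≡.cong (θ ^_) (Finₚ.toℕ-inject₁ i))))))
    (trans (*-comm _ _) (*-congˡ (reflexive (≡.cong (θ ^_) (Finₚ.toℕ-fromℕ r)))))))

  module Intersection {us : List (Maybe Carrier)} (len : length us ≡ r) {a : Carrier} (a≉0 : ¬ a ≈ 0#)
                      (form≈ : ∀ θ → form (at (just θ)) ≈ a * factors us θ) where

    us<N : length us ℕ.< q ℕ.^ 6
    us<N = ≡.subst (ℕ._< q ℕ.^ 6) (≡.sym len) r<N

    -- The restriction of the form to the curve has its coefficients in 𝔽 1.
    stable : us ↭ map (σᵐ 1) us
    stable = unique-factorisation us (map (σᵐ 1) us) (≡.sym (Listₚ.length-map (σᵐ 1) us)) us<N a≉0 (λ eq → a≉0 (σ-≈0 1 eq)) λ θ → begin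
      a * factors us θ                                   ≈⟨ form≈ θ ⟨
      -- `σ 5` is inverse to `σ 1`. The factorisation taken at `σ 5 θ` and then raised to the q-th
      -- power is a second factorisation at θ, with conjugate roots.
      form (at (just θ))                                 ≈⟨ form-cong Σ∞ (at-cong (just (trans (σ-∘ 1 5 θ) (σ-6 θ)))) ⟨
      form (at (just (σ 1 (σ 5 θ))))                     ≈⟨ form-at-frobenius 1 (just (σ 5 θ)) ⟩
      σ 1 (form (at (just (σ 5 θ))))                     ≈⟨ σ-cong 1 (form≈ (σ 5 θ)) ⟩
      σ 1 (a * factors us (σ 5 θ))                       ≈⟨ σ-* 1 a _ ⟩
      σ 1 a * σ 1 (factors us (σ 5 θ))                   ≈⟨ *-congˡ (σ-factors us (σ 5 θ)) ⟩
      σ 1 a * factors (map (σᵐ 1) us) (σ 1 (σ 5 θ))      ≈⟨ *-congˡ (factors-cong (map (σᵐ 1) us) (trans (σ-∘ 1 5 θ) (σ-6 θ))) ⟩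
      σ 1 a * factors (map (σᵐ 1) us) θ                  ∎
      where
      factors-cong : ∀ us {θ η} → θ ≈ η → factors us θ ≈ factors us η
      factors-cong []             eq = refl
      factors-cong (just u ∷ us)  eq = *-cong (+-congʳ eq) (factors-cong us eq)
      factors-cong (nothing ∷ us) eq = *-congˡ (factors-cong us eq)
      σ-factors : ∀ us θ → σ 1 (factors us θ) ≈ factors (map (σᵐ 1) us) (σ 1 θ)
      σ-factors []             θ = σ-1 1
      σ-factors (just u ∷ us)  θ = trans (σ-* 1 _ _) (*-cong (trans (σ-+ 1 θ (- u)) (+-congˡ (σ-- 1 u))) (σ-factors us θ))
      σ-factors (nothing ∷ us) θ = trans (σ-* 1 _ _) (*-cong (σ-1 1) (σ-factors us θ))

    -- A parameter nothing in us lowers the degree of the product below r.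
    leading≈0 : nothing ∈ us → coefficient (fromℕ r) ≈ 0#
    leading≈0 nothing∈us = leading-coefficient zeros
        (≡.subst (ℕ._< q ℕ.^ 6) (≡.sym zeros-length) r<N) nothing∉zeros
        (≡.subst (λ m → Poly m leadingTerm) (≡.sym zeros-length) poly)
        (λ θ → *-congˡ (sym (zeros-factors r θ)))
      where
      leadingTerm : Carrier → Carrier
      leadingTerm θ = coefficient (fromℕ r) * θ ^ r
      lowerTerms : Carrier → Carrier
      lowerTerms θ = sum (λ i → coefficient (inject₁ i) * θ ^ toℕ i)
      -- θ^r is the product of r factors with root 0, so the degree comparison of
      -- `leading-coefficient` applies to the leading term by itself.
      zeros = List.replicate r (just 0#)
      zeros-length : length zeros ≡ r
      zeros-length = Listₚ.length-replicate r
      nothing∉ : ∀ m → ¬ (nothing ∈ List.replicate m (just 0#))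
      nothing∉ (suc m) (there p) = nothing∉ m p
      nothing∉zeros = nothing∉ r
      zeros-factors : ∀ m θ → factors (List.replicate m (just 0#)) θ ≈ θ ^ m
      zeros-factors zero    θ = refl
      zeros-factors (suc m) θ = *-cong (solve 1 (λ x → (x :- con ℤ.0ℤ) := x) refl θ) (zeros-factors m θ)
      poly : Poly r leadingTerm
      poly = Poly-cong (λ θ → trans (+-congʳ (trans (sym (form≈ θ)) (form-at-just θ)))
                         (solve 2 (λ x y → (x :+ y :- x) := y) refl (lowerTerms θ) (leadingTerm θ)))
        (Poly-- {f = λ θ → a * factors us θ} {g = lowerTerms}
          (≡.subst (λ m → Poly m (λ θ → a * factors us θ)) len (Poly-scale a (Poly-factors-nothing nothing∈us)))
          (Poly-eval (λ i → coefficient (inject₁ i))))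

    form-at≈0 : ∀ u → u ∈ us → form (at u) ≈ 0#
    form-at≈0 (just θ) θ∈us = trans (form≈ θ) (trans (*-congˡ (root us θ∈us)) (zeroʳ a))
    form-at≈0 nothing  n∈us = trans form-at-nothing (leading≈0 n∈us)

    form-at≈0⁻¹ : ∀ u → form (at u) ≈ 0# → u ∈ us
    form-at≈0⁻¹ (just θ) eq = root⁻¹ us (xy≈0⇒y≈0 a≉0 (trans (sym (form≈ θ)) eq))
    form-at≈0⁻¹ nothing  eq with nothing ∈? us
    ... | yes nothing∈us = nothing∈us
    -- A form vanishing at infinity restricts to degree below r, whereas a product of finite factors
    -- only would have degree r.
    ... | no nothing∉us  = contradiction (leading-coefficient us us<N nothing∉us
          (≡.subst (λ m → Poly m (λ θ → form (at (just θ)))) (≡.sym len)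
            (Poly-cong (λ θ → sym (trans (form-at-just θ) (trans (+-congˡ (trans (*-congʳ (trans (sym form-at-nothing) eq)) (zeroˡ _))) (+-identityʳ _))))
              (Poly-eval (λ i → coefficient (inject₁ i))))) form≈) a≉0

    meets : ∀ {Ps vs} → us ↭ vs → Pointwise (λ P u → coordinates P ∼ at u) Ps vs → MeetsWithMultiplicity Σ∞ 𝒩 Ps
    meets us↭vs Ps∼vs = _ , ≡.trans (≡.sym (xs↭ys⇒|xs|≡|ys| us↭vs)) len , Ps∼vs , a , ≉⇒# a≉0 ,
      λ θ → trans (form≈ θ) (*-congˡ (factors-↭ us↭vs θ))

    -- A point of the curve is at infinity exactly when its parameter is in `us`. Hence `vs` has to
    -- hold, up to repetition, the parameters of `us` over `𝔽 k`: usually all of them, but only one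
    -- for the GF(q) points in the case r = 4.
    commonPoints : ∀ k {Ps vs} → Pointwise (λ P u → coordinates P ∼ at u) Ps vs →
      (∀ {u} → u ∈ vs → u ∈ us × MaybeAll.All (𝔽 k) u) →
      (∀ {u} → u ∈ us → MaybeAll.All (𝔽 k) u → u ∈ vs) → CommonPoints k Σ∞ 𝒩 Ps
    commonPoints k {Ps} {vs} Ps∼vs sound complete X = mk⇔
      (λ { ((u , u∈𝔽 , X∼u) , (_ , form≈0)) →
             listed Ps∼vs (complete (form-at≈0⁻¹ u (form-∼ Σ∞ (∼-sym X∼u) form≈0)) u∈𝔽) X∼u })
      (λ X∈Ps → let u , u∈vs , X∼u = unlisted Ps∼vs X∈Ps
                    u∈us , u∈𝔽 = sound u∈vs in
                (u , u∈𝔽 , X∼u) , (at u , at-over u u∈𝔽 , X∼u) , form-∼ Σ∞ X∼u (form-at≈0 u u∈us))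
      where
      listed : ∀ {Ps vs u} → Pointwise (λ P u → coordinates P ∼ at u) Ps vs → u ∈ vs →
               coordinates X ∼ at u → Any (X ≈ₚ_) Ps
      listed (P∼v ∷ _)    (here u≈v)   X∼u = here (∼-trans X∼u (∼-trans (≋⇒∼ (at-cong u≈v)) (∼-sym P∼v)))
      listed (_ ∷ Ps∼vs)  (there u∈vs) X∼u = there (listed Ps∼vs u∈vs X∼u)
      unlisted : ∀ {Ps vs} → Pointwise (λ P u → coordinates P ∼ at u) Ps vs → Any (X ≈ₚ_) Ps →
                 ∃[ u ] (u ∈ vs × coordinates X ∼ at u)
      unlisted (P∼v ∷ _)   (here X≈P)   = _ , here ≈ᵐ-refl , ∼-trans X≈P P∼v
      unlisted (_ ∷ Ps∼vs) (there X∈Ps) = let u , u∈vs , X∼u = unlisted Ps∼vs X∈Ps in u , there u∈vs , X∼u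
      fixed : ∀ {u} → MaybeAll.All (𝔽 k) u → σᵐ k u ≈ᵐ u
      fixed (MaybeAll.just eq) = just eq
      fixed MaybeAll.nothing   = nothing
      at-over : ∀ u → MaybeAll.All (𝔽 k) u → Over k (at u)
      at-over u u∈𝔽 j = trans (frobenius-at k u j) (at-cong (fixed u∈𝔽) j)

-- A basis of the hyperplane at infinity over GF(q)

module HyperplaneBasis {c ℓ₁ ℓ₂} (K : HeytingField c ℓ₁ ℓ₂) (q : ℕ) (primePower : IsPrimePower q)
                       (card : HasCardinality K (q ℕ.^ 6)) (Σ∞ : Geometry.Hyperplane K q) where

  open HeytingField K hiding (zero; Carrier; _≈_; _#_; _+_; _*_; -_; _-_; 0#; 1#; heytingCommutativeRing)
  open Geometry K q
  open FiniteField K (q ℕ.^ 6) card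
  open Frobenius K q primePower card
  open Coordinates K q primePower card
  open HeytingCommutativeRing heytingCommutativeRing using (commutativeRing)
  open CommutativeRing commutativeRing using (semiring)
  open SumProperties semiring
  open IntegerSolver commutativeRing
  open SetoidReasoning setoid
  open Hyperplane Σ∞ using (coefficients; over; form) renaming (nonZero to coefficients-nonZero)

  δ : ∀ {n} → Fin n → Fin n → Carrier
  δ i j = if does (i Finₚ.≟ j) then 1# else 0#

  δ-same : ∀ {n} (i : Fin n) → δ i i ≈ 1#
  δ-same i = reflexive (≡.cong (λ b → if b then 1# else 0#) (dec-true (i Finₚ.≟ i) ≡.refl))

  δ-different : ∀ {n} {i j : Fin n} → i ≢ j → δ i j ≈ 0#
  δ-different {i = i} {j} i≢j = reflexive (≡.cong (λ b → if b then 1# else 0#) (dec-false (i Finₚ.≟ j) i≢j))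

  sum-δ : ∀ {n} (f : Vector Carrier n) k → sum (λ j → f j * δ k j) ≈ f k
  sum-δ {suc n} f k = begin
    sum (λ j → f j * δ k j)                                          ≈⟨ sum-remove {i = k} (λ j → f j * δ k j) ⟩
    f k * δ k k + sum (removeAt (λ j → f j * δ k j) k)               ≈⟨ +-cong (trans (*-congˡ (δ-same k)) (*-identityʳ (f k)))
      (sum≈0 (removeAt (λ j → f j * δ k j) k) (λ j → trans (*-congˡ (δ-different (Finₚ.punchInᵢ≢i k j ∘ ≡.sym))) (zeroʳ _))) ⟩
    f k + 0#                                                         ≈⟨ +-identityʳ _ ⟩
    f k                                                              ∎

  𝔽1-δ : ∀ {n} (i j : Fin n) → 𝔽 1 (δ i j)
  𝔽1-δ i j with i Finₚ.≟ j
  ... | yes _ = σ-1 1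
  ... | no _  = σ-0 1

  pivot : Fin 7
  pivot = proj₁ coefficients-nonZero

  private
    h = coefficients
    p = pivot

  h≉0 : ¬ h p ≈ 0#
  h≉0 = #⇒≉ (proj₂ coefficients-nonZero)

  -- With coefficients h and pivot p these are the vectors h_p e_k - h_k e_p for k different from p.
  -- Being over GF(q), they give points to which the spanning property of the transversals applies.
  basis∞ : Vector V 6
  basis∞ i j = h p * δ (punchIn p i) j - h (punchIn p i) * δ p j

  basis∞-over : ∀ i → Over 1 (basis∞ i)
  basis∞-over i j = trans (σ-+ 1 _ _) (+-cong
    (trans (σ-* 1 _ _) (*-cong (over p) (𝔽1-δ (punchIn p i) j)))
    (trans (σ-- 1 _) (-‿cong (trans (σ-* 1 _ _) (*-cong (over (punchIn p i)) (𝔽1-δ p j))))))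

  basis∞-form : ∀ i → form (basis∞ i) ≈ 0#
  basis∞-form i = begin
    sum (λ j → h j * (h p * δ (punchIn p i) j - h k * δ p j))
      ≈⟨ sum-cong-≋ {7} (λ j → solve 5 (λ x a y b z → (x :* (a :* y :- b :* z)) := (a :* (x :* y) :+ (:- b) :* (x :* z))) refl (h j) (h p) (δ k j) (h k) (δ p j)) ⟩
    sum (λ j → h p * (h j * δ k j) + - h k * (h j * δ p j))
      ≈⟨ ∑-distrib-+ (λ j → h p * (h j * δ k j)) (λ j → - h k * (h j * δ p j)) ⟩
    sum (λ j → h p * (h j * δ k j)) + sum (λ j → - h k * (h j * δ p j))
      ≈⟨ +-cong (*-distribˡ-sum (h p) (λ j → h j * δ k j)) (*-distribˡ-sum (- h k) (λ j → h j * δ p j)) ⟨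
    h p * sum (λ j → h j * δ k j) + - h k * sum (λ j → h j * δ p j)
      ≈⟨ +-cong (*-congˡ (sum-δ h k)) (*-congˡ (sum-δ h p)) ⟩
    h p * h k + - h k * h p
      ≈⟨ solve 2 (λ a b → (a :* b :+ (:- b) :* a) := con ℤ.0ℤ) refl (h p) (h k) ⟩
    0# ∎
    where k = punchIn p i

  -- Away from the pivot each coordinate is nonzero in a single basis vector only, so independence
  -- can be read off there.
  basis∞-coordinate : ∀ x k → combination x basis∞ (punchIn p k) ≈ h p * x k
  basis∞-coordinate x k = begin
    sum (λ i → x i * (h p * δ (punchIn p i) (punchIn p k) - h (punchIn p i) * δ p (punchIn p k)))
      ≈⟨ sum-cong-≋ {6} (λ i → trans (*-congˡ (+-cong (*-congˡ (δ-punchIn i)) (-‿cong (*-congˡ (δ-different (Finₚ.punchInᵢ≢i p k ∘ ≡.sym))))))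
           (solve 4 (λ x a d b → (x :* (a :* d :- b :* con ℤ.0ℤ)) := (a :* (x :* d))) refl (x i) (h p) (δ k i) (h (punchIn p i)))) ⟩
    sum (λ i → h p * (x i * δ k i))
      ≈⟨ *-distribˡ-sum (h p) (λ i → x i * δ k i) ⟨
    h p * sum (λ i → x i * δ k i)
      ≈⟨ *-congˡ (sum-δ x k) ⟩
    h p * x k ∎
    where
    δ-punchIn : ∀ i → δ (punchIn p i) (punchIn p k) ≈ δ k i
    δ-punchIn i with k Finₚ.≟ i
    ... | yes ≡.refl = δ-same (punchIn p k)
    ... | no k≢i     = δ-different (λ eq → k≢i (≡.sym (Finₚ.punchIn-injective p i k eq)))

  basis∞-independent : LinearlyIndependent basis∞
  basis∞-independent x eq i = xy≈0⇒y≈0 h≉0 (trans (sym (basis∞-coordinate x i)) (eq (punchIn p i)))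

  basis∞-nonZero : ∀ i → NonZero (basis∞ i)
  basis∞-nonZero i = punchIn p i , ≉⇒# λ eq → h≉0 (begin
    h p                                                                             ≈⟨ solve 2 (λ a b → a := (a :* con ℤ.1ℤ :- b :* con ℤ.0ℤ)) refl (h p) (h (punchIn p i)) ⟩
    h p * 1# - h (punchIn p i) * 0#                                                 ≈⟨ +-cong (*-congˡ (δ-same (punchIn p i))) (-‿cong (*-congˡ (δ-different (Finₚ.punchInᵢ≢i p i ∘ ≡.sym)))) ⟨
    basis∞ i (punchIn p i)                                                          ≈⟨ eq ⟩
    0#                                                                              ∎)

  basis∞-point : Fin 6 → Point
  basis∞-point i = point (basis∞ i) (basis∞-nonZero i)

  basis∞∈Σ∞ : ∀ i → basis∞-point i ∈ Σ∞ ⟨ 3 ⟩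
  basis∞∈Σ∞ i = (basis∞ i , (λ j → 𝔽1⇒𝔽 3 (basis∞-over i j)) , ∼-refl) , basis∞-form i

-- Independence of the transversal lines

module Transversals {c ℓ₁ ℓ₂} (K : HeytingField c ℓ₁ ℓ₂) (q : ℕ) (primePower : IsPrimePower q)
                    (card : HasCardinality K (q ℕ.^ 6)) (Σ∞ : Geometry.Hyperplane K q)
                    (S : Geometry.RegularSpread K q Σ∞) where

  open HeytingField K hiding (zero; Carrier; _≈_; _#_; _+_; _*_; -_; _-_; 0#; 1#; heytingCommutativeRing)
  open Geometry K q
  open FiniteField K (q ℕ.^ 6) card
  open LinearAlgebra K (q ℕ.^ 6) card
  open Frobenius K q primePower card
  open Coordinates K q primePower card
  open HyperplaneBasis K q primePower card Σ∞
  open HeytingCommutativeRing heytingCommutativeRing using (commutativeRing)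
  open CommutativeRing commutativeRing using (semiring)
  open SumProperties semiring
  open IntegerSolver commutativeRing
  open SetoidReasoning setoid
  open RegularSpread S
  open Subspace g

  -- The index may be any natural number, so that Frobenius simply adds to it. The predicate is on
  -- vectors, zero included, which makes a transversal a linear subspace closed under differences.
  OnTransversal : ℕ → V → Set _
  OnTransversal n v = ∃[ a ] (v ≋ combination a (λ l → frobenius n (basis l)))

  OnTransversal-cong : ∀ n {v w} → v ≋ w → OnTransversal n v → OnTransversal n w
  OnTransversal-cong n v≋w (a , eq) = a , λ j → trans (sym (v≋w j)) (eq j)

  OnTransversal-scale : ∀ n b {v} → OnTransversal n v → OnTransversal n (λ j → b * v j)
  OnTransversal-scale n b (a , eq) = (λ i → b * a i) , λ j →
    trans (*-congˡ (eq j)) (sym (combination-scale b a (λ l → frobenius n (basis l)) j))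

  OnTransversal-- : ∀ n {v w} → OnTransversal n v → OnTransversal n w → OnTransversal n (λ j → v j - w j)
  OnTransversal-- n (a , eq) (b , eq′) = (λ i → a i + - 1# * b i) , λ j →
    trans (+-cong (eq j) (-‿cong (eq′ j))) (sym (combination-- a b (λ l → frobenius n (basis l)) j))

  OnTransversal-0 : ∀ n → OnTransversal n (λ _ → 0#)
  OnTransversal-0 n = (λ _ → 0#) , λ j → sym (sum≈0 {2} _ (λ l → zeroˡ (frobenius n (basis l) j)))

  OnTransversal-frobenius : ∀ m n {v} → OnTransversal n v → OnTransversal (m ℕ.+ n) (frobenius m v)
  OnTransversal-frobenius m n (a , eq) = (λ l → σ m (a l)) , λ j →
    trans (frobenius-cong m eq j) (trans (frobenius-combination m a (λ l → frobenius n (basis l)) j)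
      (combination-cong {a = λ l → σ m (a l)} {w = λ l → frobenius (m ℕ.+ n) (basis l)} (λ _ → refl) (λ l → frobenius-∘ m n (basis l)) j))

  -- The line g has a basis over GF(q^3); this makes the indices of transversals cyclic modulo 3.
  frobenius-3-basis : ∀ n l → frobenius (3 ℕ.+ n) (basis l) ≋ frobenius n (basis l)
  frobenius-3-basis n l j = trans (sym (σ-∘ 3 n (basis l j))) (trans (σ-comm 3 n (basis l j)) (σ-cong n (over l j)))

  OnTransversal-3+ : ∀ n {v} → OnTransversal (3 ℕ.+ n) v → OnTransversal n v
  OnTransversal-3+ n (a , eq) = a , λ j → trans (eq j)
    (combination-cong {a = a} {w = λ l → frobenius n (basis l)} (λ _ → refl) (frobenius-3-basis n) j)

  OnTransversal-3+⁻¹ : ∀ n {v} → OnTransversal n v → OnTransversal (3 ℕ.+ n) v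
  OnTransversal-3+⁻¹ n (a , eq) = a , λ j → trans (eq j)
    (combination-cong {a = a} {w = λ l → frobenius (3 ℕ.+ n) (basis l)} (λ _ → refl) (λ l j → sym (frobenius-3-basis n l j)) j)

  OnTransversal-*3 : ∀ m n {v} → OnTransversal (m ℕ.* 3 ℕ.+ n) v → OnTransversal n v
  OnTransversal-*3 zero    n T = T
  OnTransversal-*3 (suc m) n T = OnTransversal-*3 m n (OnTransversal-3+ (m ℕ.* 3 ℕ.+ n) T)

  spanningBasis : Vector V 6
  spanningBasis = transversalBasis g 0F Vector.++ (transversalBasis g 1F Vector.++ transversalBasis g 2F)

  -- Six independent vectors of the hyperplane are combinations of the six vectors
  -- of spanningBasis, so a relation between the latter would give seven rows in K⁶
  -- whose kernel contradicts that independence.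
  spanningBasis-independent : LinearlyIndependent spanningBasis
  spanningBasis-independent a a-relation k with a k ≟ 0#
  ... | yes aₖ≈0 = aₖ≈0
  ... | no aₖ≉0  = let x , (i , xᵢ≉0) , eq = kernel D in ⊥-elim (xᵢ≉0 (trivial x eq i))
    where
    coefficientsOf : ∀ i → basis∞-point i ∈⟨ spanningBasis ⟩
    coefficientsOf i = spanning (basis∞-point i) (basis∞∈Σ∞ i)
    D : Fin 7 → Fin 6 → Carrier
    D zero    = a
    D (suc i) = proj₁ (coefficientsOf i)
    trivial : ∀ x → (∀ j → sum (λ i → x i * D i j) ≈ 0#) → ∀ i → x i ≈ 0#
    trivial x eq = λ where
        zero    → x₀≈0
        (suc i) → tail≈0 i
      where
      tail≈0 : ∀ i → x (suc i) ≈ 0#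
      tail≈0 = basis∞-independent (x ∘ suc) λ j → begin
        combination (x ∘ suc) basis∞ j
          ≈⟨ combination-cong {a = x ∘ suc} {v = basis∞} (λ _ → refl) (λ i → proj₂ (coefficientsOf i)) j ⟩
        combination (x ∘ suc) (λ i → combination (D (suc i)) spanningBasis) j
          ≈⟨ +-identityˡ _ ⟨
        0# + combination (x ∘ suc) (λ i → combination (D (suc i)) spanningBasis) j
          ≈⟨ +-congʳ (trans (*-congˡ (a-relation j)) (zeroʳ (x zero))) ⟨
        combination x (λ i → combination (D i) spanningBasis) j
          ≈⟨ combination-combination x D spanningBasis j ⟩
        combination (λ k → sum (λ i → x i * D i k)) spanningBasis j
          ≈⟨ sum≈0 _ (λ k → trans (*-congʳ (eq k)) (zeroˡ (spanningBasis k j))) ⟩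
        0# ∎
      x₀≈0 : x zero ≈ 0#
      x₀≈0 = xy≈0⇒y≈0 aₖ≉0 (begin
        a k * x zero                                         ≈⟨ *-comm _ _ ⟩
        x zero * a k                                         ≈⟨ +-identityʳ _ ⟨
        x zero * a k + 0#                                    ≈⟨ +-congˡ (sum≈0 (λ i → x (suc i) * D (suc i) k) (λ i → trans (*-congʳ (tail≈0 i)) (zeroˡ _))) ⟨
        sum (λ i → x i * D i k)                              ≈⟨ eq k ⟩
        0#                                                   ∎)

  direct₀ : ∀ {x y z} → OnTransversal 0 x → OnTransversal 1 y → OnTransversal 2 z →
            (∀ j → x j + y j + z j ≈ 0#) → (∀ j → x j ≈ 0#) × (∀ j → y j ≈ 0#) × (∀ j → z j ≈ 0#)
  direct₀ {x} {y} {z} (a , x≋) (b , y≋) (c , z≋) eq =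
      (λ j → trans (x≋ j) (vanish a 0 j (zeros 0F) (zeros 1F))) ,
      (λ j → trans (y≋ j) (vanish b 1 j (zeros 2F) (zeros 3F))) ,
      (λ j → trans (z≋ j) (vanish c 2 j (zeros 4F) (zeros 5F)))
    where
    vanish : ∀ (a : Vector Carrier 2) n j → a 0F ≈ 0# → a 1F ≈ 0# → combination a (λ l → frobenius n (basis l)) j ≈ 0#
    vanish a n j a₀≈0 a₁≈0 = sum≈0 {2} (λ l → a l * frobenius n (basis l) j) λ where
      0F → trans (*-congʳ a₀≈0) (zeroˡ _)
      1F → trans (*-congʳ a₁≈0) (zeroˡ _)
    zeros : ∀ k → (a Vector.++ (b Vector.++ c)) k ≈ 0#
    zeros = spanningBasis-independent (a Vector.++ (b Vector.++ c)) λ j → trans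
      (solve 6 (λ a b c d e f → (a :+ (b :+ (c :+ (d :+ (e :+ (f :+ con ℤ.0ℤ))))))
                  := ((a :+ (b :+ con ℤ.0ℤ)) :+ (c :+ (d :+ con ℤ.0ℤ)) :+ (e :+ (f :+ con ℤ.0ℤ)))) refl _ _ _ _ _ _)
      (trans (sym (+-cong (+-cong (x≋ j) (y≋ j)) (z≋ j))) (eq j))

  -- Since 2n + (k + n) = 3n + k, the 2n-th Frobenius power undoes a shift by n without subtraction.
  OnTransversal-rotate : ∀ n k {v} → OnTransversal (k ℕ.+ n) v → OnTransversal k (frobenius (2 ℕ.* n) v)
  OnTransversal-rotate n k {v} T =
    OnTransversal-*3 n k (≡.subst (λ i → OnTransversal i (frobenius m v)) index (OnTransversal-frobenius m (k ℕ.+ n) T))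
    where
    m = 2 ℕ.* n
    index : m ℕ.+ (k ℕ.+ n) ≡ n ℕ.* 3 ℕ.+ k
    index = ≡.trans (≡.cong (m ℕ.+_) (ℕₚ.+-comm k n)) (≡.trans (≡.sym (ℕₚ.+-assoc m n k)) (≡.cong (ℕ._+ k)
      (≡.trans (ℕₚ.+-comm m n) (ℕₚ.*-comm 3 n))))

  -- Rotation brings the two transversals to the indices 0 and 1, where `direct₀` applies with third
  -- summand 0.
  direct : ∀ n {x y} → OnTransversal n x → OnTransversal (1 ℕ.+ n) y → (∀ j → x j + y j ≈ 0#) →
           (∀ j → x j ≈ 0#) × (∀ j → y j ≈ 0#)
  direct n {x} {y} Tx Ty eq =
    let m = 2 ℕ.* n
        x≈0 , y≈0 , _ = direct₀ (OnTransversal-rotate n 0 Tx) (OnTransversal-rotate n 1 Ty) (OnTransversal-0 2) λ j → begin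
          σ m (x j) + σ m (y j) + 0#   ≈⟨ +-identityʳ _ ⟩
          σ m (x j) + σ m (y j)        ≈⟨ σ-+ m (x j) (y j) ⟨
          σ m (x j + y j)              ≈⟨ σ-cong m (eq j) ⟩
          σ m 0#                       ≈⟨ σ-0 m ⟩
          0#                           ∎
    in (λ j → σ-≈0 m (x≈0 j)) , (λ j → σ-≈0 m (y≈0 j))

-- Points of weight two and planes of the spread

module WeightTwo {c ℓ₁ ℓ₂} (K : HeytingField c ℓ₁ ℓ₂) (q : ℕ) (primePower : IsPrimePower q)
                 (card : HasCardinality K (q ℕ.^ 6)) (8≤q : 8 ℕ.≤ q) (Σ∞ : Geometry.Hyperplane K q)
                 (S : Geometry.RegularSpread K q Σ∞) where

  open HeytingField K hiding (zero; Carrier; _≈_; _#_; _+_; _*_; -_; _-_; 0#; 1#; heytingCommutativeRing)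
  open Geometry K q
  open FiniteField K (q ℕ.^ 6) card
  open Polynomials K (q ℕ.^ 6) card
  open LinearAlgebra K (q ℕ.^ 6) card
  open Frobenius K q primePower card
  open Coordinates K q primePower card
  open Transversals K q primePower card Σ∞ S
  open HeytingCommutativeRing heytingCommutativeRing using (commutativeRing)
  open CommutativeRing commutativeRing using (semiring; commutativeSemiring)
  open ExpProperties commutativeSemiring using (_^_; ^-congˡ)
  open SumProperties semiring
  open IntegerSolver commutativeRing
  open SetoidReasoning setoid
  open RegularSpread S
  open Subspace g
  open Hyperplane Σ∞ using (form)

  ≉0⇒NonZero : ∀ {v} → ¬ (∀ j → v j ≈ 0#) → NonZero v
  ≉0⇒NonZero {v} v≉0 = let j , vⱼ≉0 = Finₚ.¬∀⟶∃¬ 7 (λ j → v j ≈ 0#) (λ j → v j ≟ 0#) v≉0 in j , ≉⇒# vⱼ≉0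

  NonZero⇒≉0 : ∀ {v} → NonZero v → ¬ (∀ j → v j ≈ 0#)
  NonZero⇒≉0 (j , vⱼ#0) v≈0 = #⇒≉ vⱼ#0 (v≈0 j)

  scale≈0⇒≈0 : ∀ {v a} → NonZero v → (∀ j → a * v j ≈ 0#) → a ≈ 0#
  scale≈0⇒≈0 {v} {a} (j , vⱼ#0) eq = xy≈0⇒y≈0 (#⇒≉ vⱼ#0) (trans (*-comm (v j) a) (eq j))

  OnSomeTransversal : V → Set _
  OnSomeTransversal v = ∃[ n ] OnTransversal n v

  OnSomeTransversal⇒ : ∀ {P} → OnSomeTransversal (coordinates P) → OnExtendedTransversal S P
  OnSomeTransversal⇒ {P} (n , T) = reduce n T
    where
    reduce : ∀ n → OnTransversal n (coordinates P) → OnExtendedTransversal S P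
    reduce 0 T = 0F , T
    reduce 1 T = 1F , T
    reduce 2 T = 2F , T
    reduce (suc (suc (suc n))) T = reduce n (OnTransversal-3+ n T)

  ⇒OnSomeTransversal : ∀ {P} → OnExtendedTransversal S P → OnSomeTransversal (coordinates P)
  ⇒OnSomeTransversal (i , T) = toℕ i , T

  OnTransversal-∼ : ∀ n {v w} → v ∼ w → OnTransversal n w → OnTransversal n v
  OnTransversal-∼ n (a , _ , eq) T = OnTransversal-cong n (λ j → sym (eq j)) (OnTransversal-scale n a T)

  OnSomeTransversal-∼ : ∀ {v w} → v ∼ w → OnSomeTransversal w → OnSomeTransversal v
  OnSomeTransversal-∼ v∼w (n , T) = n , OnTransversal-∼ n v∼w T

  OnSomeTransversal-frobenius : ∀ m {v} → OnSomeTransversal v → OnSomeTransversal (frobenius m v)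
  OnSomeTransversal-frobenius m (n , T) = m ℕ.+ n , OnTransversal-frobenius m n T

  -- Any two of the three transversals are consecutive in one of the two orders, so
  -- this covers all lines meeting two of them.
  Splits : ℕ → V → Set _
  Splits n v = ∃[ x ] ∃[ y ] (OnTransversal n x × OnTransversal (1 ℕ.+ n) y × (∀ j → v j ≈ x j + y j))

  -- In the basis of the line, X and Y have a 2 by 2 determinant. If it vanishes, each coordinate of
  -- Y times X is a multiple of Y on another transversal, so by `direct` Y would be 0. Otherwise
  -- Cramer's rule writes P in terms of X and Y.
  meetsBoth⇒Splits : ∀ n (ℓ : Subspace 6 1) {P X Y} →
    P ∈⟨ Subspace.basis ℓ ⟩ → X ∈⟨ Subspace.basis ℓ ⟩ → Y ∈⟨ Subspace.basis ℓ ⟩ →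
    OnTransversal n (coordinates X) → OnTransversal (1 ℕ.+ n) (coordinates Y) → Splits n (coordinates P)
  meetsBoth⇒Splits n ℓ {P} {X} {Y} (p , P≋) (x , X≋) (y , Y≋) TX TY with (x 0F * y 1F - x 1F * y 0F) ≟ 0#
  ... | yes D≈0 = ⊥-elim (NonZero⇒≉0 (nonZero Y) Y≈0)
    where
    open Subspace ℓ renaming (basis to b)
    multiples : ∀ i → (∀ j → y i * coordinates X j ≈ x i * coordinates Y j) → y i ≈ 0#
    multiples i eq = scale≈0⇒≈0 (nonZero X) (proj₁ (direct n (OnTransversal-scale n (y i) TX)
      (OnTransversal-scale (1 ℕ.+ n) (- x i) TY) (λ j → trans (+-congʳ (eq j))
        (solve 2 (λ x w → (x :* w :+ (:- x) :* w) := con ℤ.0ℤ) refl (x i) (coordinates Y j)))))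
    y₀≈0 : y 0F ≈ 0#
    y₀≈0 = multiples 0F (λ j → x-y≈0⇒x≈y (begin
      y 0F * coordinates X j - x 0F * coordinates Y j
        ≈⟨ +-cong (*-congˡ (X≋ j)) (-‿cong (*-congˡ (Y≋ j))) ⟩
      y 0F * combination x b j - x 0F * combination y b j
        ≈⟨ solve 6 (λ x₀ x₁ y₀ y₁ b₀ b₁ →
             (y₀ :* (x₀ :* b₀ :+ (x₁ :* b₁ :+ con ℤ.0ℤ)) :- x₀ :* (y₀ :* b₀ :+ (y₁ :* b₁ :+ con ℤ.0ℤ)))
               := (:- ((x₀ :* y₁ :- x₁ :* y₀) :* b₁))) refl (x 0F) (x 1F) (y 0F) (y 1F) (b 0F j) (b 1F j) ⟩
      - ((x 0F * y 1F - x 1F * y 0F) * b 1F j)        ≈⟨ -‿cong (*-congʳ D≈0) ⟩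
      - (0# * b 1F j)                                 ≈⟨ solve 1 (λ b → (:- (con ℤ.0ℤ :* b)) := con ℤ.0ℤ) refl (b 1F j) ⟩
      0#                                              ∎))
    y₁≈0 : y 1F ≈ 0#
    y₁≈0 = multiples 1F (λ j → x-y≈0⇒x≈y (begin
      y 1F * coordinates X j - x 1F * coordinates Y j
        ≈⟨ +-cong (*-congˡ (X≋ j)) (-‿cong (*-congˡ (Y≋ j))) ⟩
      y 1F * combination x b j - x 1F * combination y b j
        ≈⟨ solve 6 (λ x₀ x₁ y₀ y₁ b₀ b₁ →
             (y₁ :* (x₀ :* b₀ :+ (x₁ :* b₁ :+ con ℤ.0ℤ)) :- x₁ :* (y₀ :* b₀ :+ (y₁ :* b₁ :+ con ℤ.0ℤ)))
               := ((x₀ :* y₁ :- x₁ :* y₀) :* b₀)) refl (x 0F) (x 1F) (y 0F) (y 1F) (b 0F j) (b 1F j) ⟩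
      (x 0F * y 1F - x 1F * y 0F) * b 0F j            ≈⟨ *-congʳ D≈0 ⟩
      0# * b 0F j                                     ≈⟨ zeroˡ _ ⟩
      0#                                              ∎))
    Y≈0 : ∀ j → coordinates Y j ≈ 0#
    Y≈0 j = trans (Y≋ j) (sum≈0 {2} (λ i → y i * b i j) λ where
      0F → trans (*-congʳ y₀≈0) (zeroˡ _)
      1F → trans (*-congʳ y₁≈0) (zeroˡ _))
  ... | no D≉0 = _ , _ , OnTransversal-scale n α TX , OnTransversal-scale (1 ℕ.+ n) β TY , λ j → begin
      coordinates P j
        ≈⟨ P≋ j ⟩
      combination p b j
        ≈⟨ *-identityˡ _ ⟨
      1# * combination p b j
        ≈⟨ *-congʳ wD≈1 ⟨
      w * (x 0F * y 1F - x 1F * y 0F) * combination p b j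
        ≈⟨ cramer w (x 0F) (x 1F) (y 0F) (y 1F) (p 0F) (p 1F) (b 0F j) (b 1F j) ⟩
      α * combination x b j + β * combination y b j
        ≈⟨ +-cong (*-congˡ (X≋ j)) (*-congˡ (Y≋ j)) ⟨
      α * coordinates X j + β * coordinates Y j ∎
    where
    open Subspace ℓ renaming (basis to b)
    w = proj₁ (inverse D≉0)
    wD≈1 = proj₂ (inverse D≉0)
    α = w * (p 0F * y 1F - p 1F * y 0F)
    β = w * (x 0F * p 1F - x 1F * p 0F)
    cramer : ∀ w x₀ x₁ y₀ y₁ p₀ p₁ b₀ b₁ → w * (x₀ * y₁ - x₁ * y₀) * (p₀ * b₀ + (p₁ * b₁ + 0#)) ≈
      w * (p₀ * y₁ - p₁ * y₀) * (x₀ * b₀ + (x₁ * b₁ + 0#)) + w * (x₀ * p₁ - x₁ * p₀) * (y₀ * b₀ + (y₁ * b₁ + 0#))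
    cramer = solve 9 (λ w x₀ x₁ y₀ y₁ p₀ p₁ b₀ b₁ →
      (w :* (x₀ :* y₁ :- x₁ :* y₀) :* (p₀ :* b₀ :+ (p₁ :* b₁ :+ con ℤ.0ℤ))) :=
      (w :* (p₀ :* y₁ :- p₁ :* y₀) :* (x₀ :* b₀ :+ (x₁ :* b₁ :+ con ℤ.0ℤ)) :+ w :* (x₀ :* p₁ :- x₁ :* p₀) :* (y₀ :* b₀ :+ (y₁ :* b₁ :+ con ℤ.0ℤ)))) refl

  lineMeetingTwo⇒Splits : ∀ {P} → OnLineMeetingTwoTransversals S P → ∃[ n ] Splits n (coordinates P)
  lineMeetingTwo⇒Splits {P} (ℓ , P∈ℓ , i , j , i≢j , (X , X∈ℓ , TX) , (Y , Y∈ℓ , TY)) = cases i j i≢j TX TY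
    where
    forward : ∀ n → OnTransversal n (coordinates X) → OnTransversal (1 ℕ.+ n) (coordinates Y) → ∃[ n ] Splits n (coordinates P)
    forward n TX TY = n , meetsBoth⇒Splits n ℓ {P} {X} {Y} P∈ℓ X∈ℓ Y∈ℓ TX TY
    backward : ∀ n → OnTransversal (1 ℕ.+ n) (coordinates X) → OnTransversal n (coordinates Y) → ∃[ n ] Splits n (coordinates P)
    backward n TX TY = n , meetsBoth⇒Splits n ℓ {P} {Y} {X} P∈ℓ Y∈ℓ X∈ℓ TY TX
    cases : ∀ i j → i ≢ j → OnTransversal (toℕ i) (coordinates X) → OnTransversal (toℕ j) (coordinates Y) →
            ∃[ n ] Splits n (coordinates P)
    cases 0F 0F i≢j _ _ = contradiction ≡.refl i≢j
    cases 1F 1F i≢j _ _ = contradiction ≡.refl i≢j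
    cases 2F 2F i≢j _ _ = contradiction ≡.refl i≢j
    cases 0F 1F _ TX TY = forward 0 TX TY
    cases 1F 2F _ TX TY = forward 1 TX TY
    -- The transversals 2 and 0 become consecutive once 0 is read as 3.
    cases 2F 0F _ TX TY = forward 2 TX (OnTransversal-3+⁻¹ 0 TY)
    cases 1F 0F _ TX TY = backward 0 TX TY
    cases 2F 1F _ TX TY = backward 1 TX TY
    cases 0F 2F _ TX TY = backward 2 (OnTransversal-3+⁻¹ 0 TX) TY

  Splits-∼ : ∀ n {v w} → v ∼ w → Splits n w → Splits n v
  Splits-∼ n (a , _ , eq) (x , y , Tx , Ty , w≋) = _ , _ , OnTransversal-scale n a Tx , OnTransversal-scale (1 ℕ.+ n) a Ty ,
    λ j → trans (eq j) (trans (*-congˡ (w≋ j)) (distribˡ a _ _))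

  Splits-rotate : ∀ n {v} → Splits n v → Splits 0 (frobenius (2 ℕ.* n) v)
  Splits-rotate n (x , y , Tx , Ty , v≋) = _ , _ , OnTransversal-rotate n 0 Tx , OnTransversal-rotate n 1 Ty ,
    λ j → trans (σ-cong (2 ℕ.* n) (v≋ j)) (σ-+ (2 ℕ.* n) (x j) (y j))

  -- Dividing by a nonzero coordinate makes that coordinate 1. The scaled vector is still an
  -- eigenvector, and its factor must be 1 because the coordinate 1 is fixed.
  fixed⇒over : ∀ k {v a} → NonZero v → (∀ j → frobenius k v j ≈ a * v j) → ∃[ w ] (Over k w × v ∼ w)
  fixed⇒over k {v} {a} (j₀ , v₀#0) eq =
    let b , bv₀≈1 = inverse (#⇒≉ v₀#0)
        b≉0 : ¬ b ≈ 0#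
        b≉0 b≈0 = 1≉0 (trans (sym bv₀≈1) (trans (*-congʳ b≈0) (zeroˡ _)))
        σb*a≈b : σ k b * a ≈ b
        σb*a≈b = *-cancelˡ-≉ (#⇒≉ v₀#0) (begin
          v j₀ * (σ k b * a)       ≈⟨ solve 3 (λ v b a → (v :* (b :* a)) := (b :* (a :* v))) refl (v j₀) (σ k b) a ⟩
          σ k b * (a * v j₀)       ≈⟨ *-congˡ (eq j₀) ⟨
          σ k b * σ k (v j₀)       ≈⟨ σ-* k b (v j₀) ⟨
          σ k (b * v j₀)           ≈⟨ σ-cong k bv₀≈1 ⟩
          σ k 1#                   ≈⟨ σ-1 k ⟩
          1#                       ≈⟨ bv₀≈1 ⟨
          b * v j₀                 ≈⟨ *-comm _ _ ⟩
          v j₀ * b                 ∎)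
    in (λ j → b * v j) ,
       (λ j → begin
          σ k (b * v j)            ≈⟨ σ-* k b (v j) ⟩
          σ k b * σ k (v j)        ≈⟨ *-congˡ (eq j) ⟩
          σ k b * (a * v j)        ≈⟨ *-assoc _ a (v j) ⟨
          σ k b * a * v j          ≈⟨ *-congʳ σb*a≈b ⟩
          b * v j                  ∎) ,
       ∼-sym (scalar b≉0 (λ j → refl))

  frobenius-0 : ∀ v → frobenius 0 v ≋ v
  frobenius-0 v j = σ-zero (v j)

  OnTransversal-zero⇒ : ∀ {P} → OnTransversal 0 (coordinates P) → OnG** S P
  OnTransversal-zero⇒ (a , eq) = a , λ j → trans (eq j) (combination-cong {a = a} {w = basis} (λ _ → refl) (λ l → frobenius-0 (basis l)) j)

  -- The plane has a basis over GF(q), so Frobenius changes only the coefficients and stays in the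
  -- same plane. Exponent 0 covers a mere change of coordinate vector.
  InExtendedPlane-frobenius : ∀ k {P Q} → coordinates Q ∼ frobenius k (coordinates P) → InExtendedPlane S P → InExtendedPlane S Q
  InExtendedPlane-frobenius k (b , _ , Q≋) (π , element , (a , P≋)) = π , element , (λ i → b * σ k (a i)) , λ j →
    trans (Q≋ j) (trans (*-congˡ (trans (frobenius-cong k P≋ j) (trans (frobenius-combination k a (Subspace.basis π) j)
      (combination-cong {a = λ i → σ k (a i)} {w = Subspace.basis π} (λ _ → refl) (λ i j → 𝔽1⇒𝔽 k (Subspace.over π i j)) j))))
      (sym (combination-scale b (λ i → σ k (a i)) (Subspace.basis π) j)))

  -- Lying in an extended plane must be witnessed by a plane of PG(6,q), so the span of X and its
  -- conjugates needs a basis over GF(q).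
  module SpreadPlane (v : V) (v-over : Over 3 v) (v-nonZero : NonZero v) (Tv : OnTransversal 0 v) where

    X : Point
    X = point v v-nonZero

    conjugate : Vector V 3
    conjugate k = frobenius (toℕ k) v

    X∈g : OnG S X
    X∈g = (v , v-over , ∼-refl) , OnTransversal-zero⇒ {X} Tv

    conjugate-form : ∀ k → form (conjugate k) ≈ 0#
    conjugate-form k = trans (form-frobenius Σ∞ (toℕ k) v) (trans (σ-cong (toℕ k) (g⊂Σ∞ X (proj₂ X∈g))) (σ-0 (toℕ k)))

    conjugate-independent : LinearlyIndependent conjugate
    conjugate-independent a eq = λ where
        0F → nonzero 0F (proj₁ zeros)
        1F → nonzero 1F (proj₁ (proj₂ zeros))
        2F → nonzero 2F (proj₂ (proj₂ zeros))
      where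
      T : ∀ k → OnTransversal (toℕ k) (λ j → a k * conjugate k j)
      T k = OnTransversal-scale (toℕ k) (a k) (≡.subst (λ n → OnTransversal n (conjugate k)) (ℕₚ.+-identityʳ (toℕ k)) (OnTransversal-frobenius (toℕ k) 0 Tv))
      zeros = direct₀ (T 0F) (T 1F) (T 2F) (λ j → trans
        (solve 3 (λ x y z → (x :+ y :+ z) := (x :+ (y :+ (z :+ con ℤ.0ℤ)))) refl _ _ _) (eq j))
      nonzero : ∀ k → (∀ j → a k * conjugate k j ≈ 0#) → a k ≈ 0#
      nonzero k = scale≈0⇒≈0 (nonZero (X ^q^ toℕ k))

    -- As g misses Σ∞, the point X is not in PG(6,q): it has a coordinate generating 𝔽 3.
    generator : ∃[ j ] ¬ 𝔽 1 (v j)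
    generator = Finₚ.¬∀⟶∃¬ 7 (λ j → 𝔽 1 (v j)) (λ j → σ 1 (v j) ≟ v j) λ v-over-1 →
      disjoint X (proj₂ X∈g) ((v , v-over-1 , ∼-refl) , g⊂Σ∞ X (proj₂ X∈g))

    τ : Carrier
    τ = v (proj₁ generator)

    στ≉τ : ¬ σ 1 τ ≈ τ
    στ≉τ = proj₂ generator

    nodes : Vector Carrier 3
    nodes k = σ (toℕ k) τ

    nodes-distinct : ∀ i j → i ≢ j → ¬ nodes i ≈ nodes j
    nodes-distinct 0F 0F i≢j _ = i≢j ≡.refl
    nodes-distinct 1F 1F i≢j _ = i≢j ≡.refl
    nodes-distinct 2F 2F i≢j _ = i≢j ≡.refl
    nodes-distinct 0F 1F _ eq = στ≉τ (trans (sym eq) (σ-zero τ))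
    nodes-distinct 1F 0F _ eq = στ≉τ (trans eq (σ-zero τ))
    nodes-distinct 1F 2F _ eq = στ≉τ (σ-injective 1 (trans (σ-∘ 1 1 τ) (sym eq)))
    nodes-distinct 2F 1F _ eq = στ≉τ (σ-injective 1 (trans (σ-∘ 1 1 τ) eq))
    -- If both the second and the third power of Frobenius fix `τ`, then so does the first.
    nodes-distinct 0F 2F _ eq = στ≉τ (trans (σ-cong 1 (trans (sym (σ-zero τ)) eq)) (trans (σ-∘ 1 2 τ) (v-over _)))
    nodes-distinct 2F 0F _ eq = στ≉τ (trans (σ-cong 1 (trans (sym (σ-zero τ)) (sym eq))) (trans (σ-∘ 1 2 τ) (v-over _)))

    vandermonde : Fin 3 → Fin 3 → Carrier
    vandermonde i k = nodes k ^ toℕ i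

    -- A relation is a polynomial of degree at most 2 with three distinct roots, so it vanishes as a
    -- function and then in its coefficients.
    vandermonde-independent : ∀ x → (∀ k → sum (λ i → x i * vandermonde i k) ≈ 0#) → ∀ i → x i ≈ 0#
    vandermonde-independent x eq = zero⇒coefficients≈0 (ℕₚ.≤-trans (ℕ.s≤s (ℕ.s≤s (ℕ.s≤s ℕ.z≤n))) (8≤q⇒8≤q^6 8≤q)) x (roots⇒zero (Poly-eval x) nodes nodes-distinct eq)

    -- The traces of τ^i X, a basis over 𝔽 1 of the spread plane through X.
    traces : Vector V 3
    traces i = combination (vandermonde i) conjugate

    -- As `τ` and `v` are over `𝔽 3`, `σ 1` permutes the three summands of a trace cyclically.
    traces-over : ∀ i → Over 1 (traces i)
    traces-over i j = begin
      σ 1 (combination (vandermonde i) conjugate j)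
        ≈⟨ frobenius-combination 1 (vandermonde i) conjugate j ⟩
      combination (λ k → σ 1 (vandermonde i k)) (λ k → frobenius 1 (conjugate k)) j
        ≈⟨ +-cong (shift 0 1 refl refl) (+-cong (shift 1 2 refl refl) (+-congʳ (shift 2 0
             (trans (v-over _) (sym (σ-zero τ))) (trans (v-over j) (sym (σ-zero (v j))))))) ⟩
      term 1 + (term 2 + (term 0 + 0#))
        ≈⟨ solve 3 (λ x y z → (y :+ (z :+ (x :+ con ℤ.0ℤ))) := (x :+ (y :+ (z :+ con ℤ.0ℤ)))) refl (term 0) (term 1) (term 2) ⟩
      combination (vandermonde i) conjugate j ∎
      where
      term : ℕ → Carrier
      term k = σ k τ ^ toℕ i * σ k (v j)
      shift : ∀ k k′ → σ (suc k) τ ≈ σ k′ τ → σ (suc k) (v j) ≈ σ k′ (v j) →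
              σ 1 (σ k τ ^ toℕ i) * σ 1 (σ k (v j)) ≈ term k′
      shift k k′ eq eq′ = *-cong
        (trans (σ-^ 1 (σ k τ) (toℕ i)) (^-congˡ (toℕ i) (trans (σ-∘ 1 k τ) eq)))
        (trans (σ-∘ 1 k (v j)) eq′)

    traces-combination : ∀ x → combination x traces ≋ combination (λ k → sum (λ i → x i * vandermonde i k)) conjugate
    traces-combination x = combination-combination x vandermonde conjugate

    plane : Subspace 1 2
    plane = record
      { basis       = traces
      ; over        = traces-over
      ; independent = λ x eq → vandermonde-independent x
          (conjugate-independent (λ k → sum (λ i → x i * vandermonde i k)) (λ j → trans (sym (traces-combination x j)) (eq j)))
      }

    -- The Vandermonde matrix is invertible, so over K the traces span all of the span of the
    -- conjugates.
    conjugate-span⇒plane : ∀ {P} → P ∈⟨ conjugate ⟩ → P ∈⟨ traces ⟩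
    conjugate-span⇒plane (t , P≋) =
      let y , t≈ = independent⇒spanning vandermonde vandermonde-independent t in
      y , λ j → trans (P≋ j) (trans (combination-cong {v = conjugate} {w = conjugate} t≈ (λ k j → refl) j) (sym (traces-combination y j)))

    plane-element : SpreadElement S plane
    plane-element = X , X∈g , λ P → mk⇔
      (λ { (P∈PG , (x , P≋)) →
             let P∈conj = (λ k → sum (λ i → x i * vandermonde i k)) , λ j → trans (P≋ j) (traces-combination x j)
             in P∈conj , P∈PG , trans (form-cong Σ∞ (proj₂ P∈conj)) (trans (form-combination Σ∞ (proj₁ P∈conj) conjugate)
                  (sum≈0 {3} (λ k → proj₁ P∈conj k * form (conjugate k)) (λ k → trans (*-congˡ (conjugate-form k)) (zeroʳ _)))) })
      (λ { (P∈conj , P∈PG , _) → P∈PG , conjugate-span⇒plane {P} P∈conj })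

    inExtendedPlane : ∀ {P} → P ∈⟨ conjugate ⟩ → InExtendedPlane S P
    inExtendedPlane {P} P∈conj = plane , plane-element , conjugate-span⇒plane {P} P∈conj

  -- Let `σ 3` multiply R = x + y by a. The vectors `σ 3` x - a x and `σ 3` y - a y lie on the
  -- transversals of x and y and add up to 0, so `direct` makes both vanish, and x and y are points
  -- over GF(q^3).
  fixedSplitting : ∀ {R} → frobenius 3 (coordinates R) ∼ coordinates R → ¬ OnExtendedTransversal S R → ¬ InExtendedPlane S R →
    Splits 0 (coordinates R) →
    ∃[ X ] ∃[ Y ] (OnG S X × OnG S Y × X ≉ₚ Y × R ∈⟨ line X (Y ^q^ 1) ⟩ × R ≉ₚ X × R ≉ₚ Y ^q^ 1)
  fixedSplitting {R} (a , a#0 , fixed) R∉T R∉plane (x , y , Tx , Ty , R≋) =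
    X , Y , X∈g , Y∈g , X≉Y , R∈XY , (λ R∼x → on-transversal 0 Tx R∼x) , (λ R∼Y → on-transversal 1 Ty (∼-trans R∼Y Y^q∼y))
    where
    on-transversal : ∀ n {v} → OnTransversal n v → ¬ (coordinates R ∼ v)
    on-transversal n T R∼v = R∉T (OnSomeTransversal⇒ {R} (n , OnTransversal-∼ n R∼v T))
    x-nonZero : NonZero x
    x-nonZero = ≉0⇒NonZero λ x≈0 → on-transversal 1 Ty (≋⇒∼ λ j → trans (R≋ j) (trans (+-congʳ (x≈0 j)) (+-identityˡ _)))
    y-nonZero : NonZero y
    y-nonZero = ≉0⇒NonZero λ y≈0 → on-transversal 0 Tx (≋⇒∼ λ j → trans (R≋ j) (trans (+-congˡ (y≈0 j)) (+-identityʳ _)))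
    -- As y is on g^q, its conjugate y^(q^2) is on g^(q^3) = g. Taking this as Y makes Y^q = y^(q^3)
    -- a multiple of y.
    X Y : Point
    X = point x x-nonZero
    Y = point y y-nonZero ^q^ 2
    eigen : ∀ n {v} → OnTransversal n v → OnTransversal n (λ j → σ 3 (v j) - a * v j)
    eigen n T = OnTransversal-- n (OnTransversal-3+ n (OnTransversal-frobenius 3 n T)) (OnTransversal-scale n a T)
    differences : (∀ j → σ 3 (x j) - a * x j ≈ 0#) × (∀ j → σ 3 (y j) - a * y j ≈ 0#)
    differences = direct 0 (eigen 0 Tx) (eigen 1 Ty) λ j → begin
      (σ 3 (x j) - a * x j) + (σ 3 (y j) - a * y j)
        ≈⟨ solve 5 (λ s t a x y → ((s :- a :* x) :+ (t :- a :* y)) := ((s :+ t) :- a :* (x :+ y))) refl (σ 3 (x j)) (σ 3 (y j)) a (x j) (y j) ⟩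
      (σ 3 (x j) + σ 3 (y j)) - a * (x j + y j)
        ≈⟨ +-cong (trans (sym (σ-+ 3 (x j) (y j))) (σ-cong 3 (sym (R≋ j)))) (-‿cong (*-congˡ (sym (R≋ j)))) ⟩
      σ 3 (coordinates R j) - a * coordinates R j
        ≈⟨ +-congʳ (fixed j) ⟩
      a * coordinates R j - a * coordinates R j
        ≈⟨ -‿inverseʳ _ ⟩
      0# ∎
    σx≈ax : ∀ j → σ 3 (x j) ≈ a * x j
    σx≈ax j = x-y≈0⇒x≈y (proj₁ differences j)
    σy≈ay : ∀ j → σ 3 (y j) ≈ a * y j
    σy≈ay j = x-y≈0⇒x≈y (proj₂ differences j)
    X∈g : OnG S X
    X∈g = fixed⇒over 3 x-nonZero σx≈ax , OnTransversal-zero⇒ {X} Tx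
    Y∈g : OnG S Y
    Y∈g = fixed⇒over 3 (nonZero Y) (λ j → trans (σ-comm 3 2 (y j)) (trans (σ-cong 2 (σy≈ay j)) (σ-* 2 a (y j)))) ,
          OnTransversal-zero⇒ {Y} (OnTransversal-3+ 0 (OnTransversal-frobenius 2 1 Ty))
    Y^q≋ay : ∀ j → frobenius 1 (coordinates Y) j ≈ a * y j
    Y^q≋ay j = trans (σ-∘ 1 2 (y j)) (σy≈ay j)
    Y^q∼y : frobenius 1 (coordinates Y) ∼ y
    Y^q∼y = scalar (#⇒≉ a#0) Y^q≋ay
    R∈XY : R ∈⟨ line X (Y ^q^ 1) ⟩
    R∈XY = let b , _ , y≋ = ∼-sym Y^q∼y in (λ { 0F → 1# ; 1F → b }) , λ j → trans (R≋ j) (trans (+-congˡ (y≋ j))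
      (solve 3 (λ x b z → (x :+ b :* z) := (con ℤ.1ℤ :* x :+ (b :* z :+ con ℤ.0ℤ))) refl (x j) b (frobenius 1 (coordinates Y) j)))
    -- Otherwise R is on the line joining X and X^q, in an extended plane of S.
    X≉Y : X ≉ₚ Y
    X≉Y X∼Y = let v , v-over , x∼v = proj₁ X∈g in
      coincident v v-over x∼v (∼-trans (∼-sym Y^q∼y) (∼-trans (frobenius-∼ 1 (∼-sym X∼Y)) (frobenius-∼ 1 x∼v)))
      where
      coincident : ∀ v → Over 3 v → x ∼ v → ¬ (y ∼ frobenius 1 v)
      coincident v v-over x∼v@(b , _ , x≋) (d , _ , y≋) = R∉plane (SpreadPlane.inExtendedPlane v v-over
        (≉0⇒NonZero λ v≈0 → NonZero⇒≉0 x-nonZero (λ j → trans (x≋ j) (trans (*-congˡ (v≈0 j)) (zeroʳ b))))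
        (OnTransversal-∼ 0 (∼-sym x∼v) Tx) {R}
        ((λ { 0F → b ; 1F → d ; 2F → 0# }) , λ j → trans (R≋ j) (trans (+-cong (trans (x≋ j) (*-congˡ (sym (σ-zero (v j))))) (y≋ j))
          (solve 5 (λ b x d y z → (b :* x :+ d :* y) := (b :* x :+ (d :* y :+ (con ℤ.0ℤ :* z :+ con ℤ.0ℤ)))) refl b (σ 0 (v j)) d (σ 1 (v j)) (σ 2 (v j))))))

-- Orbits of a cyclic action and stable multisets

module Orbits {a ℓ} (S : Setoid a ℓ) (_≟_ : Decidable (Setoid._≈_ S))
              (act : ℕ → Setoid.Carrier S → Setoid.Carrier S)
              (act-cong : ∀ k {u v} → Setoid._≈_ S u v → Setoid._≈_ S (act k u) (act k v))
              (act-zero : ∀ u → Setoid._≈_ S (act 0 u) u)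
              (act-+ : ∀ j k u → Setoid._≈_ S (act j (act k u)) (act (j ℕ.+ k) u))
              (o : ℕ) (act-order : ∀ u → Setoid._≈_ S (act (suc o) u) u) where

  open Setoid S
  open import Data.Nat.Base using (_<_; _≤_)
  open Membership S using (_∈_)
  open Permutation S using (_↭_; prep; ↭-refl; ↭-sym; ↭-trans; ↭-prep; ↭-reflexive; ↭-reflexive-≋)
  open Permutationₚ S using (∈-resp-↭; ++⁺ʳ; dropMiddle; ∷↭∷ʳ; map⁺)
  open Extraction S using (∈⇒↭)

  act-≡ : ∀ {j k} u → j ≡ k → act j u ≈ act k u
  act-≡ u ≡.refl = refl

  act-comm : ∀ j k u → act j (act k u) ≈ act k (act j u)
  act-comm j k u = trans (act-+ j k u) (trans (act-≡ u (ℕₚ.+-comm j k)) (sym (act-+ k j u)))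

  act-* : ∀ m {n u} → act n u ≈ u → act (m ℕ.* n) u ≈ u
  act-* zero    {n} {u} _ = act-zero u
  act-* (suc m) {n} {u} p = trans (sym (act-+ n (m ℕ.* n) u)) (trans (act-cong n (act-* m p)) p)

  -- The exponents `k * o` and `k` add up to a multiple of the order `suc o`, which gives inverses
  -- while exponents stay natural numbers.
  inverse-act : ∀ k u → act (k ℕ.* o) (act k u) ≈ u
  inverse-act k u = trans (act-+ (k ℕ.* o) k u) (trans (act-≡ u
    (≡.trans (ℕₚ.+-comm (k ℕ.* o) k) (≡.sym (ℕₚ.*-suc k o)))) (act-* k (act-order u)))

  act-injective : ∀ k {u v} → act k u ≈ act k v → u ≈ v
  act-injective k {u} {v} eq = trans (sym (inverse-act k u)) (trans (act-cong (k ℕ.* o) eq) (inverse-act k v))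

  record Period (n : ℕ) (u : Carrier) : Set ℓ where
    constructor period
    field
      positive : 0 < n
      returns  : act n u ≈ u
      minimal  : ∀ i → 0 < i → i < n → ¬ act i u ≈ u
  open Period public

  Period-cong : ∀ {n u v} → u ≈ v → Period n u → Period n v
  Period-cong {n} u≈v (period 0<n ret min) = period 0<n
    (trans (act-cong n (sym u≈v)) (trans ret u≈v))
    (λ i 0<i i<n eq → min i 0<i i<n (trans (act-cong i u≈v) (trans eq (sym u≈v))))

  Period-act : ∀ k {n u} → Period n u → Period n (act k u)
  Period-act k {n} {u} (period 0<n ret min) = period 0<n
    (trans (act-comm n k u) (act-cong k ret))
    (λ i 0<i i<n eq → min i 0<i i<n (act-injective k (trans (act-comm k i u) eq)))

  Period-unique : ∀ {m n u} → Period m u → Period n u → m ≡ n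
  Period-unique {m} {n} p p′ with ℕₚ.<-cmp m n
  ... | tri< m<n _ _ = contradiction (returns p) (minimal p′ m (positive p) m<n)
  ... | tri≈ _ m≡n _ = m≡n
  ... | tri> _ _ n<m = contradiction (returns p′) (minimal p n (positive p′) n<m)

  -- A search up to `suc o` succeeds, since a return is known to happen there.
  period-exists : ∀ u → ∃[ n ] Period n u
  period-exists u with least (suc o)
    where
    least : ∀ m → (∃[ n ] Period n u) ⊎ (∀ i → 0 < i → i ≤ m → ¬ act i u ≈ u)
    least zero    = inj₂ (λ i 0<i i≤0 _ → ℕₚ.<⇒≱ 0<i i≤0)
    least (suc m) with least m
    ... | inj₁ found = inj₁ found
    ... | inj₂ none with act (suc m) u ≟ u
    ...   | yes ret = inj₁ (suc m , period (ℕ.s≤s ℕ.z≤n) ret (λ { i 0<i (ℕ.s≤s i≤m) → none i 0<i i≤m }))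
    ...   | no ¬ret = inj₂ (λ i 0<i i≤1+m → below i 0<i (ℕₚ.m≤n⇒m<n∨m≡n i≤1+m))
      where
      below : ∀ i → 0 < i → i < suc m ⊎ i ≡ suc m → ¬ act i u ≈ u
      below i 0<i (inj₁ (ℕ.s≤s i≤m)) = none i 0<i i≤m
      below i 0<i (inj₂ ≡.refl)      = ¬ret
  ... | inj₁ found = found
  ... | inj₂ none  = contradiction (act-order u) (none (suc o) (ℕ.s≤s ℕ.z≤n) ℕₚ.≤-refl)

  distinct : ∀ {n u} → Period n u → ∀ {i j} → i < j → j < n → ¬ act i u ≈ act j u
  distinct {n} {u} p {i} {j} i<j j<n eq = minimal p (j ℕ.∸ i) (ℕₚ.m<n⇒0<n∸m i<j) (ℕₚ.≤-<-trans (ℕₚ.m∸n≤m j i) j<n)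
    (act-injective i (trans (act-+ i (j ℕ.∸ i) u) (trans (act-≡ u (ℕₚ.m+[n∸m]≡n (ℕₚ.<⇒≤ i<j))) (sym eq))))

  act-% : ∀ {n u} → Period n u → .{{_ : ℕ.NonZero n}} → ∀ i → act i u ≈ act (i % n) u
  act-% {n} {u} p i = trans (act-≡ u (m≡m%n+[m/n]*n i n)) (trans (sym (act-+ (i % n) ((i / n) ℕ.* n) u))
    (act-cong (i % n) (act-* (i / n) (returns p))))

  AllPairs-lookup : ∀ {b r} {B : Set b} {R : B → B → Set r} → (∀ {x y} → R x y → R y x) →
                    ∀ {xs} → AllPairs R xs → ∀ {i j} → i ≢ j → R (lookup xs i) (lookup xs j)
  AllPairs-lookup R-sym (_ ∷ _)   {zero}  {zero}  i≢j = contradiction ≡.refl i≢j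
  AllPairs-lookup R-sym (px ∷ _)  {zero}  {suc j} i≢j = All.lookup px (∈-lookup j)
  AllPairs-lookup R-sym (px ∷ _)  {suc i} {zero}  i≢j = R-sym (All.lookup px (∈-lookup i))
  AllPairs-lookup R-sym (_ ∷ pxs) {suc i} {suc j} i≢j = AllPairs-lookup R-sym pxs (i≢j ∘ ≡.cong suc)

  -- x ~ u says that the element u of S represents x.
  orbitSize⇒Period : ∀ {b r} {B : Set b} (_~_ : B → Carrier → Set r) u (xs : List B) →
    (∀ {x v w} → x ~ v → x ~ w → v ≈ w) →
    AllPairs (λ x y → ∀ {v w} → x ~ v → y ~ w → ¬ v ≈ w) xs →
    (∀ i → Any (_~ act i u) xs) → All (λ x → ∃[ i ] x ~ act i u) xs → Period (length xs) u
  orbitSize⇒Period _~_ u xs functional unequal covers inOrbit with period-exists u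
  ... | n , p = ≡.subst (λ m → Period m u) (ℕₚ.≤-antisym n≤ ≤n) p
    where
    instance _ = ℕ.>-nonZero (positive p)
    -- Exponents below the period give different elements, hence different positions in the list.
    n≤ : n ≤ length xs
    n≤ = Finₚ.injective⇒≤ {f = position} injective
      where
      position : Fin n → Fin (length xs)
      position i = Any.index (covers (toℕ i))
      same : ∀ i j → position i ≡ position j → act (toℕ i) u ≈ act (toℕ j) u
      same i j eq = functional (Anyₚ.lookup-index (covers (toℕ i)))
        (≡.subst (λ k → lookup xs k ~ act (toℕ j) u) (≡.sym eq) (Anyₚ.lookup-index (covers (toℕ j))))
      injective : ∀ {i j} → position i ≡ position j → i ≡ j
      injective {i} {j} eq with ℕₚ.<-cmp (toℕ i) (toℕ j)
      ... | tri< i<j _ _ = contradiction (same i j eq) (distinct p i<j (Finₚ.toℕ<n j))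
      ... | tri≈ _ i≡j _ = Finₚ.toℕ-injective i≡j
      ... | tri> _ _ j<i = contradiction (sym (same i j eq)) (distinct p j<i (Finₚ.toℕ<n i))
    -- The listed elements are pairwise different, hence so are their exponents modulo the period.
    ≤n : length xs ≤ n
    ≤n = Finₚ.injective⇒≤ {f = residue} injective
      where
      exponent : ∀ k → ∃[ i ] lookup xs k ~ act i u
      exponent k = All.lookup inOrbit (∈-lookup k)
      residue : Fin (length xs) → Fin n
      residue k = fromℕ< (m%n<n (proj₁ (exponent k)) n)
      same : ∀ k l → residue k ≡ residue l → act (proj₁ (exponent k)) u ≈ act (proj₁ (exponent l)) u
      same k l eq = trans (act-% p _) (trans (act-≡ u
        (≡.trans (≡.sym (Finₚ.toℕ-fromℕ< _)) (≡.trans (≡.cong toℕ eq) (Finₚ.toℕ-fromℕ< _)))) (sym (act-% p _)))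
      injective : ∀ {k l} → residue k ≡ residue l → k ≡ l
      injective {k} {l} eq with k Finₚ.≟ l
      ... | yes k≡l = k≡l
      ... | no k≢l  = contradiction (same k l eq)
              (AllPairs-lookup {R = λ x y → ∀ {v w} → x ~ v → y ~ w → ¬ v ≈ w}
                (λ r x~v y~w v≈w → r y~w x~v (sym v≈w)) unequal k≢l (proj₂ (exponent k)) (proj₂ (exponent l)))

  orbit : ℕ → Carrier → List Carrier
  orbit n u = applyUpTo (λ i → act i u) n

  ∈-orbit⁻ : ∀ n {u v} → v ∈ orbit n u → ∃[ i ] v ≈ act i u
  ∈-orbit⁻ n {u} v∈ = let i , _ , eq = Anyₚ.applyUpTo⁻ (λ i → act i u) v∈ in i , eq

  orbit-fixed : ∀ k n {u v} → act k u ≈ u → v ∈ orbit n u → act k v ≈ v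
  orbit-fixed k n {u} ret v∈ = let i , v≈ = ∈-orbit⁻ n v∈ in
    trans (act-cong k v≈) (trans (act-comm k i u) (trans (act-cong i ret) (sym v≈)))

  -- Members are extracted one at a time; because the others differ from the one removed, they are
  -- still present whatever the multiplicities in `us`.
  sublist⇒↭ : ∀ {xs us} → AllPairs (λ x y → ¬ x ≈ y) xs → All (_∈ us) xs → ∃[ vs ] (us ↭ xs ++ vs)
  sublist⇒↭ {us = us} [] [] = us , ↭-refl
  sublist⇒↭ {x ∷ xs} {us} (x≉ ∷ xs≉) (x∈us ∷ xs∈us) =
    let us′ , us↭ = ∈⇒↭ x∈us
        vs , us′↭ = sublist⇒↭ xs≉ (All.zipWith (λ (x≉y , y∈us) → other us↭ x≉y y∈us) (x≉ , xs∈us))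
    in vs , ↭-trans us↭ (↭-prep x us′↭)
    where
    other : ∀ {us′ y} → us ↭ x ∷ us′ → ¬ x ≈ y → y ∈ us → y ∈ us′
    other us↭ x≉y y∈us with ∈-resp-↭ us↭ y∈us
    ... | here y≈x  = contradiction (sym y≈x) x≉y
    ... | there y∈  = y∈

  Stable : List Carrier → Set _
  Stable us = us ↭ map (act 1) us

  Stable⇒act∈ : ∀ {us} → Stable us → ∀ {u} → u ∈ us → ∀ i → act i u ∈ us
  Stable⇒act∈ {us} stable {u} u∈us zero    = ∈-resp-≈ S (sym (act-zero u)) u∈us
  Stable⇒act∈ {us} stable {u} u∈us (suc i) = ∈-resp-≈ S (act-+ 1 i u)
    (∈-resp-↭ (↭-sym stable) (∈-map⁺ S S (act-cong 1) (Stable⇒act∈ stable u∈us i)))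

  -- Every entry moves one place along, and the last one has returned to u and is moved to the
  -- front.
  map-orbit : ∀ {n u} → Period n u → map (act 1) (orbit n u) ↭ orbit n u
  map-orbit {zero}  p = ↭-refl
  map-orbit {suc n} {u} p = ↭-trans (↭-reflexive (Listₚ.map-applyUpTo (λ i → act i u) (act 1) (suc n)))
    (↭-trans (↭-reflexive-≋ (pointwise (suc n) (λ i → act-+ 1 i u)))
    (↭-trans (↭-reflexive (≡.sym (Listₚ.applyUpTo-∷ʳ (λ i → act (suc i) u) n)))
    (↭-trans (↭-sym (∷↭∷ʳ (act (suc n) u) (applyUpTo (λ i → act (suc i) u) n)))
      (prep (trans (returns p) (sym (act-zero u))) ↭-refl))))
    where
    pointwise : ∀ {f g : ℕ → Carrier} n → (∀ i → f i ≈ g i) → Pointwise _≈_ (applyUpTo f n) (applyUpTo g n)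
    pointwise zero    f≈g = []
    pointwise (suc n) f≈g = f≈g 0 ∷ pointwise n (f≈g ∘ suc)

  -- Only one copy of the orbit is split off, so repeated points are allowed. The orbit is stable
  -- itself and cancels from the relation for `us`, which leaves the rest stable.
  remove-orbit : ∀ {us} → Stable us → ∀ {n u} → u ∈ us → Period n u → ∃[ vs ] (us ↭ orbit n u ++ vs × Stable vs)
  remove-orbit {us} stable {n} {u} u∈us p =
    let vs , us↭ = sublist⇒↭ (AllPairsₚ.applyUpTo⁺₁ (λ i → act i u) n (distinct p))
                             (Allₚ.applyUpTo⁺₂ (λ i → act i u) n (Stable⇒act∈ stable u∈us))
    in vs , us↭ , dropMiddle {vs = orbit n u} [] [] (↭-trans (↭-sym us↭) (↭-trans stable
         (↭-trans (map⁺ S (act-cong 1) us↭) (↭-trans (↭-reflexive (Listₚ.map-++ (act 1) (orbit n u) vs))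
           (++⁺ʳ (map (act 1) vs) (map-orbit p))))))

-- Orbits and weights of the intersection points

module Classification {c ℓ₁ ℓ₂} (K : HeytingField c ℓ₁ ℓ₂) (q : ℕ) (primePower : IsPrimePower q)
                      (card : HasCardinality K (q ℕ.^ 6)) (8≤q : 8 ℕ.≤ q)
                      (Σ∞ : Geometry.Hyperplane K q) (S : Geometry.RegularSpread K q Σ∞)
                      (r′ : ℕ) (r≤6 : suc r′ ℕ.≤ 6) (𝒩 : Geometry.NormalRationalCurve K q (suc r′)) where

  open HeytingField K using (refl; sym; trans)
  open Geometry K q
  open Frobenius K q primePower card
  open Factorisation K (q ℕ.^ 6) card q
  open Coordinates K q primePower card
  open Transversals K q primePower card Σ∞ S
  open WeightTwo K q primePower card 8≤q Σ∞ S
  open Curve K q primePower card 8≤q Σ∞ r′ r≤6 𝒩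
  open NormalRationalCurve 𝒩

  σᵐ-zero : ∀ u → σᵐ 0 u ≈ᵐ u
  σᵐ-zero (just x) = just (σ-zero x)
  σᵐ-zero nothing  = nothing

  σᵐ-6 : ∀ u → σᵐ 6 u ≈ᵐ u
  σᵐ-6 (just x) = just (σ-6 x)
  σᵐ-6 nothing  = nothing

  open Orbits parameters _≟ᵐ_ σᵐ σᵐ-cong σᵐ-zero σᵐ-∘ 5 σᵐ-6 public
  open Permutationₚ parameters using (++-comm; ++⁺ˡ; drop-∷)
  open Permutation parameters using (↭-reflexive)

  infix 4 _~_
  _~_ : Point → Maybe Carrier → Set _
  P ~ u = coordinates P ∼ at u

  ~-functional : ∀ {P u v} → P ~ u → P ~ v → u ≈ᵐ v
  ~-functional {P} {u} {v} P~u P~v = at-injective u v (∼-trans (∼-sym P~u) P~v)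

  ~-≈ : ∀ {P u v} → u ≈ᵐ v → P ~ u → P ~ v
  ~-≈ u≈v P~u = ∼-trans P~u (≋⇒∼ (at-cong u≈v))

  frobenius~ : ∀ k {v u} → v ∼ at u → frobenius k v ∼ at (σᵐ k u)
  frobenius~ k {u = u} v∼u = ∼-trans (frobenius-∼ k v∼u) (≋⇒∼ (frobenius-at k u))

  WeightOne : Maybe Carrier → Set _
  WeightOne u = OnSomeTransversal (at u)

  WeightOne-≈ : ∀ {u v} → u ≈ᵐ v → WeightOne u → WeightOne v
  WeightOne-≈ u≈v = OnSomeTransversal-∼ (≋⇒∼ (at-cong (≈ᵐ-sym u≈v)))

  WeightOne-σ : ∀ k {u} → WeightOne u → WeightOne (σᵐ k u)
  WeightOne-σ k {u} T = OnSomeTransversal-∼ (∼-sym (≋⇒∼ (frobenius-at k u))) (OnSomeTransversal-frobenius k T)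

  WeightOne-σ⁻¹ : ∀ k {u} → WeightOne (σᵐ k u) → WeightOne u
  WeightOne-σ⁻¹ k {u} T = WeightOne-≈ (inverse-act k u) (WeightOne-σ (k ℕ.* 5) {σᵐ k u} T)

  WeightOne⇒ : ∀ {P u} → P ~ u → WeightOne u → OnExtendedTransversal S P
  WeightOne⇒ {P} P~u T = OnSomeTransversal⇒ {P} (OnSomeTransversal-∼ P~u T)

  ⇒WeightOne : ∀ {P u} → P ~ u → OnExtendedTransversal S P → WeightOne u
  ⇒WeightOne {P} P~u T = OnSomeTransversal-∼ (∼-sym P~u) (⇒OnSomeTransversal {P} T)

  OffPlanes : Maybe Carrier → Set _
  OffPlanes u = ∀ {R} → R ~ u → ¬ InExtendedPlane S R

  -- The inverse collineation, a power of Frobenius too, would carry a point R in an extended plane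
  -- to a point of that plane represented by u.
  OffPlanes-σ : ∀ k {u} → OffPlanes u → OffPlanes (σᵐ k u)
  OffPlanes-σ k {u} off {R} R~σu R∈π = off {R ^q^ (k ℕ.* 5)} R′~u
    (InExtendedPlane-frobenius (k ℕ.* 5) {R} {R ^q^ (k ℕ.* 5)} ∼-refl R∈π)
    where
    R′~u : R ^q^ (k ℕ.* 5) ~ u
    R′~u = ~-≈ {R ^q^ (k ℕ.* 5)} (inverse-act k u) (frobenius~ (k ℕ.* 5) {u = σᵐ k u} R~σu)

  -- kind with indices w and o is for points of weight w and orbit size o; these are
  -- the solutions of w * o ≡ 3 * s with s equal to 1 or 2.
  data Kind (u : Maybe Carrier) : ℕ → Set (c ⊔ ℓ₁ ⊔ ℓ₂) where
    kind₁₃ : Period 3 u → WeightOne u → Kind u 1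
    kind₁₆ : Period 6 u → WeightOne u → Kind u 1
    kind₂₃ : Period 3 u → ¬ WeightOne u → (∃[ n ] Splits n (at u)) → OffPlanes u → Kind u 2
    kind₃₁ : Period 1 u → ¬ WeightOne u → Kind u 3
    kind₃₂ : Period 2 u → ¬ WeightOne u → Kind u 3

  Kind-≈ : ∀ {u v w} → u ≈ᵐ v → Kind u w → Kind v w
  Kind-≈ u≈v (kind₁₃ p T) = kind₁₃ (Period-cong u≈v p) (WeightOne-≈ u≈v T)
  Kind-≈ u≈v (kind₁₆ p T) = kind₁₆ (Period-cong u≈v p) (WeightOne-≈ u≈v T)
  Kind-≈ u≈v (kind₂₃ p ¬T (n , split) off) = kind₂₃ (Period-cong u≈v p) (¬T ∘ WeightOne-≈ (≈ᵐ-sym u≈v))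
    (n , Splits-∼ n (≋⇒∼ (at-cong (≈ᵐ-sym u≈v))) split) (λ {R} R~v → off {R} (~-≈ {R} (≈ᵐ-sym u≈v) R~v))
  Kind-≈ u≈v (kind₃₁ p ¬T) = kind₃₁ (Period-cong u≈v p) (¬T ∘ WeightOne-≈ (≈ᵐ-sym u≈v))
  Kind-≈ u≈v (kind₃₂ p ¬T) = kind₃₂ (Period-cong u≈v p) (¬T ∘ WeightOne-≈ (≈ᵐ-sym u≈v))

  Weight-unique : ∀ {P w w′} → Weight S P w → Weight S P w′ → w ≡ w′
  Weight-unique (w≡1 _)    (w≡1 _)    = ≡.refl
  Weight-unique (w≡1 T)    (w≡2 ¬T _) = contradiction T ¬T
  Weight-unique (w≡1 T)    (w≡3 ¬T _) = contradiction T ¬T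
  Weight-unique (w≡2 ¬T _) (w≡1 T)    = contradiction T ¬T
  Weight-unique (w≡2 _ _)  (w≡2 _ _)  = ≡.refl
  Weight-unique (w≡2 _ L)  (w≡3 _ ¬L) = contradiction L ¬L
  Weight-unique (w≡3 ¬T _) (w≡1 T)    = contradiction T ¬T
  Weight-unique (w≡3 _ ¬L) (w≡2 _ L)  = contradiction L ¬L
  Weight-unique (w≡3 _ _)  (w≡3 _ _)  = ≡.refl

  orbitSize : ∀ {P u n} → P ~ u → OrbitSize S P n → Period n u
  orbitSize {P} {u} P~u (xs , unequal , covers , inOrbit , ≡.refl) =
    orbitSize⇒Period _~_ u xs (λ {P} → ~-functional {P})
      (AllPairs.map (λ X≉Y {v} {w} X~v Y~w v≈w → X≉Y (∼-trans X~v (∼-trans (≋⇒∼ (at-cong v≈w)) (∼-sym Y~w)))) unequal)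
      (λ i → Any.map (λ Pⁱ≈X → ∼-trans (∼-sym Pⁱ≈X) (frobenius~ i {u = u} P~u)) (covers i))
      (All.map (λ (i , X≈Pⁱ) → i , ∼-trans X≈Pⁱ (frobenius~ i {u = u} P~u)) inOrbit)

  2*o≢3 : ∀ o → 2 ℕ.* o ≢ 3
  2*o≢3 o eq = from-no (2 ∣? 3) (divides o (≡.trans (≡.sym eq) (ℕₚ.*-comm 2 o)))

  -- In each case 3s is read as w times the orbit size and w is cancelled. The pair w = 2, s = 1
  -- would make 3 even, so weight 2 always comes with s = 2, recorded as `OffPlanes`.
  good⇒Kind : ∀ {P u w} → P ~ u → Weight S P w → Good S P → Kind u w
  good⇒Kind {P} {u} P~u W (w , o , s , W′ , O , I , eq) with ≡.refl ← Weight-unique W W′ = kind W I eq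
    where
    withPeriod : ∀ {n} → o ≡ n → Period n u
    withPeriod ≡.refl = orbitSize {P} P~u O
    halve : ∀ {n} k .{{_ : ℕ.NonZero k}} → k ℕ.* o ≡ k ℕ.* n → o ≡ n
    halve {n} k = ℕₚ.*-cancelˡ-≡ o n k
    kind : ∀ {w s} → Weight S P w → PlaneIndex S P s → w ℕ.* o ≡ 3 ℕ.* s → Kind u w
    kind (w≡1 T) (s≡1 _) eq = kind₁₃ (withPeriod (halve 1 eq)) (⇒WeightOne {P} {u} P~u T)
    kind (w≡1 T) (s≡2 _) eq = kind₁₆ (withPeriod (halve 1 eq)) (⇒WeightOne {P} {u} P~u T)
    kind (w≡2 _ _) (s≡1 _) eq = contradiction eq (2*o≢3 o)
    kind (w≡2 ¬T L) (s≡2 P∉π) eq = kind₂₃ (withPeriod (halve 2 eq)) (¬T ∘ WeightOne⇒ {P} {u} P~u)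
      (let n , split = lineMeetingTwo⇒Splits {P} L in n , Splits-∼ n (∼-sym P~u) split)
      (λ {R} R~u R∈π → P∉π (InExtendedPlane-frobenius 0 {R} {P}
        (∼-trans P~u (∼-trans (∼-sym R~u) (≋⇒∼ (λ j → sym (frobenius-0 (coordinates R) j))))) R∈π))
    kind (w≡3 ¬T _) (s≡1 _) eq = kind₃₁ (withPeriod (halve 3 eq)) (¬T ∘ WeightOne⇒ {P} {u} P~u)
    kind (w≡3 ¬T _) (s≡2 _) eq = kind₃₂ (withPeriod (halve 3 eq)) (¬T ∘ WeightOne⇒ {P} {u} P~u)

  data Total : List (Maybe Carrier) → ℕ → Set (c ⊔ ℓ₁ ⊔ ℓ₂) where
    []  : Total [] 0
    _∷_ : ∀ {u us w n} → Kind u w → Total us n → Total (u ∷ us) (w ℕ.+ n)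

  total : ∀ {Ps us ws} → Pointwise _~_ Ps us → Pointwise (Weight S) Ps ws → All (Good S) Ps → Total us (ListAction.sum ws)
  total [] [] [] = []
  total (_∷_ {x = P} P~u Ps~us) (W ∷ Ws) (G ∷ Gs) = good⇒Kind {P} P~u W G ∷ total Ps~us Ws Gs

  Total-↭ : ∀ {us vs n} → us ↭ vs → Total us n → Total vs n
  Total-↭ (Permutation.refl eqs) t = aux eqs t
    where
    aux : ∀ {us vs n} → Pointwise _≈ᵐ_ us vs → Total us n → Total vs n
    aux [] [] = []
    aux (eq ∷ eqs) (k ∷ t) = Kind-≈ eq k ∷ aux eqs t
  Total-↭ (prep eq p) (k ∷ t) = Kind-≈ eq k ∷ Total-↭ p t
  Total-↭ (swap eq₁ eq₂ p) (_∷_ {w = w₁} k₁ (_∷_ {w = w₂} {n = n} k₂ t)) =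
    ≡.subst (Total _) (x∙yz≈y∙xz w₂ w₁ n) (Kind-≈ eq₂ k₂ ∷ Kind-≈ eq₁ k₁ ∷ Total-↭ p t)
    where
    x∙yz≈y∙xz : ∀ x y z → x ℕ.+ (y ℕ.+ z) ≡ y ℕ.+ (x ℕ.+ z)
    x∙yz≈y∙xz x y z = ≡.trans (≡.sym (ℕₚ.+-assoc x y z)) (≡.trans (≡.cong (ℕ._+ z) (ℕₚ.+-comm x y)) (ℕₚ.+-assoc y x z))
  Total-↭ (Permutation.trans p p′) t = Total-↭ p′ (Total-↭ p t)

  0<weight : ∀ {u w} → Kind u w → 0 ℕ.< w
  0<weight (kind₁₃ _ _)     = ℕ.s≤s ℕ.z≤n
  0<weight (kind₁₆ _ _)     = ℕ.s≤s ℕ.z≤n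
  0<weight (kind₂₃ _ _ _ _) = ℕ.s≤s ℕ.z≤n
  0<weight (kind₃₁ _ _)     = ℕ.s≤s ℕ.z≤n
  0<weight (kind₃₂ _ _)     = ℕ.s≤s ℕ.z≤n

  -- Weights are positive, so the total weight bounds the number of points and excludes orbits that
  -- are too long.
  length≤total : ∀ {us n} → Total us n → length us ℕ.≤ n
  length≤total []      = ℕ.z≤n
  length≤total (k ∷ t) = ℕₚ.+-mono-≤ (0<weight k) (length≤total t)

  total-0 : ∀ {us} → Total us 0 → us ≡ []
  total-0 {us} t with us | length≤total t
  ... | [] | _ = ≡.refl

  -- Every point of an orbit brings its own `Kind` into `Total`. This lemma and the next two recover
  -- its weight from properties that are constant along the orbit.
  weight₁ : ∀ {u w} → Kind u w → WeightOne u → w ≡ 1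
  weight₁ (kind₁₃ _ _)     T = ≡.refl
  weight₁ (kind₁₆ _ _)     T = ≡.refl
  weight₁ (kind₂₃ _ ¬T _ _) T = contradiction T ¬T
  weight₁ (kind₃₁ _ ¬T)    T = contradiction T ¬T
  weight₁ (kind₃₂ _ ¬T)    T = contradiction T ¬T

  weight₂ : ∀ {u w} → Kind u w → Period 3 u → ¬ WeightOne u → w ≡ 2
  weight₂ (kind₁₃ _ T)     _ ¬T = contradiction T ¬T
  weight₂ (kind₁₆ _ T)     _ ¬T = contradiction T ¬T
  weight₂ (kind₂₃ _ _ _ _) _ _  = ≡.refl
  weight₂ (kind₃₁ p _)     p′ _ = contradiction (Period-unique p p′) λ ()
  weight₂ (kind₃₂ p _)     p′ _ = contradiction (Period-unique p p′) λ ()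

  weight₃ : ∀ {u w} → Kind u w → Period 2 u → w ≡ 3
  weight₃ (kind₁₃ p _)     p′ = contradiction (Period-unique p p′) λ ()
  weight₃ (kind₁₆ p _)     p′ = contradiction (Period-unique p p′) λ ()
  weight₃ (kind₂₃ p _ _ _) p′ = contradiction (Period-unique p p′) λ ()
  weight₃ (kind₃₁ p _)     p′ = contradiction (Period-unique p p′) λ ()
  weight₃ (kind₃₂ _ _)     _  = ≡.refl

  OnG₀ : Maybe Carrier → Set _
  OnG₀ u = OnTransversal 0 (at u)

  -- A suitable conjugate of a point on any transversal lies on the extension of g, from which the
  -- cases count their conjugates.
  normalise : ∀ {us n u} → Stable us → u ∈ us → Period n u → WeightOne u → ∃[ v ] (v ∈ us × Period n v × OnG₀ v)
  normalise {u = u} stable u∈us p (n , T) = σᵐ k u , Stable⇒act∈ stable u∈us k , Period-act k p ,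
    OnTransversal-cong 0 (frobenius-at k u) (OnTransversal-rotate n 0 T)
    where k = 2 ℕ.* n

  record WeightOneOrbit (us : List (Maybe Carrier)) (n : ℕ) : Set (c ⊔ ℓ₁ ⊔ ℓ₂) where
    field
      {representative} : Maybe Carrier
      {others}         : List (Maybe Carrier)
      {othersTotal}    : ℕ
      period₃          : Period 3 representative
      onG₀             : OnG₀ representative
      decomposition    : us ↭ orbit 3 representative ++ others
      stable-others    : Stable others
      total-others     : Total others othersTotal
      n≡               : n ≡ 3 ℕ.+ othersTotal

  remove-weight-one : ∀ {us n u} → Stable us → Total us n → u ∈ us → Period 3 u → WeightOne u → WeightOneOrbit us n
  remove-weight-one {us} {n} stable t u∈us p T =
    let v , v∈us , p′ , T₀ = normalise stable u∈us p T
        vs , us↭ , stable′ = remove-orbit stable v∈us p′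
    in split v vs p′ T₀ us↭ stable′ (Total-↭ us↭ t)
    where
    split : ∀ v vs → Period 3 v → OnG₀ v → us ↭ orbit 3 v ++ vs → Stable vs → Total (orbit 3 v ++ vs) n → WeightOneOrbit us n
    split v vs p T₀ us↭ stable (k₀ ∷ k₁ ∷ k₂ ∷ t) = record
      { period₃ = p ; onG₀ = T₀ ; decomposition = us↭ ; stable-others = stable ; total-others = t
      ; n≡ = ≡.cong₂ ℕ._+_ (weight₁ k₀ (WeightOne-σ 0 {v} (0 , T₀))) (≡.cong₂ ℕ._+_ (weight₁ k₁ (WeightOne-σ 1 {v} (0 , T₀)))
               (≡.cong (ℕ._+ _) (weight₁ k₂ (WeightOne-σ 2 {v} (0 , T₀))))) }

  data Remainder (us : List (Maybe Carrier)) : Set (c ⊔ ℓ₁ ⊔ ℓ₂) where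
    weight-one   : ∀ v → Period 3 v → OnG₀ v → us ↭ orbit 3 v → Remainder us
    weight-three : ∀ v → Period 1 v → us ↭ v ∷ [] → Remainder us

  no-others : ∀ {us vs m n} xs → Total vs m → n ≡ n ℕ.+ m → us ↭ xs ++ vs → us ↭ xs
  no-others {m = m} {n} xs t eq us↭ with ≡.refl ← ℕₚ.+-cancelˡ-≡ n m 0 (≡.trans (≡.sym eq) (≡.sym (ℕₚ.+-identityʳ n)))
    with ≡.refl ← total-0 t = ↭-trans us↭ (↭-reflexive (Listₚ.++-identityʳ xs))

  sum₃ : ∀ {x y z a b c m} → x ≡ a → y ≡ b → z ≡ c → x ℕ.+ (y ℕ.+ (z ℕ.+ m)) ≡ a ℕ.+ (b ℕ.+ (c ℕ.+ m))
  sum₃ ≡.refl ≡.refl ≡.refl = ≡.refl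

  weights₂₃ : ∀ {u vs n} → Period 3 u → ¬ WeightOne u → Total (orbit 3 u ++ vs) n → ∃[ m ] (Total vs m × n ≡ 6 ℕ.+ m)
  weights₂₃ {u} p ¬T (k₀ ∷ k₁ ∷ k₂ ∷ t) = _ , t , sum₃
    (weight₂ k₀ (Period-act 0 p) (λ T → ¬T (WeightOne-σ⁻¹ 0 {u} T)))
    (weight₂ k₁ (Period-act 1 p) (λ T → ¬T (WeightOne-σ⁻¹ 1 {u} T)))
    (weight₂ k₂ (Period-act 2 p) (λ T → ¬T (WeightOne-σ⁻¹ 2 {u} T)))

  weights₃₂ : ∀ {u vs n} → Period 2 u → Total (orbit 2 u ++ vs) n → ∃[ m ] (Total vs m × n ≡ 6 ℕ.+ m)
  weights₃₂ p (k₀ ∷ k₁ ∷ t) = _ , t , ≡.cong₂ ℕ._+_ (weight₃ k₀ (Period-act 0 p)) (≡.cong (ℕ._+ _) (weight₃ k₁ (Period-act 1 p)))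

  6+k≢3 : ∀ {k} → ¬ (6 ℕ.+ k ≡ 3)
  6+k≢3 ()

  -- Kinds 16, 23 and 32 have orbits of total weight 6, too much for what is left. The total is a
  -- variable with an equation because the index of `Total` is a sum of unknown weights.
  remainder : ∀ {us n} → Stable us → Total us n → n ≡ 3 → Remainder us
  remainder {u ∷ us} stable t@(kind₁₃ p T ∷ _) n≡3 =
    let open WeightOneOrbit (remove-weight-one stable t (here ≈ᵐ-refl) p T) in
    weight-one representative period₃ onG₀ (no-others (orbit 3 representative) total-others (≡.trans (≡.sym n≡3) n≡) decomposition)
  remainder {u ∷ us} stable t@(kind₁₆ p _ ∷ _) n≡3 =
    let vs , us↭ , _ = remove-orbit stable (here ≈ᵐ-refl) p in ⊥-elim (too-long vs us↭)
    where
    too-long : ∀ vs → ¬ (u ∷ us ↭ orbit 6 u ++ vs)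
    too-long vs us↭ with ≡.subst (6 ℕ.+ length vs ℕ.≤_) n≡3 (length≤total (Total-↭ us↭ t))
    ... | ℕ.s≤s (ℕ.s≤s (ℕ.s≤s ()))
  remainder {u ∷ us} stable t@(kind₂₃ p ¬T _ _ ∷ _) n≡3 =
    let vs , us↭ , _ = remove-orbit stable (here ≈ᵐ-refl) p in ⊥-elim (too-heavy vs us↭)
    where
    too-heavy : ∀ vs → ¬ (u ∷ us ↭ orbit 3 u ++ vs)
    too-heavy vs us↭ = let _ , _ , n≡6+m = weights₂₃ p ¬T (Total-↭ us↭ t) in 6+k≢3 (≡.trans (≡.sym n≡6+m) n≡3)
  remainder {u ∷ us} stable (kind₃₁ p _ ∷ t) n≡3 = weight-three u p (no-others (u ∷ []) t (≡.sym n≡3) ↭-refl)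
  remainder {u ∷ us} stable t@(kind₃₂ p _ ∷ _) n≡3 =
    let vs , us↭ , _ = remove-orbit stable (here ≈ᵐ-refl) p in ⊥-elim (too-heavy vs us↭)
    where
    too-heavy : ∀ vs → ¬ (u ∷ us ↭ orbit 2 u ++ vs)
    too-heavy vs us↭ = let _ , _ , n≡6+m = weights₃₂ p (Total-↭ us↭ t) in 6+k≢3 (≡.trans (≡.sym n≡6+m) n≡3)

  data Shape (us : List (Maybe Carrier)) : Set (c ⊔ ℓ₁ ⊔ ℓ₂) where
    shape₁ : ∀ u v → Period 3 u → OnG₀ u → Period 3 v → OnG₀ v → us ↭ orbit 3 u ++ orbit 3 v → Shape us
    shape₂ : ∀ u → Period 6 u → OnG₀ u → us ↭ orbit 6 u → Shape us
    shape₃ : ∀ t u → Period 1 t → Period 3 u → OnG₀ u → us ↭ t ∷ orbit 3 u → Shape us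
    shape₄ : ∀ u → Period 3 u → ¬ WeightOne u → Splits 0 (at u) → OffPlanes u → us ↭ orbit 3 u → Shape us
    shape₅ : ∀ u v → Period 1 u → Period 1 v → us ↭ u ∷ v ∷ [] → Shape us
    shape₆ : ∀ u → Period 2 u → ¬ WeightOne u → us ↭ orbit 2 u → Shape us

  -- The orbit of the first parameter decides. Kinds 13 and 31 use up weight 3 and pass the rest to
  -- `remainder`; each of the others exhausts the weight 6, so nothing further remains.
  classify : ∀ {us n} → Stable us → Total us n → n ≡ 6 → Shape us
  classify {u ∷ us} stable t@(kind₁₃ p T ∷ _) n≡6 =
    finish (remainder stable-others total-others (ℕₚ.+-cancelˡ-≡ 3 _ 3 (≡.trans (≡.sym n≡) n≡6)))
    where
    open WeightOneOrbit (remove-weight-one stable t (here ≈ᵐ-refl) p T)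
    v = representative
    finish : Remainder others → Shape (u ∷ us)
    finish (weight-one w p′ T₀ vs↭) = shape₁ v w period₃ onG₀ p′ T₀ (↭-trans decomposition (++⁺ˡ (orbit 3 v) vs↭))
    finish (weight-three w p′ vs↭)  = shape₃ w v p′ period₃ onG₀
      (↭-trans decomposition (↭-trans (++⁺ˡ (orbit 3 v) vs↭) (++-comm (orbit 3 v) (w ∷ []))))
  classify {u ∷ us} stable t@(kind₁₆ p T ∷ _) n≡6 =
    let v , v∈us , p′ , T₀ = normalise stable (here ≈ᵐ-refl) p T
        vs , us↭ , _ = remove-orbit stable v∈us p′
    in shape₂ v p′ T₀ (whole v vs us↭)
    where
    whole : ∀ v vs → u ∷ us ↭ orbit 6 v ++ vs → u ∷ us ↭ orbit 6 v
    whole v []       us↭ = us↭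
    whole v (w ∷ ws) us↭ with ≡.subst (7 ℕ.+ length ws ℕ.≤_) n≡6 (length≤total (Total-↭ us↭ t))
    ... | ℕ.s≤s (ℕ.s≤s (ℕ.s≤s (ℕ.s≤s (ℕ.s≤s (ℕ.s≤s ())))))
  classify {u ∷ us} stable t@(kind₂₃ p ¬T (n , split) off ∷ _) n≡6 =
    let vs , us↭ , _ = remove-orbit stable (Stable⇒act∈ stable (here ≈ᵐ-refl) k) p′
    in shape₄ (σᵐ k u) p′ ¬T′ (Splits-∼ 0 (∼-sym (≋⇒∼ (frobenius-at k u))) (Splits-rotate n split))
         (λ {R} → OffPlanes-σ k {u} (λ {R′} → off {R′}) {R}) (whole vs us↭)
    where
    k = 2 ℕ.* n
    p′ = Period-act k p
    ¬T′ : ¬ WeightOne (σᵐ k u)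
    ¬T′ T = ¬T (WeightOne-σ⁻¹ k {u} T)
    whole : ∀ vs → u ∷ us ↭ orbit 3 (σᵐ k u) ++ vs → u ∷ us ↭ orbit 3 (σᵐ k u)
    whole vs us↭ = let _ , t′ , n≡6+m = weights₂₃ p′ ¬T′ (Total-↭ us↭ t) in
      no-others (orbit 3 (σᵐ k u)) t′ (≡.trans (≡.sym n≡6) n≡6+m) us↭
  classify {u ∷ us} stable (kind₃₁ p _ ∷ t) n≡6 =
    finish (remainder stable′ t (ℕₚ.+-cancelˡ-≡ 3 _ 3 n≡6))
    where
    -- The head is a fixed parameter, so it cancels from both sides of the stability relation.
    stable′ : Stable us
    stable′ = drop-∷ (↭-trans stable (prep (returns p) ↭-refl))
    finish : Remainder us → Shape (u ∷ us)
    finish (weight-one w p′ T₀ us↭) = shape₃ u w p p′ T₀ (↭-prep u us↭)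
    finish (weight-three w p′ us↭)  = shape₅ u w p p′ (↭-prep u us↭)
  classify {u ∷ us} stable t@(kind₃₂ p ¬T ∷ _) n≡6 =
    let vs , us↭ , _ = remove-orbit stable (here ≈ᵐ-refl) p in shape₆ u p ¬T (whole vs us↭)
    where
    whole : ∀ vs → u ∷ us ↭ orbit 2 u ++ vs → u ∷ us ↭ orbit 2 u
    whole vs us↭ = let _ , t′ , n≡6+m = weights₃₂ p (Total-↭ us↭ t) in
      no-others (orbit 2 u) t′ (≡.trans (≡.sym n≡6) n≡6+m) us↭

-- Independence of four points on a normal rational curve of dimension four

module FourthPoint {c ℓ₁ ℓ₂} (K : HeytingField c ℓ₁ ℓ₂) (q : ℕ) (primePower : IsPrimePower q)
                   (card : HasCardinality K (q ℕ.^ 6)) (8≤q : 8 ℕ.≤ q) (Σ∞ : Geometry.Hyperplane K q) where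

  open HeytingField K hiding (zero; Carrier; _≈_; _#_; _+_; _*_; -_; _-_; 0#; 1#; heytingCommutativeRing)
  open Geometry K q
  open FiniteField K (q ℕ.^ 6) card
  open Frobenius K q primePower card
  open Polynomials K (q ℕ.^ 6) card using (x≉y⇒x-y≉0)
  open Coordinates K q primePower card
  open HeytingCommutativeRing heytingCommutativeRing using (commutativeRing)
  open CommutativeRing commutativeRing using (semiring)
  open SumProperties semiring
  open IntegerSolver commutativeRing
  open SetoidReasoning setoid

  apply : Vector Carrier 5 → Vector Carrier 5 → Carrier
  apply h z = sum (λ i → h i * z i)

  -- The coefficients of (x - p₀)(x - p₁)(x - p₂) and of x times it, padded to degree 4.
  cubic quartic : Vector Carrier 3 → Vector Carrier 5
  cubic p 0F = - (p 0F * p 1F * p 2F)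
  cubic p 1F = p 0F * p 1F + p 0F * p 2F + p 1F * p 2F
  cubic p 2F = - (p 0F + p 1F + p 2F)
  cubic p 3F = 1#
  cubic p 4F = 0#
  quartic p 0F      = 0#
  quartic p (suc i) = cubic p (Fin.inject₁ i)

  cubic-at : ∀ p x → apply (cubic p) (standard 4 (just x)) ≈ (x - p 0F) * ((x - p 1F) * (x - p 2F))
  cubic-at p x = solve 4 (λ x a b d →
      ((:- (a :* b :* d)) :* con ℤ.1ℤ :+ ((a :* b :+ a :* d :+ b :* d) :* (x :* con ℤ.1ℤ)
        :+ ((:- (a :+ b :+ d)) :* (x :* (x :* con ℤ.1ℤ)) :+ (con ℤ.1ℤ :* (x :* (x :* (x :* con ℤ.1ℤ)))
        :+ (con ℤ.0ℤ :* (x :* (x :* (x :* (x :* con ℤ.1ℤ)))) :+ con ℤ.0ℤ)))))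
      := ((x :- a) :* ((x :- b) :* (x :- d)))) refl x (p 0F) (p 1F) (p 2F)

  quartic-at : ∀ p x → apply (quartic p) (standard 4 (just x)) ≈ x * ((x - p 0F) * ((x - p 1F) * (x - p 2F)))
  quartic-at p x = solve 4 (λ x a b d →
      (con ℤ.0ℤ :* con ℤ.1ℤ :+ ((:- (a :* b :* d)) :* (x :* con ℤ.1ℤ) :+ ((a :* b :+ a :* d :+ b :* d) :* (x :* (x :* con ℤ.1ℤ))
        :+ ((:- (a :+ b :+ d)) :* (x :* (x :* (x :* con ℤ.1ℤ))) :+ (con ℤ.1ℤ :* (x :* (x :* (x :* (x :* con ℤ.1ℤ)))) :+ con ℤ.0ℤ)))))
      := (x :* ((x :- a) :* ((x :- b) :* (x :- d))))) refl x (p 0F) (p 1F) (p 2F)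

  quartic-at-nothing : ∀ p → apply (quartic p) (standard 4 nothing) ≈ 1#
  quartic-at-nothing p = solve 3 (λ a b d →
      (con ℤ.0ℤ :* con ℤ.0ℤ :+ ((:- (a :* b :* d)) :* con ℤ.0ℤ :+ ((a :* b :+ a :* d :+ b :* d) :* con ℤ.0ℤ
        :+ ((:- (a :+ b :+ d)) :* con ℤ.0ℤ :+ (con ℤ.1ℤ :* con ℤ.1ℤ :+ con ℤ.0ℤ))))) := con ℤ.1ℤ) refl (p 0F) (p 1F) (p 2F)

  roots-vanish : ∀ (p : Vector Carrier 3) k → (p k - p 0F) * ((p k - p 1F) * (p k - p 2F)) ≈ 0#
  roots-vanish p 0F = trans (*-congʳ (-‿inverseʳ _)) (zeroˡ _)
  roots-vanish p 1F = trans (*-congˡ (trans (*-congʳ (-‿inverseʳ _)) (zeroˡ _))) (zeroʳ _)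
  roots-vanish p 2F = trans (*-congˡ (trans (*-congˡ (-‿inverseʳ _)) (zeroʳ _))) (zeroʳ _)

  -- Independence of the basis turns the dependence into one between standard vectors, that is,
  -- between evaluations of polynomials of degree at most 4. A polynomial vanishing at the three
  -- conjugate parameters would then vanish at t, and one is chosen that does not.
  fourth∉conjugates : ∀ {r} (𝒩 : NormalRationalCurve r) (let open NormalRationalCurve 𝒩) → r ≡ 4 →
    ∀ {T P t π} → coordinates T ∼ at t → coordinates P ∼ at (just π) → MaybeAll.All (𝔽 1) t → ¬ 𝔽 1 π →
    ¬ (T ∈⟨ conjugates P ⟩)
  fourth∉conjugates 𝒩 ≡.refl {T} {P} {t} {π} (b , b#0 , T≋) P∼π t-fixed π-moved (a , T≋conj) = excluded t t-fixed relation
    where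
    open NormalRationalCurve 𝒩
    open Subspace space
    open Curve K q primePower card 8≤q Σ∞ 3 (ℕ.s≤s (ℕ.s≤s (ℕ.s≤s (ℕ.s≤s ℕ.z≤n)))) 𝒩 using (frobenius-at; combination-injective)
    p : Vector Carrier 3
    p k = σ (toℕ k) π
    conjugate∼ : ∀ k → conjugates P k ∼ at (just (p k))
    conjugate∼ k = ∼-trans (frobenius-∼ (toℕ k) P∼π) (≋⇒∼ (frobenius-at (toℕ k) (just π)))
    d : Vector Carrier 3
    d k = a k * proj₁ (conjugate∼ k)
    s : Fin 3 → Vector Carrier 5
    s k = standard 4 (just (p k))
    relation : ∀ i → b * standard 4 t i ≈ sum (λ k → d k * s k i)
    relation = combination-injective {v = basis} independent (λ i → b * standard 4 t i) (λ i → sum (λ k → d k * s k i)) λ j → begin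
      combination (λ i → b * standard 4 t i) basis j              ≈⟨ combination-scale b (standard 4 t) basis j ⟩
      b * at t j                                                  ≈⟨ T≋ j ⟨
      coordinates T j                                             ≈⟨ T≋conj j ⟩
      combination a (conjugates P) j                              ≈⟨ sum-cong-≋ {3} (λ k → trans (*-congˡ (proj₂ (proj₂ (conjugate∼ k)) j)) (sym (*-assoc (a k) _ _))) ⟩
      combination d (λ k → combination (s k) basis) j             ≈⟨ combination-combination d s basis j ⟩
      combination (λ i → sum (λ k → d k * s k i)) basis j         ∎
    annihilate : ∀ h {t} → (∀ i → b * standard 4 t i ≈ sum (λ k → d k * s k i)) → (∀ k → apply h (s k) ≈ 0#) → apply h (standard 4 t) ≈ 0#
    annihilate h {t} relation vanish = xy≈0⇒y≈0 (#⇒≉ b#0) (begin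
      b * apply h (standard 4 t)
        ≈⟨ *-distribˡ-sum b (λ i → h i * standard 4 t i) ⟩
      sum (λ i → b * (h i * standard 4 t i))
        ≈⟨ sum-cong-≋ {5} (λ i → trans (solve 3 (λ b h z → (b :* (h :* z)) := (h :* (b :* z))) refl b (h i) (standard 4 t i)) (*-congˡ (relation i))) ⟩
      sum (λ i → h i * sum (λ k → d k * s k i))
        ≈⟨ sum-exchange h d s ⟩
      sum (λ k → d k * apply h (s k))
        ≈⟨ sum≈0 {3} (λ k → d k * apply h (s k)) (λ k → trans (*-congˡ (vanish k)) (zeroʳ (d k))) ⟩
      0# ∎)
    excluded : ∀ t → MaybeAll.All (𝔽 1) t → ¬ (∀ i → b * standard 4 t i ≈ sum (λ k → d k * s k i))
    -- At infinity only the coefficient of x^4 is seen, so x times the cubic is used, where it is 1.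
    excluded nothing _ relation = 1≉0 (trans (sym (quartic-at-nothing p))
      (annihilate (quartic p) {nothing} relation (λ k → trans (quartic-at p (p k)) (trans (*-congˡ (roots-vanish p k)) (zeroʳ _)))))
    excluded (just x) (MaybeAll.just x-fixed) relation = *-≉0 (apart 0F) (*-≉0 (apart 1F) (apart 2F)) (trans (sym (cubic-at p x))
      (annihilate (cubic p) {just x} relation (λ k → trans (cubic-at p (p k)) (roots-vanish p k))))
      where
      apart : ∀ k → ¬ x - p k ≈ 0#
      -- If a rational x were a conjugate of π, then π would be rational too, by injectivity of
      -- `σ (toℕ k)`.
      apart k = x≉y⇒x-y≉0 λ x≈pₖ → π-moved (σ-injective (toℕ k)
        (trans (σ-comm (toℕ k) 1 π) (trans (σ-cong 1 (sym x≈pₖ)) (trans x-fixed x≈pₖ))))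

-- From the orbit types to the six cases

module Assembly {c ℓ₁ ℓ₂} (K : HeytingField c ℓ₁ ℓ₂) (q : ℕ) (primePower : IsPrimePower q)
                (card : HasCardinality K (q ℕ.^ 6)) (8≤q : 8 ℕ.≤ q)
                (Σ∞ : Geometry.Hyperplane K q) (S : Geometry.RegularSpread K q Σ∞)
                (r′ : ℕ) (r≤6 : suc r′ ℕ.≤ 6) (𝒩 : Geometry.NormalRationalCurve K q (suc r′)) where

  open HeytingField K using (trans)
  open Geometry K q
  open Factorisation K (q ℕ.^ 6) card q
  open Coordinates K q primePower card
  open WeightTwo K q primePower card 8≤q Σ∞ S
  open Curve K q primePower card 8≤q Σ∞ r′ r≤6 𝒩
  open FourthPoint K q primePower card 8≤q Σ∞ using (fourth∉conjugates)
  open Classification K q primePower card 8≤q Σ∞ S r′ r≤6 𝒩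
  open NormalRationalCurve 𝒩

  Conclusion : Set _
  Conclusion =
      (suc r′ ≡ 6 × (∃[ P ] ∃[ Q ] (OnG S P × OnG S Q ×
        IntersectionIs 3 Σ∞ 𝒩
          (P ∷ P ^q^ 1 ∷ P ^q^ 2 ∷ Q ∷ Q ^q^ 1 ∷ Q ^q^ 2 ∷ []))))
    ⊎ (suc r′ ≡ 6 × (∃[ P ] (OnG** S P × ¬ OnG S P ×
        IntersectionIs 6 Σ∞ 𝒩
          (P ∷ P ^q^ 1 ∷ P ^q^ 2 ∷ P ^q^ 3 ∷ P ^q^ 4 ∷ P ^q^ 5 ∷ []))))
    ⊎ (suc r′ ≡ 4 × (∃[ T ] ∃[ P ] (OnG S P ×
        CommonPoints 1 Σ∞ 𝒩 (T ∷ []) ×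
        IntersectionIs 3 Σ∞ 𝒩 (T ∷ P ∷ P ^q^ 1 ∷ P ^q^ 2 ∷ []) ×
        ¬ (T ∈⟨ conjugates P ⟩))))
    ⊎ (suc r′ ≡ 3 × (∃[ R ] (
        IntersectionIs 3 Σ∞ 𝒩 (R ∷ R ^q^ 1 ∷ R ^q^ 2 ∷ []) ×
        (∃[ X ] ∃[ Y ] (OnG S X × OnG S Y × X ≉ₚ Y ×
          R ∈⟨ line X (Y ^q^ 1) ⟩ × R ≉ₚ X × R ≉ₚ Y ^q^ 1)))))
    ⊎ (suc r′ ≡ 2 × (∃[ P ] ∃[ Q ] (P ∈ Σ∞ ⟨ 1 ⟩ × Q ∈ Σ∞ ⟨ 1 ⟩ ×
        IntersectionIs 1 Σ∞ 𝒩 (P ∷ Q ∷ []))))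
    ⊎ (suc r′ ≡ 2 × (∃[ P ] (P ∈ Σ∞ ⟨ 6 ⟩ × ¬ (P ∈ Σ∞ ⟨ 3 ⟩) ×
        ¬ OnExtendedTransversal S P ×
        IntersectionIs 6 Σ∞ 𝒩 (P ∷ P ^q^ 3 ∷ []))))

  fixed⇒𝔽 : ∀ k {u} → σᵐ k u ≈ᵐ u → MaybeAll.All (𝔽 k) u
  fixed⇒𝔽 k {just _}  (just eq) = MaybeAll.just eq
  fixed⇒𝔽 k {nothing} nothing   = MaybeAll.nothing

  𝔽⇒fixed : ∀ k {u} → MaybeAll.All (𝔽 k) u → σᵐ k u ≈ᵐ u
  𝔽⇒fixed k (MaybeAll.just eq) = just eq
  𝔽⇒fixed k MaybeAll.nothing   = nothing

  -- A vector over `𝔽 k` is fixed by `frobenius k`, and injectivity of the parametrisation passes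
  -- this on to the parameter. Periods can thus exclude subfields.
  ∈PG⇒fixed : ∀ k {P u} → P ~ u → P ∈PG k → σᵐ k u ≈ᵐ u
  ∈PG⇒fixed k {P} {u} P~u (v , v-over , P∼v) = at-injective (σᵐ k u) u
    (∼-trans (∼-sym (frobenius~ k {u = u} P~u)) (∼-trans (frobenius-∼ k P∼v) (∼-trans (≋⇒∼ v-over) (∼-trans (∼-sym P∼v) P~u))))

  fixed⇒frobenius∼ : ∀ k {P u} → P ~ u → σᵐ k u ≈ᵐ u → frobenius k (coordinates P) ∼ coordinates P
  fixed⇒frobenius∼ k {P} {u} P~u fixed = ∼-trans (frobenius~ k {u = u} P~u) (∼-trans (≋⇒∼ (at-cong fixed)) (∼-sym P~u))

  ~⇒OnG** : ∀ {P u} → P ~ u → OnG₀ u → OnG** S P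
  ~⇒OnG** {P} P~u T₀ = OnTransversal-zero⇒ {P} (OnTransversal-∼ 0 P~u T₀)

  ~⇒OnG : ∀ {P u} → P ~ u → Period 3 u → OnG₀ u → OnG S P
  ~⇒OnG {P} {u} P~u p T₀ = let _ , _ , eq = fixed⇒frobenius∼ 3 {P} {u} P~u (returns p) in
    fixed⇒over 3 (nonZero P) eq , ~⇒OnG** {P} {u} P~u T₀

  conjugate~ : ∀ {P u} i → P ~ u → (P ^q^ i) ~ σᵐ i u
  conjugate~ {P} {u} i P~u = frobenius~ i {u = u} P~u

  start~ : ∀ {P u} → P ~ u → P ~ σᵐ 0 u
  start~ {P} {u} P~u = ~-≈ {P} (≈ᵐ-sym (σᵐ-zero u)) P~u

  start∈ : ∀ u {n vs} → u ∈ orbit (suc n) u ++ vs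
  start∈ u = here (≈ᵐ-sym (σᵐ-zero u))

  outside : ∀ {T P t u} → T ~ t → P ~ u → Period 1 t → Period 3 u → suc r′ ≡ 4 → ¬ (T ∈⟨ conjugates P ⟩)
  outside {T} {P} {t} {just π} T~t P~u pt pu r≡4 =
    fourth∉conjugates 𝒩 r≡4 {T} {P} {t} {π} T~t P~u (fixed⇒𝔽 1 (returns pt))
      (λ π-fixed → minimal pu 1 (ℕ.s≤s ℕ.z≤n) (ℕ.s≤s (ℕ.s≤s ℕ.z≤n)) (just π-fixed))
  outside {u = nothing} _ _ _ pu _ = contradiction nothing (minimal pu 1 (ℕ.s≤s ℕ.z≤n) (ℕ.s≤s (ℕ.s≤s ℕ.z≤n)))

  module _ {us : List (Maybe Carrier)} (len : length us ≡ suc r′) {a : Carrier} (a≉0 : ¬ a ≈ 0#)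
           (form≈ : ∀ θ → Hyperplane.form Σ∞ (at (just θ)) ≈ a * factors us θ)
           {Ps : List Point} (Ps~us : Pointwise _~_ Ps us) where

    open Intersection {us} len {a} a≉0 form≈ hiding (stable)

    pointAt : ∀ {u} → u ∈ us → ∃[ P ] P ~ u
    pointAt = find Ps~us
      where
      find : ∀ {Ps us u} → Pointwise _~_ Ps us → u ∈ us → ∃[ P ] P ~ u
      find (_∷_ {x = P} P~v _) (here u≈v) = P , ~-≈ {P} (≈ᵐ-sym u≈v) P~v
      find (_ ∷ Ps~us) (there u∈us)       = find Ps~us u∈us

    intersectionIs : ∀ k {Qs vs} → Pointwise _~_ Qs vs → us ↭ vs → (∀ {v} → v ∈ vs → σᵐ k v ≈ᵐ v) → IntersectionIs k Σ∞ 𝒩 Qs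
    intersectionIs k Qs~vs us↭vs fixed =
      commonPoints k Qs~vs (λ v∈vs → ∈-resp-↭ (↭-sym us↭vs) v∈vs , fixed⇒𝔽 k (fixed v∈vs)) (λ u∈us _ → ∈-resp-↭ us↭vs u∈us) ,
      meets us↭vs Qs~vs

    atInfinity : ∀ k {P u} → u ∈ us → P ~ u → σᵐ k u ≈ᵐ u → P ∈ Σ∞ ⟨ k ⟩
    atInfinity k {P} {u} u∈us P~u fixed =
      (at u , (λ j → trans (frobenius-at k u j) (at-cong fixed j)) , P~u) , form-∼ Σ∞ P~u (form-at≈0 u u∈us)

    dimension : ∀ {vs} → us ↭ vs → suc r′ ≡ length vs
    dimension us↭vs = ≡.trans (≡.sym len) (xs↭ys⇒|xs|≡|ys| us↭vs)

    conclusion : Shape us → Conclusion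
    conclusion (shape₁ u v pu Tu pv Tv us↭) =
      let P , P~u = pointAt (∈-resp-↭ (↭-sym us↭) (start∈ u {2} {orbit 3 v}))
          Q , Q~v = pointAt (∈-resp-↭ (↭-sym us↭) (there (there (there (start∈ v {2} {[]})))))
      in inj₁ (dimension us↭ , P , Q , ~⇒OnG {P} {u} P~u pu Tu , ~⇒OnG {Q} {v} Q~v pv Tv ,
           intersectionIs 3 (start~ {P} {u} P~u ∷ conjugate~ {P} {u} 1 P~u ∷ conjugate~ {P} {u} 2 P~u ∷
                             start~ {Q} {v} Q~v ∷ conjugate~ {Q} {v} 1 Q~v ∷ conjugate~ {Q} {v} 2 Q~v ∷ []) us↭ fixed)
      where
      fixed : ∀ {w} → w ∈ orbit 3 u ++ orbit 3 v → σᵐ 3 w ≈ᵐ w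
      fixed w∈ with Anyₚ.++⁻ (orbit 3 u) w∈
      ... | inj₁ w∈u = orbit-fixed 3 3 {u} (returns pu) w∈u
      ... | inj₂ w∈v = orbit-fixed 3 3 {v} (returns pv) w∈v
    conclusion (shape₂ u pu Tu us↭) =
      let P , P~u = pointAt (∈-resp-↭ (↭-sym us↭) (start∈ u {5} {[]}))
      in inj₂ (inj₁ (dimension us↭ , P , ~⇒OnG** {P} {u} P~u Tu ,
           -- A point over GF(q^3) would return after three steps, against the period 6.
           (λ (P∈PG , _) → minimal pu 3 (ℕ.s≤s ℕ.z≤n) (ℕ.s≤s (ℕ.s≤s (ℕ.s≤s (ℕ.s≤s ℕ.z≤n)))) (∈PG⇒fixed 3 {P} {u} P~u P∈PG)) ,
           intersectionIs 6 (start~ {P} {u} P~u ∷ conjugate~ {P} {u} 1 P~u ∷ conjugate~ {P} {u} 2 P~u ∷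
                             conjugate~ {P} {u} 3 P~u ∷ conjugate~ {P} {u} 4 P~u ∷ conjugate~ {P} {u} 5 P~u ∷ []) us↭
             (λ {w} _ → σᵐ-6 w)))
    conclusion (shape₃ t u pt pu Tu us↭) =
      let T , T~t = pointAt (∈-resp-↭ (↭-sym us↭) (here ≈ᵐ-refl))
          P , P~u = pointAt (∈-resp-↭ (↭-sym us↭) (there (start∈ u {2} {[]})))
      in inj₂ (inj₂ (inj₁ (dimension us↭ , T , P , ~⇒OnG {P} {u} P~u pu Tu ,
           commonPoints 1 (T~t ∷ []) rational complete ,
           intersectionIs 3 (T~t ∷ start~ {P} {u} P~u ∷ conjugate~ {P} {u} 1 P~u ∷ conjugate~ {P} {u} 2 P~u ∷ []) us↭ fixed ,
           outside {T} {P} {t} {u} T~t P~u pt pu (dimension us↭))))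
      where
      fixed : ∀ {w} → w ∈ t ∷ orbit 3 u → σᵐ 3 w ≈ᵐ w
      fixed (here w≈t)   = orbit-fixed 3 1 {t} (act-* 3 {1} {t} (returns pt)) (here (≈ᵐ-trans w≈t (≈ᵐ-sym (σᵐ-zero t))))
      fixed (there w∈u)  = orbit-fixed 3 3 {u} (returns pu) w∈u
      rational : ∀ {w} → w ∈ t ∷ [] → w ∈ us × MaybeAll.All (𝔽 1) w
      rational (here w≈t) = ∈-resp-↭ (↭-sym us↭) (here w≈t) ,
        fixed⇒𝔽 1 (orbit-fixed 1 1 {t} (returns pt) (here (≈ᵐ-trans w≈t (≈ᵐ-sym (σᵐ-zero t)))))
      complete : ∀ {w} → w ∈ us → MaybeAll.All (𝔽 1) w → w ∈ t ∷ []
      complete w∈us w∈𝔽 with ∈-resp-↭ us↭ w∈us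
      ... | here w≈t  = here w≈t
      -- A parameter in the orbit of u has period 3 and cannot be rational.
      ... | there w∈u = let i , w≈uᵢ = ∈-orbit⁻ 3 {u} w∈u in
              contradiction (𝔽⇒fixed 1 w∈𝔽)
                (minimal (Period-cong (≈ᵐ-sym w≈uᵢ) (Period-act i pu)) 1 (ℕ.s≤s ℕ.z≤n) (ℕ.s≤s (ℕ.s≤s ℕ.z≤n)))
    conclusion (shape₄ u pu ¬Tu split off us↭) =
      let R , R~u = pointAt (∈-resp-↭ (↭-sym us↭) (start∈ u {2} {[]}))
      in inj₂ (inj₂ (inj₂ (inj₁ (dimension us↭ , R ,
           intersectionIs 3 (start~ {R} {u} R~u ∷ conjugate~ {R} {u} 1 R~u ∷ conjugate~ {R} {u} 2 R~u ∷ []) us↭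
             (λ w∈u → orbit-fixed 3 3 {u} (returns pu) w∈u) ,
           fixedSplitting {R} (fixed⇒frobenius∼ 3 {R} {u} R~u (returns pu)) (λ R∈T → ¬Tu (⇒WeightOne {R} {u} R~u R∈T)) (off {R} R~u)
             (Splits-∼ 0 R~u split)))))
    conclusion (shape₅ u v pu pv us↭) =
      let P , P~u = pointAt u∈us
          Q , Q~v = pointAt v∈us
      in inj₂ (inj₂ (inj₂ (inj₂ (inj₁ (dimension us↭ , P , Q , atInfinity 1 {P} {u} u∈us P~u (returns pu) ,
           atInfinity 1 {Q} {v} v∈us Q~v (returns pv) , intersectionIs 1 (P~u ∷ Q~v ∷ []) us↭ fixed)))))
      where
      u∈us : u ∈ us
      u∈us = ∈-resp-↭ (↭-sym us↭) (here ≈ᵐ-refl)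
      v∈us : v ∈ us
      v∈us = ∈-resp-↭ (↭-sym us↭) (there (here ≈ᵐ-refl))
      fixed : ∀ {w} → w ∈ u ∷ v ∷ [] → σᵐ 1 w ≈ᵐ w
      fixed (here w≈u)         = returns (Period-cong (≈ᵐ-sym w≈u) pu)
      fixed (there (here w≈v)) = returns (Period-cong (≈ᵐ-sym w≈v) pv)
    conclusion (shape₆ u pu ¬Tu us↭) =
      let P , P~u = pointAt u∈us
      in inj₂ (inj₂ (inj₂ (inj₂ (inj₂ (dimension us↭ , P , atInfinity 6 {P} {u} u∈us P~u (σᵐ-6 u) ,
           (λ (P∈PG , _) → minimal pu 1 (ℕ.s≤s ℕ.z≤n) (ℕ.s≤s (ℕ.s≤s ℕ.z≤n)) (≈ᵐ-trans σu≈σ³u (∈PG⇒fixed 3 {P} {u} P~u P∈PG))) ,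
           (λ P∈T → ¬Tu (⇒WeightOne {P} {u} P~u P∈T)) ,
           intersectionIs 6 (P~u ∷ conjugate~ {P} {u} 3 P~u ∷ [])
             (↭-trans us↭ (prep (σᵐ-zero u) (prep σu≈σ³u ↭-refl))) (λ {w} _ → σᵐ-6 w))))))
      where
      u∈us : u ∈ us
      u∈us = ∈-resp-↭ (↭-sym us↭) (start∈ u {1} {[]})
      -- For period 2 the point P^(q^3) of the statement is the second orbit point P^q. The same
      -- equality keeps P out of PG(6,q^3), where it would be fixed by `σᵐ 1`.
      σu≈σ³u : σᵐ 1 u ≈ᵐ σᵐ 3 u
      σu≈σ³u = ≈ᵐ-trans (σᵐ-cong 1 (≈ᵐ-sym (returns pu))) (σᵐ-∘ 1 2 u)

open import Data.Nat.Base using (_≤_; _^_)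

theorem5p3 : ∀ {c ℓ₁ ℓ₂} (q : ℕ) → IsPrimePower q → 8 ≤ q →
    (K : HeytingField c ℓ₁ ℓ₂) → HasCardinality K (q ^ 6) →
    let open Geometry K q in
    (Σ∞ : Hyperplane) (S : RegularSpread Σ∞) (r : ℕ) (𝒩 : NormalRationalCurve r) →
    ThreeSpecial S 𝒩 →
    (r ≡ 6 × (∃[ P ] ∃[ Q ] (OnG S P × OnG S Q ×
    IntersectionIs 3 Σ∞ 𝒩
    (P ∷ P ^q^ 1 ∷ P ^q^ 2 ∷ Q ∷ Q ^q^ 1 ∷ Q ^q^ 2 ∷ []))))
    ⊎ (r ≡ 6 × (∃[ P ] (OnG** S P × ¬ OnG S P ×
    IntersectionIs 6 Σ∞ 𝒩
    (P ∷ P ^q^ 1 ∷ P ^q^ 2 ∷ P ^q^ 3 ∷ P ^q^ 4 ∷ P ^q^ 5 ∷ []))))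
    ⊎ (r ≡ 4 × (∃[ T ] ∃[ P ] (OnG S P ×
    CommonPoints 1 Σ∞ 𝒩 (T ∷ []) ×
    IntersectionIs 3 Σ∞ 𝒩 (T ∷ P ∷ P ^q^ 1 ∷ P ^q^ 2 ∷ []) ×
    ¬ (T ∈⟨ conjugates P ⟩))))
    ⊎ (r ≡ 3 × (∃[ R ] (
    IntersectionIs 3 Σ∞ 𝒩 (R ∷ R ^q^ 1 ∷ R ^q^ 2 ∷ []) ×
    (∃[ X ] ∃[ Y ] (OnG S X × OnG S Y × X ≉ₚ Y ×
    R ∈⟨ line X (Y ^q^ 1) ⟩ × R ≉ₚ X × R ≉ₚ Y ^q^ 1)))))
    ⊎ (r ≡ 2 × (∃[ P ] ∃[ Q ] (P ∈ Σ∞ ⟨ 1 ⟩ × Q ∈ Σ∞ ⟨ 1 ⟩ ×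
    IntersectionIs 1 Σ∞ 𝒩 (P ∷ Q ∷ []))))
    ⊎ (r ≡ 2 × (∃[ P ] (P ∈ Σ∞ ⟨ 6 ⟩ × ¬ (P ∈ Σ∞ ⟨ 3 ⟩) ×
    ¬ OnExtendedTransversal S P ×
    IntersectionIs 6 Σ∞ 𝒩 (P ∷ P ^q^ 3 ∷ []))))
-- In dimension 0 there are no intersection points, and the weights would add up to 0 instead of 6.
theorem5p3 q primePower 8≤q K card Σ∞ S zero 𝒩 (_ , _ , _ , ([] , _ , [] , _) , ([] , [] , ()) , _)
theorem5p3 q primePower 8≤q K card Σ∞ S (suc r′) 𝒩 (r≤6 , _ , Ps , (us , len , Ps~us , a , a#0 , form≈) , (ws , weights , sum≡6) , good) =
  conclusion len (#⇒≉ a#0) form≈ Ps~us (classify stable (total Ps~us weights good) sum≡6)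
  where
  open FiniteField K (q ^ 6) card using (#⇒≉)
  open Classification K q primePower card 8≤q Σ∞ S r′ r≤6 𝒩
  open Assembly K q primePower card 8≤q Σ∞ S r′ r≤6 𝒩
  open Curve.Intersection K q primePower card 8≤q Σ∞ r′ r≤6 𝒩 {us} len {a} (#⇒≉ a#0) form≈ using (stable)
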